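{- Let $K = \mathbb{Q}[\sqrt{D}]$ be a real quadratic number field, where $D \in \mathbb{N}$ is square-free, and let $\alpha \in K$ with $\alpha > 0$ (under the real embedding of $K$). Then for every $\varepsilon > 0$ there is a constant $C = C(\alpha,\varepsilon)>0$ such that $\delta_{\min}^{(\alpha)}(N) \le C\, N^{ -1+\varepsilon}$ for infinitely many $N$. Furthermore, if $\alpha \in \mathbb{Q}_{>0}\cdot (K^\times)^2$ (i.e. $\alpha = r\gamma^2$ with $r$ a positive rational and $\gamma \in K^\times$), then there is a constant $C = C(\alpha)>0$ such that $\delta_{\min}^{(\alpha)}(N) \le C\, N^{ -1}$ for all $N$.
   Context: For a positive irrational real number $\alpha$, the numbers $\alpha m^2 + n^2$ with integers $m,n \ge 1$ (the eigenvalues of the Laplacian on a rectangular billiard with sides $\pi/\sqrt{\alpha}$ and $\pi$) are pairwise distinct, and we list them in increasing order as $0 < \lambda_1 < \lambda_2 < \cdots$. The minimal gap function is $\delta_{\min}^{(\alpha)}(N) = \min\{\lambda_{i+1} - \lambda_i : 1 \le i < N\}$. Here $\alpha \in K$ is assumed irrational implicitly via $\alpha$ being a quadratic irrationality; $K$ is regarded as a subfield of $\mathbb{R}$ via $\sqrt{D} > 0$. -}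

module Defs where

open import Data.Nat as ℕ using (ℕ; zero; suc)
open import Data.Nat.Divisibility using (_∣_)
open import Data.Integer using (+_)
open import Data.Rational using (ℚ; 0ℚ; _+_; _*_; _-_; -_; _<_; _≤_)
open import Data.Rational.Properties using (_<?_; _≤?_)
open import Data.Bool using (Bool; true; false; _∧_; _∨_; not; if_then_else_; T)
open import Data.Product using (_×_; _,_; Σ; ∃; proj₁; proj₂)
open import Relation.Nullary.Decidable using (⌊_⌋)
open import Relation.Binary.PropositionalEquality using (_≡_)

SquareFree : ℕ → Set
SquareFree D = ∀ p → p ℕ.* p ∣ D → p ≡ 1

ℕ→ℚ : ℕ → ℚ
ℕ→ℚ n = + n Data.Rational./ 1

-- Elements of K = ℚ[√D]: a pair (a , b) represents a + b √D.
K : Set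
K = ℚ × ℚ

module Field (D : ℕ) where
  Dq : ℚ
  Dq = ℕ→ℚ D

  _+K_ : K → K → K
  (a , b) +K (c , d) = (a + c , b + d)

  _-K_ : K → K → K
  (a , b) -K (c , d) = (a - c , b - d)

  _*K_ : K → K → K
  (a , b) *K (c , d) = (a * c + Dq * (b * d) , a * d + b * c)

  ι : ℚ → K
  ι q = (q , 0ℚ)

  ιℕ : ℕ → K
  ιℕ n = ι (ℕ→ℚ n)

  _^K_ : K → ℕ → K
  x ^K zero = ι (ℕ→ℚ 1)
  x ^K suc k = x *K (x ^K k)

  private
    le : ℚ → ℚ → Bool
    le x y = ⌊ x ≤? y ⌋
    lt : ℚ → ℚ → Bool
    lt x y = ⌊ x <? y ⌋

  -- a + b√D > 0 for the real embedding with √D > 0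
  posB : K → Bool
  posB (a , b) with le 0ℚ a | le 0ℚ b
  ... | true  | true  = lt 0ℚ a ∨ lt 0ℚ b
  ... | true  | false = lt (b * b * Dq) (a * a)
  ... | false | true  = lt (a * a) (b * b * Dq)
  ... | false | false = false

  -- a + b√D ≥ 0 for the real embedding with √D > 0
  nonnegB : K → Bool
  nonnegB (a , b) with le 0ℚ a | le 0ℚ b
  ... | true  | true  = true
  ... | true  | false = le (b * b * Dq) (a * a)
  ... | false | true  = le (a * a) (b * b * Dq)
  ... | false | false = false

  Pos : K → Set
  Pos x = T (posB x)

  _≤K_ : K → K → Set
  x ≤K y = T (nonnegB (y -K x))

  ev : K → ℕ → ℕ → K
  ev α m n = (α *K ιℕ (m ℕ.* m)) +K ιℕ (n ℕ.* n)

  countRow : K → K → ℕ → ℕ → ℕ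
  countRow α μ m zero = 0
  countRow α μ m (suc n) =
    (if nonnegB (μ -K ev α m (suc n)) then 1 else 0) ℕ.+ countRow α μ m n

  countBox : K → K → ℕ → ℕ → ℕ
  countBox α μ zero B' = 0
  countBox α μ (suc m) B' = countRow α μ (suc m) B' ℕ.+ countBox α μ m B'

  IsEig : K → K → Set
  IsEig α μ = ∃ λ m → ∃ λ n → (1 ℕ.≤ m) × (1 ℕ.≤ n) × ev α m n ≡ μ

  -- #{(m , n) : m , n ≥ 1, α m² + n² ≤ μ} = k
  -- (the set is contained in the box {1..B}², on which it has k elements)
  CountLe : K → K → ℕ → Set
  CountLe α μ k = Σ ℕ λ B →
      (∀ m n → 1 ℕ.≤ m → 1 ℕ.≤ n → ev α m n ≤K μ → (m ℕ.≤ B) × (n ℕ.≤ B))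
    × countBox α μ B B ≡ k

  -- λ_i = μ : μ is an eigenvalue and exactly i eigenvalues are ≤ μ
  -- (eigenvalues are pairwise distinct for irrational α)
  IsLambda : K → ℕ → K → Set
  IsLambda α i μ = IsEig α μ × CountLe α μ i

  -- δ_min(N) ≤ bound, where bound is a predicate on the gap value g :
  -- min {λ_{i+1} - λ_i : 1 ≤ i < N} satisfies the predicate Bnd
  -- (Bnd is monotone in all uses, so "min satisfies" ⇔ "some gap satisfies")
  DeltaMinLe : K → ℕ → (K → Set) → Set
  DeltaMinLe α N Bnd = ∃ λ i → (1 ℕ.≤ i) × (i ℕ.< N) ×
    (∃ λ μ → ∃ λ μ' → IsLambda α i μ × IsLambda α (suc i) μ' × Bnd (μ' -K μ))

{-# OPTIONS --safe #-}
module Submission where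

-- Let a₀ + b₀√D be a multiple of α, with conjugate x₀.  For z = z₀ + z₁√D one has
-- (a₀ + b₀√D) z₁ − Im (x₀ z) = b₀ z.  Taking z to be the square of θ = u − v√D close to 0, z₁ is a
-- product of two integers of the same size, and a good approximation to α by quotients cd/ab of
-- such products yields a small gap, since 8ab and 8cd are differences of squares.
--
-- If α is a rational multiple of γ², then Im (γ̄² θ²) is again a product of two balanced factors, and
-- Dirichlet's theorem supplies θ = κ = x − y√D with |κ| ≤ 1/N at every scale N.
--
-- In general choose θ = (x₀ κ²)^t κ, so that x₀ θ² = σ^L with σ = x₀ κ² and L = 2t + 1.  The factors
-- of y^L − x^L are balanced for L = 2^(2^n) − 1: with F = L + 2, on passing from L to L F the
-- factor E of degree (L + 1)/2 is replaced by E(x^F, y^F) / E(x, y) of degree (L F + 1)/2, which is a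
-- polynomial because F ≡ 2 modulo L and E(x, y) divides E(x², y²) = E(x, y) E(−x, y).

open import Level using (0ℓ)
open import Algebra.Bundles using (CommutativeRing)
open import Algebra.Structures using (IsCommutativeRing)
import Algebra.Properties.CommutativeSemigroup
import Algebra.Properties.Ring
import Algebra.Solver.Ring
import Algebra.Solver.Ring.AlmostCommutativeRing as ACR
open import Data.Bool using (Bool; true; false; T; if_then_else_)
open import Data.Bool.Properties using (T?)
open import Data.Empty using (⊥-elim)
open import Data.Fin using (Fin; toℕ)
import Data.Fin.Properties as Finₚ
open import Data.Integer as ℤ using (ℤ; -[1+_]; 0ℤ) renaming (+_ to pos)
import Data.Integer.Properties as ℤₚ
open import Data.List using (List; []; _∷_; upTo; cartesianProduct)
open import Data.List.Membership.Propositional.Properties using (∈-cartesianProduct⁺; ∈-upTo⁺)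
open import Data.List.Relation.Unary.All as All using (All; []; _∷_)
open import Data.Maybe using (Maybe; just; nothing)
open import Data.Nat as ℕ using (ℕ; zero; suc)
import Data.Nat.Coprimality as Coprimality
open import Data.Nat.Divisibility using (_∣_; divides; ∣-refl)
open import Data.Nat.DivMod using (_mod_; _/_; _%_; m≡m%n+[m/n]*n)
import Data.Nat.Properties as ℕₚ
import Data.Nat.Solver
open import Data.Product using (_×_; _,_; Σ; ∃; proj₁; proj₂)
open import Data.Rational as ℚ using (ℚ; mkℚ; 0ℚ; 1ℚ; toℚᵘ)
import Data.Rational.Properties as ℚₚ
open import Data.Rational.Unnormalised as ℚᵘ using (mkℚᵘ; *≡*)
import Data.Rational.Unnormalised.Properties as ℚᵘₚ
open import Data.Sum using (_⊎_; inj₁; inj₂; [_,_]′)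
open import Data.Unit using (tt)
open import Defs
open import Relation.Binary.Bundles using (Poset)
open import Relation.Binary.Definitions using (tri<; tri≈; tri>)
open import Relation.Binary.PropositionalEquality
import Relation.Binary.Reasoning.PartialOrder
open import Relation.Nullary using (¬_; yes; no; Dec)
open import Relation.Nullary.Decidable using (⌊_⌋; map′; _×-dec_; ¬?)

-- Sizes explain the exponents. If the four factors a, b, c, d are at most S, the eigenvalues used
-- have O(S²) predecessors, so N is of order S². With κ of order 1/X and κ̄ of order X, the gap has
-- order θ² = X^(-2L), while the factors have orders X^L, X^L, X^(L + 1) and X^(L - 1). The largest
-- one fixes S, so N times the gap has order X² = N^(1/(L + 1)). The excess of one degree in the
-- splitting of y^L - x^L is thus the whole loss ε. It cannot be avoided in this way, since L has to
-- be odd for x₀ times a square to be the power σ^L. The exponents L are products of consecutive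
-- Fermat numbers F. As long as these are prime, E is up to sign the homogenised cyclotomic
-- polynomial of index L, and its degree is φ(L) = (L + 1)/2; the recursion for E never uses that F
-- is prime. No polynomial ring is needed: identities for E are proved at pairs (x, y) where E does
-- not vanish, by cancelling values of E.

module ℕₛ = Data.Nat.Solver.+-*-Solver
open Algebra.Properties.CommutativeSemigroup ℕₚ.+-commutativeSemigroup
  using () renaming (interchange to +-interchange)

-- Ordered domains

-- Instantiated with ℚ and then with ℚ[√D]: the order on the field is algebraic, and real numbers
-- never enter.
record OrderedDomain : Set₁ where
  infixl 7 _*_
  infixl 6 _+_
  infix 8 -_
  field
    Carrier : Set
    _+_ _*_ : Carrier → Carrier → Carrier
    -_ : Carrier → Carrier
    0# 1# : Carrier
    isCommutativeRing : IsCommutativeRing _≡_ _+_ _*_ -_ 0# 1#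
    NonNeg : Carrier → Set
    nonNeg-+ : ∀ {x y} → NonNeg x → NonNeg y → NonNeg (x + y)
    nonNeg-* : ∀ {x y} → NonNeg x → NonNeg y → NonNeg (x * y)
    nonNeg-total : ∀ x → NonNeg x ⊎ NonNeg (- x)
    nonNeg-antisym : ∀ {x} → NonNeg x → NonNeg (- x) → x ≡ 0#
    1≢0 : 1# ≢ 0#
    zero-product : ∀ x y → x * y ≡ 0# → x ≡ 0# ⊎ y ≡ 0#

module OrderedDomainProperties (R : OrderedDomain) where
  open OrderedDomain R public
  open IsCommutativeRing isCommutativeRing public
    using (+-assoc; +-comm; +-identityˡ; +-identityʳ; *-assoc; *-comm; *-identityˡ; *-identityʳ; zeroˡ; zeroʳ; -‿inverseʳ; -‿inverseˡ; distribˡ; distribʳ)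

  commutativeRing : CommutativeRing 0ℓ 0ℓ
  commutativeRing = record { isCommutativeRing = isCommutativeRing }

  open Algebra.Properties.Ring (CommutativeRing.ring commutativeRing)
    using (-‿distribˡ-*; -‿distribʳ-*; -‿involutive; -‿+-comm; -0#≈0#)

  -- The separate clause for 1 makes `fromℕ 1` equal to `1#` by computation, as the coefficient
  -- morphism of the ring solver and its constants `con (pos 1)` require.
  fromℕ : ℕ → Carrier
  fromℕ zero = 0#
  fromℕ (suc zero) = 1#
  fromℕ (suc (suc n)) = 1# + fromℕ (suc n)

  fromℕ-suc : ∀ n → fromℕ (suc n) ≡ 1# + fromℕ n
  fromℕ-suc zero = sym (+-identityʳ 1#)
  fromℕ-suc (suc n) = refl

  fromℤ : ℤ → Carrier
  fromℤ (pos n) = fromℕ n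
  fromℤ -[1+ n ] = - fromℕ (suc n)

  fromℕ-+ : ∀ m n → fromℕ (m ℕ.+ n) ≡ fromℕ m + fromℕ n
  fromℕ-+ zero n = sym (+-identityˡ _)
  fromℕ-+ (suc m) n = trans (fromℕ-suc (m ℕ.+ n)) (trans (cong (1# +_) (fromℕ-+ m n))
    (trans (sym (+-assoc 1# _ _)) (cong (_+ fromℕ n) (sym (fromℕ-suc m)))))

  fromℕ-* : ∀ m n → fromℕ (m ℕ.* n) ≡ fromℕ m * fromℕ n
  fromℕ-* zero n = sym (zeroˡ _)
  fromℕ-* (suc m) n = trans (fromℕ-+ n (m ℕ.* n))
    (trans (cong₂ _+_ (sym (*-identityˡ _)) (fromℕ-* m n))
    (trans (sym (distribʳ (fromℕ n) 1# (fromℕ m))) (cong (_* fromℕ n) (sym (fromℕ-suc m)))))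

  fromℤ-neg : ∀ i → fromℤ (ℤ.- i) ≡ - fromℤ i
  fromℤ-neg (pos zero) = sym -0#≈0#
  fromℤ-neg (pos (suc n)) = refl
  fromℤ-neg -[1+ n ] = sym (-‿involutive _)

  fromℤ-⊖ : ∀ m n → fromℤ (m ℤ.⊖ n) ≡ fromℕ m + - fromℕ n
  fromℤ-⊖ m zero = trans (cong fromℤ (ℤₚ.⊖-≥ {m} {0} ℕ.z≤n)) (sym (trans (cong (fromℕ m +_) -0#≈0#) (+-identityʳ _)))
  fromℤ-⊖ zero (suc n) = sym (+-identityˡ _)
  fromℤ-⊖ (suc m) (suc n) = trans (cong fromℤ (ℤₚ.[1+m]⊖[1+n]≡m⊖n m n)) (trans (fromℤ-⊖ m n)
    (sym (trans (cong₂ (λ u v → u + - v) (fromℕ-suc m) (fromℕ-suc n)) lem)))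
    where
    a = fromℕ m
    b = fromℕ n
    lem : (1# + a) + - (1# + b) ≡ a + - b
    lem = begin
      (1# + a) + - (1# + b) ≡⟨ cong ((1# + a) +_) (sym (-‿+-comm 1# b)) ⟩
      (1# + a) + (- 1# + - b) ≡⟨ cong (_+ (- 1# + - b)) (+-comm 1# a) ⟩
      (a + 1#) + (- 1# + - b) ≡⟨ +-assoc a 1# _ ⟩
      a + (1# + (- 1# + - b)) ≡⟨ cong (a +_) (sym (+-assoc 1# _ _)) ⟩
      a + ((1# + - 1#) + - b) ≡⟨ cong (λ z → a + (z + - b)) (-‿inverseʳ 1#) ⟩
      a + (0# + - b) ≡⟨ cong (a +_) (+-identityˡ _) ⟩
      a + - b ∎
      where open ≡-Reasoning

  fromℤ-+ : ∀ i j → fromℤ (i ℤ.+ j) ≡ fromℤ i + fromℤ j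
  fromℤ-+ (pos m) (pos n) = fromℕ-+ m n
  fromℤ-+ (pos m) -[1+ n ] = fromℤ-⊖ m (suc n)
  fromℤ-+ -[1+ m ] (pos n) = trans (fromℤ-⊖ n (suc m)) (+-comm _ _)
  fromℤ-+ -[1+ m ] -[1+ n ] = trans (cong (λ k → - fromℕ (suc k)) (sym (ℕₚ.+-suc m n)))
    (trans (cong -_ (fromℕ-+ (suc m) (suc n))) (sym (-‿+-comm _ _)))

  fromℤ-* : ∀ i j → fromℤ (i ℤ.* j) ≡ fromℤ i * fromℤ j
  fromℤ-* (pos m) (pos n) = trans (cong fromℤ (sym (ℤₚ.pos-* m n))) (fromℕ-* m n)
  fromℤ-* (pos m) -[1+ n ] = trans (cong fromℤ (trans (sym (ℤₚ.neg-distribʳ-* (pos m) (pos (suc n)))) (cong ℤ.-_ (sym (ℤₚ.pos-* m (suc n))))))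
    (trans (fromℤ-neg (pos (m ℕ.* suc n))) (trans (cong -_ (fromℕ-* m (suc n))) (-‿distribʳ-* _ _)))
  fromℤ-* -[1+ m ] (pos n) = trans (cong fromℤ (trans (sym (ℤₚ.neg-distribˡ-* (pos (suc m)) (pos n))) (cong ℤ.-_ (sym (ℤₚ.pos-* (suc m) n)))))
    (trans (fromℤ-neg (pos (suc m ℕ.* n))) (trans (cong -_ (fromℕ-* (suc m) n)) (-‿distribˡ-* _ _)))
  fromℤ-* -[1+ m ] -[1+ n ] = trans (fromℕ-* (suc m) (suc n))
    (sym (trans (sym (-‿distribˡ-* _ _)) (trans (cong -_ (sym (-‿distribʳ-* _ _))) (-‿involutive _))))

  private
    almost : ACR.AlmostCommutativeRing 0ℓ 0ℓ
    almost = ACR.fromCommutativeRing commutativeRing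
    morphism : CommutativeRing.rawRing ℤₚ.+-*-commutativeRing ACR.-Raw-AlmostCommutative⟶ almost
    morphism = record { ⟦_⟧ = fromℤ ; +-homo = fromℤ-+ ; *-homo = fromℤ-* ; -‿homo = fromℤ-neg ; 0-homo = refl ; 1-homo = refl }
    coeff≟ : ∀ i j → Maybe (fromℤ i ≡ fromℤ j)
    coeff≟ i j with i ℤ.≟ j
    ... | yes p = just (cong fromℤ p)
    ... | no _ = nothing

  open Algebra.Solver.Ring (CommutativeRing.rawRing ℤₚ.+-*-commutativeRing) almost morphism coeff≟ public
    using (solve; _:=_; _:+_; _:*_; :-_; con; _:-_)

  infixl 6 _-_
  _-_ : Carrier → Carrier → Carrier
  x - y = x + - y

  infixr 8 _^_
  _^_ : Carrier → ℕ → Carrier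
  x ^ zero = 1#
  x ^ suc n = x * x ^ n

  infix 4 _≤_ _<_
  -- A record rather than a synonym for `NonNeg (y - x)`, so that both sides can be inferred from
  -- the type of a proof.
  record _≤_ (x y : Carrier) : Set where
    constructor fromDiff
    field diff : NonNeg (y - x)
  open _≤_ public

  _<_ : Carrier → Carrier → Set
  x < y = x ≤ y × x ≢ y

  private
    by : ∀ {x y z} → z ≡ y - x → NonNeg z → x ≤ y
    by e p = fromDiff (subst NonNeg e p)

  nonNeg⇒0≤ : ∀ {x} → NonNeg x → 0# ≤ x
  nonNeg⇒0≤ {x} = by (solve 1 (λ x → x := x :- con (pos 0)) refl x)

  0≤⇒nonNeg : ∀ {x} → 0# ≤ x → NonNeg x
  0≤⇒nonNeg {x} p = subst NonNeg (solve 1 (λ x → x :- con (pos 0) := x) refl x) (diff p)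

  ≤-reflexive : ∀ {x y} → x ≡ y → x ≤ y
  -- Nonnegativity of zero is not an axiom; it follows from totality, because -0 = 0.
  ≤-reflexive {x} refl with nonNeg-total 0#
  ... | inj₁ p = by (sym (-‿inverseʳ x)) p
  ... | inj₂ p = by (trans -0#≈0# (sym (-‿inverseʳ x))) p

  ≤-refl : ∀ {x} → x ≤ x
  ≤-refl = ≤-reflexive refl

  ≤-trans : ∀ {x y z} → x ≤ y → y ≤ z → x ≤ z
  ≤-trans {x} {y} {z} p q = by (solve 3 (λ x y z → (y :- x) :+ (z :- y) := z :- x) refl x y z) (nonNeg-+ (diff p) (diff q))

  x-y≡0⇒x≡y : ∀ {x y} → x - y ≡ 0# → x ≡ y
  x-y≡0⇒x≡y {x} {y} e = trans (solve 2 (λ x y → x := (x :- y) :+ y) refl x y) (trans (cong (_+ y) e) (+-identityˡ y))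

  ≤-antisym : ∀ {x y} → x ≤ y → y ≤ x → x ≡ y
  ≤-antisym {x} {y} p q = sym (x-y≡0⇒x≡y (nonNeg-antisym (diff p)
    (subst NonNeg (solve 2 (λ x y → x :- y := :- (y :- x)) refl x y) (diff q))))

  ≤-total : ∀ x y → x ≤ y ⊎ y ≤ x
  ≤-total x y with nonNeg-total (y - x)
  ... | inj₁ p = inj₁ (fromDiff p)
  ... | inj₂ p = inj₂ (by (solve 2 (λ x y → :- (y :- x) := x :- y) refl x y) p)

  ≰⇒≥ : ∀ {x y} → ¬ (x ≤ y) → y ≤ x
  ≰⇒≥ {x} {y} p with ≤-total x y
  ... | inj₁ q = ⊥-elim (p q)
  ... | inj₂ q = q

  <⇒≱ : ∀ {x y} → x < y → ¬ (y ≤ x)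
  <⇒≱ (p , ne) q = ne (≤-antisym p q)

  ≰⇒> : ∀ {x y} → ¬ (x ≤ y) → y < x
  ≰⇒> p = ≰⇒≥ p , λ e → p (≤-reflexive (sym e))

  <-≤-trans : ∀ {x y z} → x < y → y ≤ z → x < z
  <-≤-trans (p , ne) q = ≤-trans p q , λ { refl → ne (≤-antisym p q) }

  ≤-<-trans : ∀ {x y z} → x ≤ y → y < z → x < z
  ≤-<-trans p (q , ne) = ≤-trans p q , λ { refl → ne (≤-antisym q p) }

  +-mono-≤ : ∀ {x y u v} → x ≤ y → u ≤ v → x + u ≤ y + v
  +-mono-≤ {x} {y} {u} {v} p q = by (solve 4 (λ x y u v → (y :- x) :+ (v :- u) := (y :+ v) :- (x :+ u)) refl x y u v) (nonNeg-+ (diff p) (diff q))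

  +-monoˡ-≤ : ∀ {x y} z → x ≤ y → x + z ≤ y + z
  +-monoˡ-≤ z p = +-mono-≤ p ≤-refl

  +-monoʳ-≤ : ∀ {x y} z → x ≤ y → z + x ≤ z + y
  +-monoʳ-≤ z p = +-mono-≤ (≤-refl {z}) p

  neg-mono-≤ : ∀ {x y} → x ≤ y → - y ≤ - x
  neg-mono-≤ {x} {y} p = by (solve 2 (λ x y → y :- x := :- x :- :- y) refl x y) (diff p)

  *-nonNeg : ∀ {x y} → 0# ≤ x → 0# ≤ y → 0# ≤ x * y
  *-nonNeg p q = nonNeg⇒0≤ (nonNeg-* (0≤⇒nonNeg p) (0≤⇒nonNeg q))

  +-nonNeg : ∀ {x y} → 0# ≤ x → 0# ≤ y → 0# ≤ x + y
  +-nonNeg p q = nonNeg⇒0≤ (nonNeg-+ (0≤⇒nonNeg p) (0≤⇒nonNeg q))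

  *-monoˡ-≤ : ∀ {x y} z → 0# ≤ z → x ≤ y → z * x ≤ z * y
  *-monoˡ-≤ {x} {y} z p q = by (solve 3 (λ x y z → z :* (y :- x) := z :* y :- z :* x) refl x y z) (nonNeg-* (0≤⇒nonNeg p) (diff q))

  *-monoʳ-≤ : ∀ {x y} z → 0# ≤ z → x ≤ y → x * z ≤ y * z
  *-monoʳ-≤ {x} {y} z p q = by (solve 3 (λ x y z → z :* (y :- x) := y :* z :- x :* z) refl x y z) (nonNeg-* (0≤⇒nonNeg p) (diff q))

  *-mono-≤ : ∀ {x y u v} → 0# ≤ x → 0# ≤ v → x ≤ y → u ≤ v → x * u ≤ y * v
  *-mono-≤ {x} {y} {u} {v} px pv p q = ≤-trans (*-monoˡ-≤ x px q) (*-monoʳ-≤ v pv p)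

  0≤x*x : ∀ x → 0# ≤ x * x
  0≤x*x x with nonNeg-total x
  ... | inj₁ p = nonNeg⇒0≤ (nonNeg-* p p)
  ... | inj₂ p = nonNeg⇒0≤ (subst NonNeg (solve 1 (λ x → :- x :* :- x := x :* x) refl x) (nonNeg-* p p))

  0≤1 : 0# ≤ 1#
  0≤1 = ≤-trans (0≤x*x 1#) (≤-reflexive (*-identityˡ 1#))

  0<1 : 0# < 1#
  0<1 = 0≤1 , λ e → 1≢0 (sym e)

  *-≢0 : ∀ {x y} → x ≢ 0# → y ≢ 0# → x * y ≢ 0#
  *-≢0 {x} {y} p q e = [ p , q ]′ (zero-product x y e)

  *-pos : ∀ {x y} → 0# < x → 0# < y → 0# < x * y
  *-pos (p , ne) (q , ne′) = *-nonNeg p q , λ e → *-≢0 (λ e → ne (sym e)) (λ e → ne′ (sym e)) (sym e)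

  +-pos-nonNeg : ∀ {x y} → 0# < x → 0# ≤ y → 0# < x + y
  +-pos-nonNeg {x} {y} p q = <-≤-trans p (by (solve 2 (λ x y → y := (x :+ y) :- x) refl x y) (0≤⇒nonNeg q))

  *-cancelˡ : ∀ {x y z} → z ≢ 0# → z * x ≡ z * y → x ≡ y
  *-cancelˡ {x} {y} {z} nz e with zero-product z (x - y) (trans (solve 3 (λ x y z → z :* (x :- y) := z :* x :- z :* y) refl x y z) (trans (cong (_- (z * y)) e) (-‿inverseʳ _)))
  ... | inj₁ p = ⊥-elim (nz p)
  ... | inj₂ p = x-y≡0⇒x≡y p

  *-cancelʳ : ∀ {x y z} → z ≢ 0# → x * z ≡ y * z → x ≡ y
  *-cancelʳ {x} {y} {z} nz e = *-cancelˡ nz (trans (*-comm z x) (trans e (*-comm y z)))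

  *-cancelˡ-≤ : ∀ {x y z} → 0# < z → z * x ≤ z * y → x ≤ y
  *-cancelˡ-≤ {x} {y} {z} (p , ne) q with ≤-total x y
  ... | inj₁ r = r
  ... | inj₂ r = ≤-reflexive (*-cancelˡ (λ e → ne (sym e)) (≤-antisym q (*-monoˡ-≤ z p r)))

  -- If y ≤ x, the squares agree and (x - y)(x + y) = 0. The second factor vanishing gives x ≤ x + y
  -- = 0 ≤ y.
  square-cancel-≤ : ∀ {x y} → 0# ≤ y → x * x ≤ y * y → x ≤ y
  square-cancel-≤ {x} {y} py q with ≤-total x y
  ... | inj₁ r = r
  ... | inj₂ r with zero-product (x - y) (x + y) (trans (solve 2 (λ x y → (x :- y) :* (x :+ y) := x :* x :- y :* y) refl x y)
                 (trans (cong (_- (y * y)) (≤-antisym q (*-mono-≤ py (≤-trans py r) r r))) (-‿inverseʳ _)))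
  ...   | inj₁ e = ≤-reflexive (x-y≡0⇒x≡y e)
  ...   | inj₂ e = ≤-trans (≤-trans (by (solve 2 (λ x y → y := (x :+ y) :- x) refl x y) (0≤⇒nonNeg py)) (≤-reflexive e)) py

  square-mono-≤ : ∀ {x y} → 0# ≤ x → x ≤ y → x * x ≤ y * y
  square-mono-≤ p q = *-mono-≤ p (≤-trans p q) q q

  x≤y+x : ∀ {x y} → 0# ≤ y → x ≤ y + x
  x≤y+x {x} {y} p = by (solve 2 (λ x y → y := (y :+ x) :- x) refl x y) (0≤⇒nonNeg p)

  fromℕ-nonNeg : ∀ n → 0# ≤ fromℕ n
  fromℕ-nonNeg zero = ≤-refl
  fromℕ-nonNeg (suc n) = ≤-trans (+-nonNeg 0≤1 (fromℕ-nonNeg n)) (≤-reflexive (sym (fromℕ-suc n)))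

  fromℕ-pos : ∀ n → 0# < fromℕ (suc n)
  fromℕ-pos n = subst (0# <_) (sym (fromℕ-suc n)) (+-pos-nonNeg 0<1 (fromℕ-nonNeg n))

  fromℕ-mono : ∀ {m n} → m ℕ.≤ n → fromℕ m ≤ fromℕ n
  fromℕ-mono {m} {n} p = subst (λ k → fromℕ m ≤ fromℕ k) (ℕₚ.m∸n+n≡m p)
    (subst (fromℕ m ≤_) (sym (fromℕ-+ (n ℕ.∸ m) m)) (x≤y+x (fromℕ-nonNeg (n ℕ.∸ m))))

  +-cancelˡ-≤ : ∀ {x y} z → z + x ≤ z + y → x ≤ y
  +-cancelˡ-≤ {x} {y} z p = by (solve 3 (λ x y z → (z :+ y) :- (z :+ x) := y :- x) refl x y z) (diff p)

  fromℕ-cancel : ∀ {m n} → fromℕ m ≤ fromℕ n → m ℕ.≤ n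
  fromℕ-cancel {m} {n} p with m ℕ.≤? n
  ... | yes q = q
  ... | no q = ⊥-elim (<⇒≱ 0<1 (+-cancelˡ-≤ (fromℕ n) (≤-trans (≤-reflexive (trans (+-comm (fromℕ n) 1#) (sym (fromℕ-suc n))))
    (≤-trans (fromℕ-mono (ℕₚ.≰⇒> q)) (≤-trans p (≤-reflexive (sym (+-identityʳ (fromℕ n)))))))))

-- Absolute values and powers in an ordered domain.

module AbsoluteBounds (R : OrderedDomain) where
  open OrderedDomainProperties R

  two≢0 : fromℕ 2 ≢ 0#
  two≢0 e = proj₂ (fromℕ-pos 1) (sym e)

  0≤-neg : ∀ {x} → x ≤ 0# → 0# ≤ - x
  0≤-neg p = ≤-trans (≤-reflexive (solve 0 (con (pos 0) := :- con (pos 0)) refl)) (neg-mono-≤ p)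

  halve-≤ : ∀ {x y} → fromℕ 2 * x ≤ fromℕ 2 * y → x ≤ y
  halve-≤ = *-cancelˡ-≤ (fromℕ-pos 1)

  infix 4 ∣_∣≤_
  -- A pair of one-sided bounds, so that estimates need no case distinction on the sign of x.
  ∣_∣≤_ : Carrier → Carrier → Set
  ∣ x ∣≤ M = x ≤ M × - x ≤ M

  abs-nonNeg : ∀ {x M} → ∣ x ∣≤ M → 0# ≤ M
  abs-nonNeg {x} {M} (p , q) = halve-≤ (subst₂ _≤_
    (solve 1 (λ x → x :+ (:- x) := con (pos 2) :* con (pos 0)) refl x) (solve 1 (λ M → M :+ M := con (pos 2) :* M) refl M) (+-mono-≤ p q))

  abs-refl : ∀ {x} → 0# ≤ x → ∣ x ∣≤ x
  abs-refl {x} p = ≤-refl , ≤-trans (≤-trans (neg-mono-≤ p) (≤-reflexive (solve 0 (:- con (pos 0) := con (pos 0)) refl))) p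

  abs-mono : ∀ {x M N} → ∣ x ∣≤ M → M ≤ N → ∣ x ∣≤ N
  abs-mono (p , q) r = ≤-trans p r , ≤-trans q r

  abs-neg : ∀ {x M} → ∣ x ∣≤ M → ∣ - x ∣≤ M
  abs-neg {x} (p , q) = q , ≤-trans (≤-reflexive (solve 1 (λ x → :- :- x := x) refl x)) p

  abs-+ : ∀ {x y M N} → ∣ x ∣≤ M → ∣ y ∣≤ N → ∣ x + y ∣≤ M + N
  abs-+ {x} {y} (p , q) (r , s) = +-mono-≤ p r , ≤-trans (≤-reflexive (solve 2 (λ x y → :- (x :+ y) := :- x :+ :- y) refl x y)) (+-mono-≤ q s)

  private
    0≤-diff : ∀ {x y} → x ≤ y → 0# ≤ y - x
    0≤-diff p = nonNeg⇒0≤ (diff p)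
    0≤-sum : ∀ {x y} → - x ≤ y → 0# ≤ y + x
    0≤-sum {x} {y} p = subst (0# ≤_) (solve 2 (λ x y → y :- :- x := y :+ x) refl x y) (0≤-diff p)
    diff-0≤ : ∀ {x y} → 0# ≤ y - x → x ≤ y
    diff-0≤ p = fromDiff (0≤⇒nonNeg p)

  -- 2 (M N ∓ x y) is a sum of products of the nonnegative quantities M ± x, N ± y.
  abs-* : ∀ {x y M N} → ∣ x ∣≤ M → ∣ y ∣≤ N → ∣ x * y ∣≤ M * N
  abs-* {x} {y} {M} {N} (p , q) (r , s) =
      halve-≤ (diff-0≤ (subst (0# ≤_) (solve 4 (λ x y M N → (M :- x) :* (N :+ y) :+ (M :+ x) :* (N :- y) := con (pos 2) :* (M :* N) :- con (pos 2) :* (x :* y)) refl x y M N)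
        (+-nonNeg (*-nonNeg (0≤-diff p) (0≤-sum s)) (*-nonNeg (0≤-sum q) (0≤-diff r)))))
    , halve-≤ (diff-0≤ (subst (0# ≤_) (solve 4 (λ x y M N → (M :- x) :* (N :- y) :+ (M :+ x) :* (N :+ y) := con (pos 2) :* (M :* N) :- con (pos 2) :* (:- (x :* y))) refl x y M N)
        (+-nonNeg (*-nonNeg (0≤-diff p) (0≤-diff r)) (*-nonNeg (0≤-sum q) (0≤-sum s)))))

  abs-fromℤ : ∀ i → ∣ fromℤ i ∣≤ fromℕ ℤ.∣ i ∣
  abs-fromℤ (pos n) = abs-refl (fromℕ-nonNeg n)
  abs-fromℤ -[1+ n ] = abs-neg (abs-refl (fromℕ-nonNeg (suc n)))

  abs-fromℤ⁻¹ : ∀ i n → ∣ fromℤ i ∣≤ fromℕ n → ℤ.∣ i ∣ ℕ.≤ n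
  abs-fromℤ⁻¹ (pos m) n (p , q) = fromℕ-cancel p
  abs-fromℤ⁻¹ -[1+ m ] n (p , q) = fromℕ-cancel (≤-trans (≤-reflexive (solve 1 (λ x → x := :- :- x) refl (fromℕ (suc m)))) q)

  fromℤ-injective : ∀ {i j} → fromℤ i ≡ fromℤ j → i ≡ j
  fromℤ-injective {i} {j} e = ℤₚ.i-j≡0⇒i≡j i j (ℤₚ.∣i∣≡0⇒i≡0 (ℕₚ.n≤0⇒n≡0 (abs-fromℤ⁻¹ (i ℤ.- j) 0 (subst (∣_∣≤ 0#) (sym eq) (abs-refl ≤-refl)))))
    where
    eq : fromℤ (i ℤ.- j) ≡ 0#
    eq = trans (fromℤ-+ i (ℤ.- j)) (trans (cong₂ _+_ e (fromℤ-neg j)) (-‿inverseʳ (fromℤ j)))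

  ≤-poset : Poset 0ℓ 0ℓ 0ℓ
  ≤-poset = record { isPartialOrder = record
    { isPreorder = record { isEquivalence = isEquivalence ; reflexive = ≤-reflexive ; trans = ≤-trans }
    ; antisym = ≤-antisym } }

  module ≤-Reasoning = Relation.Binary.Reasoning.PartialOrder ≤-poset

  ^-nonNeg : ∀ {x} n → 0# ≤ x → 0# ≤ x ^ n
  ^-nonNeg zero p = 0≤1
  ^-nonNeg (suc n) p = *-nonNeg p (^-nonNeg n p)

  ^-pos : ∀ {x} n → 0# < x → 0# < x ^ n
  ^-pos zero p = 0<1
  ^-pos (suc n) p = *-pos p (^-pos n p)

  ^-≢0 : ∀ {x} n → x ≢ 0# → x ^ n ≢ 0#
  ^-≢0 zero p = 1≢0
  ^-≢0 (suc n) p = *-≢0 p (^-≢0 n p)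

  ^-mono-≤ : ∀ {x y} n → 0# ≤ x → x ≤ y → x ^ n ≤ y ^ n
  ^-mono-≤ zero p q = ≤-refl
  ^-mono-≤ (suc n) p q = *-mono-≤ p (^-nonNeg n (≤-trans p q)) q (^-mono-≤ n p q)

  abs-^ : ∀ {x M} n → ∣ x ∣≤ M → ∣ x ^ n ∣≤ M ^ n
  abs-^ zero p = abs-refl 0≤1
  abs-^ (suc n) p = abs-* p (abs-^ n p)

  ^-+ : ∀ x m n → x ^ (m ℕ.+ n) ≡ x ^ m * x ^ n
  ^-+ x zero n = sym (*-identityˡ _)
  ^-+ x (suc m) n = trans (cong (x *_) (^-+ x m n)) (sym (*-assoc x _ _))

  ^-distrib-* : ∀ x y n → (x * y) ^ n ≡ x ^ n * y ^ n
  ^-distrib-* x y zero = sym (*-identityˡ _)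
  ^-distrib-* x y (suc n) = trans (cong (x * y *_) (^-distrib-* x y n))
    (solve 4 (λ x y u v → (x :* y) :* (u :* v) := (x :* u) :* (y :* v)) refl x y (x ^ n) (y ^ n))

  1^ : ∀ n → 1# ^ n ≡ 1#
  1^ zero = refl
  1^ (suc n) = trans (*-identityˡ _) (1^ n)

  ^-* : ∀ x m n → x ^ (m ℕ.* n) ≡ (x ^ m) ^ n
  ^-* x zero n = sym (1^ n)
  ^-* x (suc m) n = trans (^-+ x n (m ℕ.* n)) (trans (cong (x ^ n *_) (^-* x m n)) (sym (^-distrib-* x (x ^ m) n)))

  fromℕ-^ : ∀ m n → fromℕ (m ℕ.^ n) ≡ fromℕ m ^ n
  fromℕ-^ m zero = refl
  fromℕ-^ m (suc n) = trans (fromℕ-* m (m ℕ.^ n)) (cong (fromℕ m *_) (fromℕ-^ m n))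

-- Quadratic extensions of ordered fields

module OverField (F : OrderedDomain) where
  open OrderedDomainProperties F

  module QuadraticExtension
    (≟0 : ∀ x → Dec (x ≡ 0#)) (inverse : ∀ x → x ≢ 0# → ∃ λ i → x * i ≡ 1#)
    (δ : Carrier) (0≤δ : 0# ≤ δ) (irrational : ∀ x → x * x ≢ δ) where

    F[√δ] : Set
    F[√δ] = Carrier × Carrier

    _+K_ : F[√δ] → F[√δ] → F[√δ]
    (a , b) +K (c , d) = (a + c , b + d)

    _*K_ : F[√δ] → F[√δ] → F[√δ]
    (a , b) *K (c , d) = (a * c + δ * (b * d) , a * d + b * c)

    0K 1K : F[√δ]
    0K = (0# , 0#)
    1K = (1# , 0#)

    negK : F[√δ] → F[√δ]
    negK (a , b) = (- a , - b)

    conj : F[√δ] → F[√δ]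
    conj (a , b) = (a , - b)

    norm : F[√δ] → Carrier
    norm (a , b) = a * a - δ * (b * b)

    +K-*K-isCommutativeRing : IsCommutativeRing _≡_ _+K_ _*K_ negK 0K 1K
    +K-*K-isCommutativeRing = record
      { isRing = record
        { +-isAbelianGroup = record
          { isGroup = record
            { isMonoid = record
              { isSemigroup = record
                { isMagma = record { isEquivalence = isEquivalence ; ∙-cong = cong₂ _+K_ }
                ; assoc = λ (a , b) (c , d) (e , f) → cong₂ _,_ (+-assoc a c e) (+-assoc b d f) }
              ; identity = (λ (a , b) → cong₂ _,_ (+-identityˡ a) (+-identityˡ b))
                         , (λ (a , b) → cong₂ _,_ (+-identityʳ a) (+-identityʳ b)) }
            ; inverse = (λ (a , b) → cong₂ _,_ (-‿inverseˡ a) (-‿inverseˡ b))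
                      , (λ (a , b) → cong₂ _,_ (-‿inverseʳ a) (-‿inverseʳ b))
            ; ⁻¹-cong = cong negK }
          ; comm = λ (a , b) (c , d) → cong₂ _,_ (+-comm a c) (+-comm b d) }
        ; *-cong = cong₂ _*K_
        ; *-assoc = assoc
        ; *-identity = (λ x → trans (comm 1K x) (identityʳ x)) , identityʳ
        ; distrib = distribˡ′ , (λ x y z → trans (comm (y +K z) x) (trans (distribˡ′ x y z) (cong₂ _+K_ (comm x y) (comm x z)))) }
      ; *-comm = comm }
      where
      assoc : ∀ x y z → (x *K y) *K z ≡ x *K (y *K z)
      assoc (a , b) (c , d) (e , f) = cong₂ _,_
        (solve 7 (λ a b c d e f D → (a :* c :+ D :* (b :* d)) :* e :+ D :* ((a :* d :+ b :* c) :* f)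
           := a :* (c :* e :+ D :* (d :* f)) :+ D :* (b :* (c :* f :+ d :* e))) refl a b c d e f δ)
        (solve 7 (λ a b c d e f D → (a :* c :+ D :* (b :* d)) :* f :+ (a :* d :+ b :* c) :* e
           := a :* (c :* f :+ d :* e) :+ b :* (c :* e :+ D :* (d :* f))) refl a b c d e f δ)
      comm : ∀ x y → x *K y ≡ y *K x
      comm (a , b) (c , d) = cong₂ _,_
        (solve 5 (λ a b c d D → a :* c :+ D :* (b :* d) := c :* a :+ D :* (d :* b)) refl a b c d δ)
        (solve 4 (λ a b c d → a :* d :+ b :* c := c :* b :+ d :* a) refl a b c d)
      identityʳ : ∀ x → x *K 1K ≡ x
      identityʳ (a , b) = cong₂ _,_
        (solve 3 (λ a b D → a :* con (pos 1) :+ D :* (b :* con (pos 0)) := a) refl a b δ)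
        (solve 2 (λ a b → a :* con (pos 0) :+ b :* con (pos 1) := b) refl a b)
      distribˡ′ : ∀ x y z → x *K (y +K z) ≡ (x *K y) +K (x *K z)
      distribˡ′ (a , b) (c , d) (e , f) = cong₂ _,_
        (solve 7 (λ a b c d e f D → a :* (c :+ e) :+ D :* (b :* (d :+ f))
           := (a :* c :+ D :* (b :* d)) :+ (a :* e :+ D :* (b :* f))) refl a b c d e f δ)
        (solve 6 (λ a b c d e f → a :* (d :+ f) :+ b :* (c :+ e)
           := (a :* d :+ b :* c) :+ (a :* f :+ b :* e)) refl a b c d e f)

    norm-* : ∀ x y → norm (x *K y) ≡ norm x * norm y
    norm-* (a , b) (c , d) = solve 5 (λ a b c d D →
      (a :* c :+ D :* (b :* d)) :* (a :* c :+ D :* (b :* d)) :- D :* ((a :* d :+ b :* c) :* (a :* d :+ b :* c))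
      := (a :* a :- D :* (b :* b)) :* (c :* c :- D :* (d :* d))) refl a b c d δ

    -- If b were nonzero, a / b would be a square root of δ.
    norm≡0 : ∀ x → norm x ≡ 0# → x ≡ 0K
    norm≡0 (a , b) e with ≟0 b
    ... | yes refl = cong (_, 0#) ([ (λ z → z) , (λ z → z) ]′ (zero-product a a
            (trans (solve 2 (λ a D → a :* a := a :* a :- D :* (con (pos 0) :* con (pos 0))) refl a δ) e)))
    ... | no nz with inverse b nz
    ...   | i , bi≡1 = ⊥-elim (irrational (a * i) (*-cancelʳ nz (*-cancelʳ nz (begin
        a * i * (a * i) * b * b ≡⟨ solve 3 (λ a b i → a :* i :* (a :* i) :* b :* b := (b :* i) :* (b :* i) :* (a :* a)) refl a b i ⟩
        (b * i) * (b * i) * (a * a) ≡⟨ cong (λ z → z * z * (a * a)) bi≡1 ⟩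
        1# * 1# * (a * a) ≡⟨ solve 1 (λ x → con (pos 1) :* con (pos 1) :* x := x) refl (a * a) ⟩
        a * a ≡⟨ x-y≡0⇒x≡y e ⟩
        δ * (b * b) ≡⟨ sym (*-assoc δ b b) ⟩
        δ * b * b ∎))))
      where open ≡-Reasoning

    -- Each branch says that one of |a|, |b|√δ dominates the other and has a nonnegative sign.
    Cone : F[√δ] → Set
    Cone x = (NonNeg (proj₁ x) × NonNeg (norm x)) ⊎ (NonNeg (proj₂ x) × NonNeg (- norm x))

    norm-neg : ∀ x → norm x ≡ norm (negK x)
    norm-neg (a , b) = solve 3 (λ a b D → a :* a :- D :* (b :* b) := (:- a) :* (:- a) :- D :* ((:- b) :* (:- b))) refl a b δ

    Cone-total : ∀ x → Cone x ⊎ Cone (negK x)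
    Cone-total x@(a , b) with nonNeg-total (norm x)
    ... | inj₁ r with nonNeg-total a
    ...   | inj₁ p = inj₁ (inj₁ (p , r))
    ...   | inj₂ p = inj₂ (inj₁ (p , subst NonNeg (norm-neg x) r))
    Cone-total x@(a , b) | inj₂ r with nonNeg-total b
    ...   | inj₁ p = inj₁ (inj₂ (p , r))
    ...   | inj₂ p = inj₂ (inj₂ (p , subst (λ n → NonNeg (- n)) (norm-neg x) r))

    private
      0≤s+t : ∀ {s t} → NonNeg s → t * t ≤ s * s → NonNeg (s + t)
      0≤s+t {s} {t} ps p = subst NonNeg (solve 2 (λ s t → s :- :- t := s :+ t) refl s t)
        (diff (square-cancel-≤ (nonNeg⇒0≤ ps) (subst (_≤ s * s) (solve 1 (λ t → t :* t := (:- t) :* (:- t)) refl t) p)))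

      norm≤0 : ∀ {a b} → NonNeg (- norm (a , b)) → a * a ≤ δ * (b * b)
      norm≤0 {a} {b} p = fromDiff (subst NonNeg (solve 3 (λ a b D → :- (a :* a :- D :* (b :* b)) := D :* (b :* b) :- a :* a) refl a b δ) p)

    -- For x = a + b√δ and y = c + d√δ, the chain b²c² ≤ δb²d² ≤ a²d² shows that ad decides the sign
    -- of the coefficient ad + bc. Multiplicativity makes the norm of the product nonpositive.
    Cone-*-mixed : ∀ {x y} → NonNeg (proj₁ x) → NonNeg (norm x) → NonNeg (proj₂ y) → NonNeg (- norm y) → Cone (x *K y)
    Cone-*-mixed {x@(a , b)} {y@(c , d)} p q r s = inj₂
      ( 0≤s+t {a * d} (nonNeg-* p r) (subst₂ _≤_
          (solve 2 (λ b c → (b :* b) :* (c :* c) := (b :* c) :* (b :* c)) refl b c)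
          (solve 2 (λ a d → (a :* a) :* (d :* d) := (a :* d) :* (a :* d)) refl a d)
          (≤-trans (*-monoˡ-≤ (b * b) (0≤x*x b) (norm≤0 {c} {d} s))
            (subst (_≤ a * a * (d * d)) (solve 3 (λ b d D → D :* (b :* b) :* (d :* d) := b :* b :* (D :* (d :* d))) refl b d δ)
              (*-monoʳ-≤ (d * d) (0≤x*x d) (fromDiff q)))))
      , subst NonNeg (trans (solve 2 (λ m n → m :* (:- n) := :- (m :* n)) refl (norm x) (norm y)) (cong -_ (sym (norm-* x y))))
          (nonNeg-* q s))

    Cone-* : ∀ {x y} → Cone x → Cone y → Cone (x *K y)
    Cone-* {x@(a , b)} {y@(c , d)} (inj₁ (p , q)) (inj₁ (r , s)) = inj₁
      ( 0≤s+t {a * c} (nonNeg-* p r) (subst₂ _≤_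
          (solve 3 (λ b d D → (D :* (b :* b)) :* (D :* (d :* d)) := (D :* (b :* d)) :* (D :* (b :* d))) refl b d δ)
          (solve 2 (λ a c → (a :* a) :* (c :* c) := (a :* c) :* (a :* c)) refl a c)
          (*-mono-≤ (*-nonNeg 0≤δ (0≤x*x b)) (0≤x*x c) (fromDiff q) (fromDiff s)))
      , subst NonNeg (sym (norm-* x y)) (nonNeg-* q s))
    Cone-* {x} {y} (inj₁ (p , q)) (inj₂ (r , s)) = Cone-*-mixed {x} {y} p q r s
    Cone-* {x} {y} (inj₂ (r , s)) (inj₁ (p , q)) = subst Cone (*K-comm y x) (Cone-*-mixed {y} {x} p q r s)
      where *K-comm = IsCommutativeRing.*-comm +K-*K-isCommutativeRing
    Cone-* {x@(a , b)} {y@(c , d)} (inj₂ (p , q)) (inj₂ (r , s)) = inj₁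
      ( subst NonNeg (+-comm (δ * (b * d)) (a * c)) (0≤s+t {δ * (b * d)} (nonNeg-* (0≤⇒nonNeg 0≤δ) (nonNeg-* p r)) (subst₂ _≤_
          (solve 2 (λ a c → (a :* a) :* (c :* c) := (a :* c) :* (a :* c)) refl a c)
          (solve 3 (λ b d D → (D :* (b :* b)) :* (D :* (d :* d)) := (D :* (b :* d)) :* (D :* (b :* d))) refl b d δ)
          (*-mono-≤ (0≤x*x a) (*-nonNeg 0≤δ (0≤x*x d)) (norm≤0 {a} {b} q) (norm≤0 {c} {d} s))))
      , subst NonNeg (trans (solve 2 (λ m n → (:- m) :* (:- n) := m :* n) refl (norm x) (norm y)) (sym (norm-* x y)))
          (nonNeg-* q s))

    Cone-1+ : ∀ {x} → Cone x → Cone (1K +K x)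
    Cone-1+ {a , b} (inj₁ (p , q)) = inj₁ (nonNeg-+ (0≤⇒nonNeg 0≤1) p
      , subst NonNeg
          (solve 3 (λ a b D → ((con (pos 1) :+ a) :* (con (pos 1) :+ a) :- a :* a) :+ (a :* a :- D :* (b :* b))
             := (con (pos 1) :+ a) :* (con (pos 1) :+ a) :- D :* ((con (pos 0) :+ b) :* (con (pos 0) :+ b))) refl a b δ)
          (nonNeg-+ (diff (square-mono-≤ (nonNeg⇒0≤ p) (x≤y+x {a} {1#} 0≤1))) q))
    Cone-1+ {a , b} (inj₂ (p , q)) with nonNeg-total (1# + a) | nonNeg-total (norm (1K +K (a , b)))
    ... | inj₁ r | inj₁ s = inj₁ (r , s)
    ... | _ | inj₂ s = inj₂ (subst NonNeg (sym (+-identityˡ b)) p , s)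
    -- If 1 + a ≤ 0, passing from a to 1 + a shrinks the square, so the norm stays nonpositive.
    ... | inj₂ r | inj₁ _ = inj₂ (subst NonNeg (sym (+-identityˡ b)) p , subst NonNeg
          (solve 3 (λ a b D → ((:- a) :* (:- a) :- (:- (con (pos 1) :+ a)) :* (:- (con (pos 1) :+ a))) :+ (:- (a :* a :- D :* (b :* b)))
             := :- ((con (pos 1) :+ a) :* (con (pos 1) :+ a) :- D :* ((con (pos 0) :+ b) :* (con (pos 0) :+ b)))) refl a b δ)
          (nonNeg-+ (diff (square-mono-≤ (nonNeg⇒0≤ r) (neg-mono-≤ (x≤y+x {a} {1#} 0≤1)))) q))

    -- Since squares lie in the cone, so do inverses, and x + y = y (1 + x / y) reduces sums to products.
    Cone-+ : ∀ {x y} → Cone x → Cone y → Cone (x +K y)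
    Cone-+ {x} {y@(c , d)} p q with ≟0 (norm y)
    ... | yes z = subst Cone (sym (trans (cong (x +K_) (norm≡0 y z)) (IsCommutativeRing.+-identityʳ +K-*K-isCommutativeRing x))) p
    ... | no nz = subst Cone eq (Cone-* q (Cone-1+ (Cone-* p y⁻¹-cone)))
      where
      module KR = IsCommutativeRing +K-*K-isCommutativeRing
      i = proj₁ (inverse (norm y) nz)
      y⁻¹ : F[√δ]
      y⁻¹ = (c * i , - (d * i))
      y*y⁻¹ : y *K y⁻¹ ≡ 1K
      y*y⁻¹ = cong₂ _,_
        (trans (solve 4 (λ c d i D → c :* (c :* i) :+ D :* (d :* (:- (d :* i))) := (c :* c :- D :* (d :* d)) :* i) refl c d i δ) (proj₂ (inverse (norm y) nz)))
        (solve 3 (λ c d i → c :* (:- (d :* i)) :+ d :* (c :* i) := con (pos 0)) refl c d i)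
      square-cone : ∀ z → Cone (z *K z)
      square-cone z with Cone-total z
      ... | inj₁ r = Cone-* r r
      ... | inj₂ r = subst Cone (cong₂ _,_
            (solve 3 (λ a b D → (:- a) :* (:- a) :+ D :* ((:- b) :* (:- b)) := a :* a :+ D :* (b :* b)) refl (proj₁ z) (proj₂ z) δ)
            (solve 2 (λ a b → (:- a) :* (:- b) :+ (:- b) :* (:- a) := a :* b :+ b :* a) refl (proj₁ z) (proj₂ z))) (Cone-* r r)
      y⁻¹-cone : Cone y⁻¹
      y⁻¹-cone = subst Cone (trans (sym (KR.*-assoc y y⁻¹ y⁻¹)) (trans (cong (_*K y⁻¹) y*y⁻¹) (KR.*-identityˡ y⁻¹))) (Cone-* q (square-cone y⁻¹))
      eq : y *K (1K +K (x *K y⁻¹)) ≡ x +K y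
      eq = trans (KR.distribˡ y 1K (x *K y⁻¹)) (trans (cong₂ _+K_ (KR.*-identityʳ y)
        (trans (cong (y *K_) (KR.*-comm x y⁻¹)) (trans (sym (KR.*-assoc y y⁻¹ x)) (trans (cong (_*K x) y*y⁻¹) (KR.*-identityˡ x))))) (KR.+-comm y x))

    K-zero-product : ∀ x y → x *K y ≡ 0K → x ≡ 0K ⊎ y ≡ 0K
    K-zero-product x y e with zero-product (norm x) (norm y) (trans (sym (norm-* x y)) (trans (cong norm e)
        (solve 1 (λ D → con (pos 0) :* con (pos 0) :- D :* (con (pos 0) :* con (pos 0)) := con (pos 0)) refl δ)))
    ... | inj₁ p = inj₁ (norm≡0 x p)
    ... | inj₂ p = inj₂ (norm≡0 y p)

    -- Every combination of branches forces the norm to vanish: different branches give it both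
    -- signs, and equal branches kill the dominating coordinate, which fixes the missing sign.
    Cone-antisym : ∀ {x} → Cone x → Cone (negK x) → x ≡ 0K
    Cone-antisym {x@(a , b)} p q = norm≡0 x (lem p q)
      where
      flip : NonNeg (- norm (negK x)) → NonNeg (- norm x)
      flip = subst (λ n → NonNeg (- n)) (sym (norm-neg x))
      lem : Cone x → Cone (negK x) → norm x ≡ 0#
      lem (inj₁ (_ , q)) (inj₂ (_ , s)) = nonNeg-antisym q (flip s)
      lem (inj₂ (_ , q)) (inj₁ (_ , s)) = nonNeg-antisym (subst NonNeg (sym (norm-neg x)) s) q
      lem (inj₁ (p , q)) (inj₁ (r , s)) = nonNeg-antisym q (subst NonNeg
        (trans (solve 2 (λ b D → D :* (b :* b) := :- (con (pos 0) :* con (pos 0) :- D :* (b :* b))) refl b δ)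
          (cong (λ a → - norm (a , b)) (sym (nonNeg-antisym p r)))) (nonNeg-* (0≤⇒nonNeg 0≤δ) (0≤⇒nonNeg (0≤x*x b))))
      lem (inj₂ (p , q)) (inj₂ (r , s)) = nonNeg-antisym (subst NonNeg
        (trans (solve 2 (λ a D → a :* a := (a :* a :- D :* (con (pos 0) :* con (pos 0)))) refl a δ)
          (cong (λ b → norm (a , b)) (sym (nonNeg-antisym p r)))) (0≤⇒nonNeg (0≤x*x a))) q

    orderedDomain : OrderedDomain
    orderedDomain = record
      { isCommutativeRing = +K-*K-isCommutativeRing
      ; NonNeg = Cone
      ; nonNeg-+ = Cone-+
      ; nonNeg-* = Cone-*
      ; nonNeg-total = Cone-total
      ; nonNeg-antisym = Cone-antisym
      ; 1≢0 = λ e → 1≢0 (cong proj₁ e)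
      ; zero-product = K-zero-product
      }

-- Sums over boxes, differences of squares and polynomial expressions

-- X is the floor of √(N / c). With c = 1 it yields floors of multiples of √D, and with general c
-- the approximation scale that belongs to a given number N of eigenvalues.
∃-scaledSqrt : ∀ c → 1 ℕ.≤ c → ∀ N → ∃ λ X → c ℕ.* (X ℕ.* X) ℕ.≤ N × N ℕ.< c ℕ.* (suc X ℕ.* suc X)
∃-scaledSqrt c 1≤c zero = 0 , ℕₚ.≤-reflexive (ℕₚ.*-zeroʳ c) , subst (1 ℕ.≤_) (sym (ℕₚ.*-identityʳ c)) 1≤c
∃-scaledSqrt c@(suc _) 1≤c (suc N) with ∃-scaledSqrt c 1≤c N
... | X , p , q with c ℕ.* (suc X ℕ.* suc X) ℕ.≤? suc N
...   | yes r = suc X , r , ℕₚ.≤-<-trans q (ℕₚ.*-monoʳ-< c (ℕₚ.*-mono-< (ℕₚ.n<1+n (suc X)) (ℕₚ.n<1+n (suc X))))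
...   | no r = X , ℕₚ.m≤n⇒m≤1+n p , ℕₚ.≰⇒> r

-- The recursion copies that of `countRow` and `countBox`, which are the case of an indicator
-- function.
sumRow : (ℕ → ℕ → ℕ) → ℕ → ℕ → ℕ
sumRow f m zero = 0
sumRow f m (suc n) = f m (suc n) ℕ.+ sumRow f m n

sumBox : (ℕ → ℕ → ℕ) → ℕ → ℕ → ℕ
sumBox f zero N = 0
sumBox f (suc m) N = sumRow f (suc m) N ℕ.+ sumBox f m N

sumRow-+ : ∀ {f g h} m N → (∀ n → 1 ℕ.≤ n → f m n ≡ g m n ℕ.+ h m n) → sumRow f m N ≡ sumRow g m N ℕ.+ sumRow h m N
sumRow-+ m zero p = refl
sumRow-+ {f} {g} {h} m (suc n) p = trans (cong₂ ℕ._+_ (p (suc n) (ℕ.s≤s ℕ.z≤n)) (sumRow-+ {f} {g} {h} m n p))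
  (+-interchange (g m (suc n)) (h m (suc n)) _ _)

sumBox-+ : ∀ {f g h} M N → (∀ m n → 1 ℕ.≤ m → 1 ℕ.≤ n → f m n ≡ g m n ℕ.+ h m n) → sumBox f M N ≡ sumBox g M N ℕ.+ sumBox h M N
sumBox-+ zero N p = refl
sumBox-+ {f} {g} {h} (suc m) N p = trans (cong₂ ℕ._+_ (sumRow-+ {f} {g} {h} (suc m) N (λ n → p (suc m) n (ℕ.s≤s ℕ.z≤n))) (sumBox-+ {f} {g} {h} m N p))
  (+-interchange (sumRow g (suc m) N) (sumRow h (suc m) N) _ _)

sumRow-zero : ∀ {f} m N → (∀ n → n ℕ.≤ N → f m n ≡ 0) → sumRow f m N ≡ 0
sumRow-zero m zero p = refl
sumRow-zero m (suc n) p = cong₂ ℕ._+_ (p (suc n) ℕₚ.≤-refl) (sumRow-zero m n (λ k q → p k (ℕₚ.m≤n⇒m≤1+n q)))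

sumRow-≤ : ∀ {f} m N → (∀ m n → f m n ℕ.≤ 1) → sumRow f m N ℕ.≤ N
sumRow-≤ m zero p = ℕ.z≤n
sumRow-≤ m (suc n) p = ℕₚ.+-mono-≤ (p m (suc n)) (sumRow-≤ m n p)

sumBox-≤ : ∀ {f} M N → (∀ m n → f m n ℕ.≤ 1) → sumBox f M N ℕ.≤ M ℕ.* N
sumBox-≤ zero N p = ℕ.z≤n
sumBox-≤ (suc m) N p = ℕₚ.+-mono-≤ (sumRow-≤ (suc m) N p) (sumBox-≤ m N p)

sumRow-≥ : ∀ {f} m n N → 1 ℕ.≤ n → n ℕ.≤ N → f m n ℕ.≤ sumRow f m N
sumRow-≥ m (suc n) zero p ()
sumRow-≥ {f} m n (suc N) p q with n ℕ.≟ suc N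
... | yes refl = ℕₚ.m≤m+n (f m n) _
... | no ne = ℕₚ.≤-trans (sumRow-≥ m n N p (ℕₚ.≤-pred (ℕₚ.≤∧≢⇒< q ne))) (ℕₚ.m≤n+m _ (f m (suc N)))

sumBox-≥ : ∀ {f} m n M N → 1 ℕ.≤ m → m ℕ.≤ M → 1 ℕ.≤ n → n ℕ.≤ N → f m n ℕ.≤ sumBox f M N
sumBox-≥ (suc m) n zero N p () r s
sumBox-≥ {f} m n (suc M) N p q r s with m ℕ.≟ suc M
... | yes refl = ℕₚ.≤-trans (sumRow-≥ m n N r s) (ℕₚ.m≤m+n (sumRow f m N) _)
... | no ne = ℕₚ.≤-trans (sumBox-≥ m n M N p (ℕₚ.≤-pred (ℕₚ.≤∧≢⇒< q ne)) r s) (ℕₚ.m≤n+m _ (sumRow f (suc M) N))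

-- Kronecker delta of the point (m₀, n₀); counts at consecutive eigenvalues differ by its sum.
δ : ℕ → ℕ → ℕ → ℕ → ℕ
δ m₀ n₀ m n = if ⌊ (m ℕ.≟ m₀) ×-dec (n ℕ.≟ n₀) ⌋ then 1 else 0

δ-refl : ∀ m n → δ m n m n ≡ 1
δ-refl m n with m ℕ.≟ m | n ℕ.≟ n
... | yes _ | yes _ = refl
... | no p | _ = ⊥-elim (p refl)
... | yes _ | no p = ⊥-elim (p refl)

δ-≢ : ∀ {m₀ n₀ m n} → ¬ (m ≡ m₀ × n ≡ n₀) → δ m₀ n₀ m n ≡ 0
δ-≢ {m₀} {n₀} {m} {n} p with m ℕ.≟ m₀ | n ℕ.≟ n₀
... | yes q | yes r = ⊥-elim (p (q , r))
... | yes _ | no _ = refl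
... | no _ | yes _ = refl
... | no _ | no _ = refl

sumRow-δ : ∀ m n N → 1 ℕ.≤ n → n ℕ.≤ N → sumRow (δ m n) m N ≡ 1
sumRow-δ m (suc n) zero p ()
sumRow-δ m n (suc N) p q with n ℕ.≟ suc N
... | yes refl = cong₂ ℕ._+_ (δ-refl m n) (sumRow-zero m N (λ k r → δ-≢ λ { (_ , refl) → ℕₚ.1+n≰n r }))
... | no ne = cong₂ ℕ._+_ (δ-≢ {m} {n} λ (_ , e) → ne (sym e)) (sumRow-δ m n N p (ℕₚ.≤-pred (ℕₚ.≤∧≢⇒< q ne)))

sumBox-δ-zero : ∀ m n M N → M ℕ.< m → sumBox (δ m n) M N ≡ 0
sumBox-δ-zero m n zero N p = refl
sumBox-δ-zero m n (suc M) N p = cong₂ ℕ._+_ (sumRow-zero (suc M) N (λ k _ → δ-≢ λ { (refl , _) → ℕₚ.1+n≰n p })) (sumBox-δ-zero m n M N (ℕₚ.<-trans (ℕₚ.n<1+n M) p))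

sumBox-δ : ∀ m n M N → 1 ℕ.≤ m → m ℕ.≤ M → 1 ℕ.≤ n → n ℕ.≤ N → sumBox (δ m n) M N ≡ 1
sumBox-δ (suc m) n zero N p () r s
sumBox-δ m n (suc M) N p q r s with m ℕ.≟ suc M
... | yes refl = cong₂ ℕ._+_ (sumRow-δ m n N r s) (sumBox-δ-zero m n M N ℕₚ.≤-refl)
... | no ne = cong₂ ℕ._+_ (sumRow-zero (suc M) N (λ k _ → δ-≢ {m} {n} λ (e , _) → ne (sym e))) (sumBox-δ m n M N p (ℕₚ.≤-pred (ℕₚ.≤∧≢⇒< q ne)) r s)

-- Eigenvalue indices start at 1, so m₀ = 0 must be avoided. In 4ab = (a + b)² - (a - b)² it would
-- occur for a = b. Doubling gives two representations of 8ab, with m₀ = |2a - b| and m₀ = |a - 2b|,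
-- which cannot both vanish.
record SquareDifference (a b S : ℕ) : Set where
  constructor squareDifference
  field
    m m₀ : ℕ
    1≤m : 1 ℕ.≤ m
    1≤m₀ : 1 ℕ.≤ m₀
    m≤ : m ℕ.≤ 4 ℕ.* S
    m²≡ : m ℕ.* m ≡ m₀ ℕ.* m₀ ℕ.+ 8 ℕ.* (a ℕ.* b)

  m₀≤ : m₀ ℕ.≤ 4 ℕ.* S
  m₀≤ with m₀ ℕ.≤? m
  ... | yes p = ℕₚ.≤-trans p m≤
  ... | no p = ⊥-elim (ℕₚ.<⇒≱ (ℕₚ.*-mono-< (ℕₚ.≰⇒> p) (ℕₚ.≰⇒> p)) (subst (m₀ ℕ.* m₀ ℕ.≤_) (sym m²≡) (ℕₚ.m≤m+n (m₀ ℕ.* m₀) _)))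

-- (2a + b)² − (2a − b)² = 8ab, with (a + 2b)² − (2b − a)² = 8ab in reserve for the case 2a = b.
8ab-squareDifference : ∀ a b S → 1 ℕ.≤ a → 1 ℕ.≤ b → a ℕ.≤ S → b ℕ.≤ S → SquareDifference a b S
8ab-squareDifference a b S 1≤a 1≤b a≤S b≤S with ℕₚ.<-cmp b (2 ℕ.* a)
... | tri< b<2a _ _ = squareDifference (2 ℕ.* b ℕ.+ k) k (ℕₚ.≤-trans 1≤b (ℕₚ.≤-trans (ℕₚ.m≤m+n b _) (ℕₚ.m≤m+n (2 ℕ.* b) k))) (ℕₚ.m<n⇒0<n∸m b<2a)
    (subst₂ ℕ._≤_ eq (ℕₛ.solve 1 (λ s → ℕₛ.con 2 ℕₛ.:* s ℕₛ.:+ (s ℕₛ.:+ s) ℕₛ.:= ℕₛ.con 4 ℕₛ.:* s) refl S) (ℕₚ.+-mono-≤ (ℕₚ.*-monoʳ-≤ 2 a≤S) (ℕₚ.≤-trans b≤S (ℕₚ.m≤m+n S S))))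
    (trans (ℕₛ.solve 2 (λ b k → (ℕₛ.con 2 ℕₛ.:* b ℕₛ.:+ k) ℕₛ.:* (ℕₛ.con 2 ℕₛ.:* b ℕₛ.:+ k) ℕₛ.:= k ℕₛ.:* k ℕₛ.:+ ℕₛ.con 4 ℕₛ.:* ((b ℕₛ.:+ k) ℕₛ.:* b)) refl b k)
      (cong (k ℕ.* k ℕ.+_) (trans (cong (λ z → 4 ℕ.* (z ℕ.* b)) b+k) (ℕₛ.solve 2 (λ a b → ℕₛ.con 4 ℕₛ.:* ((ℕₛ.con 2 ℕₛ.:* a) ℕₛ.:* b) ℕₛ.:= ℕₛ.con 8 ℕₛ.:* (a ℕₛ.:* b)) refl a b))))
  where
  k = 2 ℕ.* a ℕ.∸ b
  b+k : b ℕ.+ k ≡ 2 ℕ.* a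
  b+k = ℕₚ.m+[n∸m]≡n (ℕₚ.<⇒≤ b<2a)
  eq : 2 ℕ.* a ℕ.+ b ≡ 2 ℕ.* b ℕ.+ k
  eq = trans (cong (ℕ._+ b) (sym b+k)) (ℕₛ.solve 2 (λ b k → b ℕₛ.:+ k ℕₛ.:+ b ℕₛ.:= ℕₛ.con 2 ℕₛ.:* b ℕₛ.:+ k) refl b k)
... | tri≈ _ refl _ = squareDifference (5 ℕ.* a) (3 ℕ.* a) (ℕₚ.≤-trans 1≤a (ℕₚ.m≤m+n a _)) (ℕₚ.≤-trans 1≤a (ℕₚ.m≤m+n a _))
    (subst₂ ℕ._≤_ (ℕₛ.solve 1 (λ a → a ℕₛ.:+ ℕₛ.con 2 ℕₛ.:* (ℕₛ.con 2 ℕₛ.:* a) ℕₛ.:= ℕₛ.con 5 ℕₛ.:* a) refl a) (ℕₛ.solve 1 (λ s → ℕₛ.con 2 ℕₛ.:* s ℕₛ.:+ ℕₛ.con 2 ℕₛ.:* s ℕₛ.:= ℕₛ.con 4 ℕₛ.:* s) refl S)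
      (ℕₚ.+-mono-≤ (ℕₚ.≤-trans a≤S (ℕₚ.m≤m+n S _)) (ℕₚ.*-monoʳ-≤ 2 b≤S)))
    (ℕₛ.solve 1 (λ a → (ℕₛ.con 5 ℕₛ.:* a) ℕₛ.:* (ℕₛ.con 5 ℕₛ.:* a) ℕₛ.:= (ℕₛ.con 3 ℕₛ.:* a) ℕₛ.:* (ℕₛ.con 3 ℕₛ.:* a) ℕₛ.:+ ℕₛ.con 8 ℕₛ.:* (a ℕₛ.:* (ℕₛ.con 2 ℕₛ.:* a))) refl a)
... | tri> _ _ 2a<b = squareDifference (4 ℕ.* a ℕ.+ k) k (ℕₚ.≤-trans 1≤a (ℕₚ.≤-trans (ℕₚ.m≤m+n a _) (ℕₚ.m≤m+n (4 ℕ.* a) k))) (ℕₚ.m<n⇒0<n∸m 2a<b)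
    (subst₂ ℕ._≤_ eq (ℕₛ.solve 1 (λ s → ℕₛ.con 2 ℕₛ.:* s ℕₛ.:+ (s ℕₛ.:+ s) ℕₛ.:= ℕₛ.con 4 ℕₛ.:* s) refl S) (ℕₚ.+-mono-≤ (ℕₚ.*-monoʳ-≤ 2 a≤S) (ℕₚ.≤-trans b≤S (ℕₚ.m≤m+n S S))))
    (trans (ℕₛ.solve 2 (λ a k → (ℕₛ.con 4 ℕₛ.:* a ℕₛ.:+ k) ℕₛ.:* (ℕₛ.con 4 ℕₛ.:* a ℕₛ.:+ k) ℕₛ.:= k ℕₛ.:* k ℕₛ.:+ ℕₛ.con 8 ℕₛ.:* (a ℕₛ.:* (ℕₛ.con 2 ℕₛ.:* a ℕₛ.:+ k))) refl a k)
      (cong (λ z → k ℕ.* k ℕ.+ 8 ℕ.* (a ℕ.* z)) 2a+k))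
  where
  k = b ℕ.∸ 2 ℕ.* a
  2a+k : 2 ℕ.* a ℕ.+ k ≡ b
  2a+k = ℕₚ.m+[n∸m]≡n (ℕₚ.<⇒≤ 2a<b)
  eq : 2 ℕ.* a ℕ.+ b ≡ 4 ℕ.* a ℕ.+ k
  eq = trans (cong (2 ℕ.* a ℕ.+_) (sym 2a+k)) (ℕₛ.solve 2 (λ a k → ℕₛ.con 2 ℕₛ.:* a ℕₛ.:+ (ℕₛ.con 2 ℕₛ.:* a ℕₛ.:+ k) ℕₛ.:= ℕₛ.con 4 ℕₛ.:* a ℕₛ.:+ k) refl a k)

sumBox-zero : ∀ M N → sumBox (λ _ _ → 0) M N ≡ 0
sumBox-zero zero N = refl
sumBox-zero (suc m) N = cong₂ ℕ._+_ (sumRow-zero (suc m) N (λ _ _ → refl)) (sumBox-zero m N)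

data Var : Set where 𝑥 𝑦 : Var

-- Integer polynomials as syntax: induction on the expression shows that the value at a pair of
-- conjugates is a quadratic integer, and which one is its conjugate.
data Expr : Set where
  var : Var → Expr
  one : Expr
  _⊕_ _⊗_ : Expr → Expr → Expr
  ⊖_ : Expr → Expr

infixl 6 _⊕_
infixl 7 _⊗_
infix 8 ⊖_

_↑_ : Expr → ℕ → Expr
e ↑ zero = one
e ↑ suc n = e ⊗ e ↑ n

substitute : (Var → Expr) → Expr → Expr
substitute p (var v) = p v
substitute p one = one
substitute p (a ⊕ b) = substitute p a ⊕ substitute p b
substitute p (a ⊗ b) = substitute p a ⊗ substitute p b
substitute p (⊖ a) = ⊖ substitute p a

-- Δ p u m e is the quotient (e(p + m u) − e(p)) / m.
Δ : (p u : Var → Expr) (m : Expr) → Expr → Expr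
Δ p u m (var v) = u v
-- The sum `one ⊕ ⊖ one` stands for zero.
Δ p u m one = one ⊕ ⊖ one
Δ p u m (a ⊕ b) = Δ p u m a ⊕ Δ p u m b
Δ p u m (a ⊗ b) = Δ p u m a ⊗ substitute p b ⊕ substitute p a ⊗ Δ p u m b ⊕ m ⊗ (Δ p u m a ⊗ Δ p u m b)
Δ p u m (⊖ a) = ⊖ Δ p u m a

⟨_,_⟩ : {A : Set} → A → A → Var → A
⟨ x , y ⟩ 𝑥 = x
⟨ x , y ⟩ 𝑦 = y

module OverOrderedDomain (R : OrderedDomain) where
  open OrderedDomainProperties R
  open AbsoluteBounds R

  -- Approximation of α by quotients of products.

  module RationalApproximation where

    -- The four factors are bounded separately, since they and not their products control the
    -- eigenvalue indices.
    record Approximant (α : Carrier) (S : ℕ) : Set where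
      field
        a b c d : ℕ
        1≤a : 1 ℕ.≤ a
        1≤b : 1 ℕ.≤ b
        1≤c : 1 ℕ.≤ c
        1≤d : 1 ℕ.≤ d
        a≤S : a ℕ.≤ S
        b≤S : b ℕ.≤ S
        c≤S : c ℕ.≤ S
        d≤S : d ℕ.≤ S
        gap : Carrier
        gap≡ : gap ≡ α * fromℕ (a ℕ.* b) - fromℕ (c ℕ.* d)
        gap≢0 : gap ≢ 0#

    -- At scale N the factors are O(N^e) and the gap is O(N^(-f)). As the number of eigenvalues
    -- involved is O(N^(2e)), the exponents e = 1, f = 2 lose nothing, and e = L + 1, f = 2L lose
    -- the power 1/(L + 1).
    record Approximable (α : Carrier) (e f : ℕ) : Set where
      field
        k₁ k₂ N₀ : ℕ
        approximant : ∀ N → N₀ ℕ.≤ N → Σ (Approximant α (k₁ ℕ.* N ℕ.^ e)) λ A →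
          ∣ Approximant.gap A * fromℕ (N ℕ.^ f) ∣≤ fromℕ k₂

  -- Dirichlet approximation

  module Dirichlet
    (D : ℕ) (√D : Carrier) (0≤√D : 0# ≤ √D) (√D² : √D * √D ≡ fromℕ D) where

    -- The residue of ⌊jX√D⌋ modulo X is ⌊X{j√D}⌋, the pigeonhole of the classical proof, but
    -- expressed in integers. For equal residues the floors differ by a multiple Xx, and the two
    -- rounding errors, each between -1 and 0, differ by at most 1.
    dirichlet : ∀ X → 1 ℕ.≤ X → ∃ λ x → ∃ λ y → 1 ℕ.≤ y × y ℕ.≤ X × ∣ fromℕ X * (fromℤ x - fromℕ y * √D) ∣≤ 1#
    dirichlet X@(suc _) _ = x , y , ℕₚ.m<n⇒0<n∸m i<j , ℕₚ.≤-trans (ℕₚ.m∸n≤m (toℕ j) (toℕ i)) (ℕₚ.≤-pred (Finₚ.toℕ<n j)) ,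
      subst (∣_∣≤ 1#) (sym eq) bound
      where
      floor : ∀ m → ∃ λ s → fromℕ s ≤ fromℕ m * √D × fromℕ m * √D ≤ fromℕ (suc s)
      -- The floor of m√D is the integer square root of D m².
      floor m with ∃-scaledSqrt 1 (ℕ.s≤s ℕ.z≤n) (D ℕ.* (m ℕ.* m))
      ... | s , p , q = s
          , square-cancel-≤ (*-nonNeg (fromℕ-nonNeg m) 0≤√D) (subst₂ _≤_ (fromℕ-* s s) (sym sq) (fromℕ-mono (subst (ℕ._≤ D ℕ.* (m ℕ.* m)) (ℕₚ.*-identityˡ (s ℕ.* s)) p)))
          , square-cancel-≤ (fromℕ-nonNeg (suc s)) (subst₂ _≤_ (sym sq) (fromℕ-* (suc s) (suc s)) (fromℕ-mono (subst (D ℕ.* (m ℕ.* m) ℕ.≤_) (ℕₚ.*-identityˡ (suc s ℕ.* suc s)) (ℕₚ.<⇒≤ q))))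
        where
        sq : (fromℕ m * √D) * (fromℕ m * √D) ≡ fromℕ (D ℕ.* (m ℕ.* m))
        sq = trans (solve 2 (λ m w → (m :* w) :* (m :* w) := (w :* w) :* (m :* m)) refl (fromℕ m) √D)
          (trans (cong₂ _*_ √D² (sym (fromℕ-* m m))) (sym (fromℕ-* D (m ℕ.* m))))
      s : Fin (suc X) → ℕ
      s j = proj₁ (floor (toℕ j ℕ.* X))
      pigeons = Finₚ.pigeonhole (ℕₚ.n<1+n X) (λ j → s j mod X)
      i = proj₁ pigeons
      j = proj₁ (proj₂ pigeons)
      i<j : toℕ i ℕ.< toℕ j
      i<j = proj₁ (proj₂ (proj₂ pigeons))
      same : s i % X ≡ s j % X
      same = trans (sym (Finₚ.toℕ-fromℕ< _)) (trans (cong toℕ (proj₂ (proj₂ (proj₂ pigeons)))) (Finₚ.toℕ-fromℕ< _))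
      x : ℤ
      x = pos (s j / X) ℤ.+ ℤ.- pos (s i / X)
      y = toℕ j ℕ.∸ toℕ i
      s-decomp : ∀ k → fromℕ (s k) ≡ fromℕ (s k % X) + fromℕ (s k / X) * fromℕ X
      s-decomp k = trans (cong fromℕ (m≡m%n+[m/n]*n (s k) X)) (trans (fromℕ-+ (s k % X) _) (cong (fromℕ (s k % X) +_) (fromℕ-* (s k / X) X)))
      t : Fin (suc X) → Carrier
      t k = fromℕ (toℕ k ℕ.* X) * √D
      eq : fromℕ X * (fromℤ x - fromℕ y * √D) ≡ (fromℕ (s j) - t j) - (fromℕ (s i) - t i)
      eq = begin
        fromℕ X * (fromℤ x - fromℕ y * √D)
          ≡⟨ cong (λ z → fromℕ X * (z - fromℕ y * √D)) (trans (fromℤ-+ (pos (s j / X)) (ℤ.- pos (s i / X))) (cong (fromℕ (s j / X) +_) (fromℤ-neg (pos (s i / X))))) ⟩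
        fromℕ X * ((fromℕ (s j / X) - fromℕ (s i / X)) - fromℕ y * √D)
          ≡⟨ solve 7 (λ X qj qi y w r i → X :* ((qj :- qi) :- y :* w) := ((r :+ qj :* X) :- ((y :+ i) :* X) :* w) :- ((r :+ qi :* X) :- (i :* X) :* w)) refl
               (fromℕ X) (fromℕ (s j / X)) (fromℕ (s i / X)) (fromℕ y) √D (fromℕ (s j % X)) (fromℕ (toℕ i)) ⟩
        ((fromℕ (s j % X) + fromℕ (s j / X) * fromℕ X) - ((fromℕ y + fromℕ (toℕ i)) * fromℕ X) * √D) - ((fromℕ (s j % X) + fromℕ (s i / X) * fromℕ X) - (fromℕ (toℕ i) * fromℕ X) * √D)
          ≡⟨ cong₂ _-_ (cong₂ (λ u v → u - v * √D) (sym (s-decomp j)) (trans (cong (_* fromℕ X) (trans (sym (fromℕ-+ y (toℕ i))) (cong fromℕ (ℕₚ.m∸n+n≡m (ℕₚ.<⇒≤ i<j))))) (sym (fromℕ-* (toℕ j) X))))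
                       (cong₂ (λ u v → u - v * √D) (trans (cong (λ r → fromℕ r + fromℕ (s i / X) * fromℕ X) (sym same)) (sym (s-decomp i))) (sym (fromℕ-* (toℕ i) X))) ⟩
        (fromℕ (s j) - t j) - (fromℕ (s i) - t i) ∎
        where open ≡-Reasoning
      upper : ∀ k → fromℕ (s k) - t k ≤ 0#
      upper k = ≤-trans (+-monoˡ-≤ (- t k) (proj₁ (proj₂ (floor (toℕ k ℕ.* X))))) (≤-reflexive (-‿inverseʳ (t k)))
      lower : ∀ k → - (fromℕ (s k) - t k) ≤ 1#
      lower k = ≤-trans (≤-reflexive (solve 2 (λ s t → :- (s :- t) := t :+ :- s) refl (fromℕ (s k)) (t k)))
        (≤-trans (+-monoˡ-≤ (- fromℕ (s k)) (proj₂ (proj₂ (floor (toℕ k ℕ.* X)))))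
          (≤-reflexive (trans (cong (_+ - fromℕ (s k)) (fromℕ-suc (s k))) (solve 1 (λ s → (con (pos 1) :+ s) :+ :- s := con (pos 1)) refl (fromℕ (s k))))))
      bound : ∣ (fromℕ (s j) - t j) - (fromℕ (s i) - t i) ∣≤ 1#
      bound = ≤-trans (+-mono-≤ (upper j) (lower i)) (≤-reflexive (+-identityˡ 1#))
        , ≤-trans (≤-reflexive (solve 2 (λ a b → :- (a :- b) := :- a :+ b) refl (fromℕ (s j) - t j) (fromℕ (s i) - t i)))
            (≤-trans (+-mono-≤ (lower j) (upper i)) (≤-reflexive (+-identityʳ 1#)))

  -- Balanced factorisations of y^L − x^L

  module Evaluation where

    eval : (Var → Carrier) → Expr → Carrier
    eval ρ (var v) = ρ v
    eval ρ one = 1#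
    eval ρ (a ⊕ b) = eval ρ a + eval ρ b
    eval ρ (a ⊗ b) = eval ρ a * eval ρ b
    eval ρ (⊖ a) = - eval ρ a

    infix 9 _⟦_,_⟧
    _⟦_,_⟧ : Expr → Carrier → Carrier → Carrier
    e ⟦ x , y ⟧ = eval ⟨ x , y ⟩ e

    eval-cong : ∀ {ρ σ} e → (∀ v → ρ v ≡ σ v) → eval ρ e ≡ eval σ e
    eval-cong (var v) p = p v
    eval-cong one p = refl
    eval-cong (a ⊕ b) p = cong₂ _+_ (eval-cong a p) (eval-cong b p)
    eval-cong (a ⊗ b) p = cong₂ _*_ (eval-cong a p) (eval-cong b p)
    eval-cong (⊖ a) p = cong -_ (eval-cong a p)

    eval-substitute : ∀ {ρ} p e → eval ρ (substitute p e) ≡ eval (λ v → eval ρ (p v)) e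
    eval-substitute p (var v) = refl
    eval-substitute p one = refl
    eval-substitute p (a ⊕ b) = cong₂ _+_ (eval-substitute p a) (eval-substitute p b)
    eval-substitute p (a ⊗ b) = cong₂ _*_ (eval-substitute p a) (eval-substitute p b)
    eval-substitute p (⊖ a) = cong -_ (eval-substitute p a)

    eval-↑ : ∀ {ρ} e n → eval ρ (e ↑ n) ≡ eval ρ e ^ n
    eval-↑ e zero = refl
    eval-↑ {ρ} e (suc n) = cong (eval ρ e *_) (eval-↑ e n)

    eval-Δ : ∀ {ρ} p u m e →
      eval (λ v → eval ρ (p v) + eval ρ m * eval ρ (u v)) e ≡ eval (λ v → eval ρ (p v)) e + eval ρ m * eval ρ (Δ p u m e)
    eval-Δ p u m (var v) = refl
    eval-Δ {ρ} p u m one = solve 1 (λ m → con (pos 1) := con (pos 1) :+ m :* (con (pos 1) :+ :- con (pos 1))) refl (eval ρ m)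
    eval-Δ {ρ} p u m (a ⊕ b) = trans (cong₂ _+_ (eval-Δ p u m a) (eval-Δ p u m b))
      (solve 5 (λ a b m a′ b′ → (a :+ m :* a′) :+ (b :+ m :* b′) := (a :+ b) :+ m :* (a′ :+ b′)) refl _ _ (eval ρ m) _ _)
    eval-Δ {ρ} p u m (a ⊗ b) = trans (cong₂ _*_ (eval-Δ p u m a) (eval-Δ p u m b))
      (trans (solve 5 (λ a b m a′ b′ → (a :+ m :* a′) :* (b :+ m :* b′) := (a :* b) :+ m :* (a′ :* b :+ a :* b′ :+ m :* (a′ :* b′))) refl _ _ (eval ρ m) _ _)
        (cong₂ (λ s t → eval q a * eval q b + eval ρ m * (eval ρ (Δ p u m a) * s + t * eval ρ (Δ p u m b) + eval ρ m * (eval ρ (Δ p u m a) * eval ρ (Δ p u m b))))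
          (sym (eval-substitute p b)) (sym (eval-substitute p a))))
      where q = λ v → eval ρ (p v)
    eval-Δ {ρ} p u m (⊖ a) = trans (cong -_ (eval-Δ p u m a))
      (solve 3 (λ a m a′ → :- (a :+ m :* a′) := :- a :+ m :* (:- a′)) refl _ (eval ρ m) _)

    -- Identities for E are obtained by cancelling values of E, so they are claimed only where these
    -- are nonzero. Asking for x² ≠ y² instead of x ≠ y makes the condition stable under x ↦ -x and
    -- under all positive powers.
    record Nondegenerate (x y : Carrier) : Set where
      constructor nondeg
      field
        x≢0 : x ≢ 0#
        y≢0 : y ≢ 0#
        x²≢y² : x * x ≢ y * y
    open Nondegenerate

    ^-injective-≤ : ∀ {a b} n → 0# ≤ a → b ≢ 0# → a ≤ b → a ^ suc n ≡ b ^ suc n → a ≡ b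
    ^-injective-≤ {a} {b} n 0≤a b≢0 a≤b e = *-cancelʳ (^-≢0 n b≢0)
      (≤-antisym (*-monoʳ-≤ (b ^ n) (^-nonNeg n (≤-trans 0≤a a≤b)) a≤b)
        (≤-trans (≤-reflexive (sym e)) (*-monoˡ-≤ a 0≤a (^-mono-≤ n 0≤a a≤b))))

    ^-injective : ∀ {a b} n → 0# ≤ a → 0# ≤ b → a ≢ 0# → b ≢ 0# → a ^ suc n ≡ b ^ suc n → a ≡ b
    ^-injective {a} {b} n p q p′ q′ e with ≤-total a b
    ... | inj₁ r = ^-injective-≤ n p q′ r e
    ... | inj₂ r = sym (^-injective-≤ n q p′ r (sym e))

    nondeg-^ : ∀ {x y} n → Nondegenerate x y → Nondegenerate (x ^ suc n) (y ^ suc n)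
    nondeg-^ {x} {y} n (nondeg p q r) = nondeg (^-≢0 (suc n) p) (^-≢0 (suc n) q)
      λ e → r (^-injective n (0≤x*x x) (0≤x*x y) (*-≢0 p p) (*-≢0 q q)
        (trans (^-distrib-* x x (suc n)) (trans e (sym (^-distrib-* y y (suc n))))))

    nondeg-square : ∀ {x y} → Nondegenerate x y → Nondegenerate (x * x) (y * y)
    nondeg-square {x} {y} n = subst₂ Nondegenerate (cong (x *_) (*-identityʳ x)) (cong (y *_) (*-identityʳ y)) (nondeg-^ 1 n)

    nondeg-neg : ∀ {x y} → Nondegenerate x y → Nondegenerate (- x) y
    nondeg-neg {x} {y} (nondeg p q r) = nondeg (λ e → p (trans (solve 1 (λ x → x := :- :- x) refl x) (trans (cong -_ e) (solve 0 (:- con (pos 0) := con (pos 0)) refl)))) q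
      (λ e → r (trans (solve 1 (λ x → x :* x := :- x :* :- x) refl x) e))

    nondeg-swap : ∀ {x y} → Nondegenerate x y → Nondegenerate y x
    nondeg-swap (nondeg p q r) = nondeg q p (λ e → r (sym e))

    nondeg-scale : ∀ {x y c} → c ≢ 0# → Nondegenerate x y → Nondegenerate (c * x) (c * y)
    nondeg-scale {x} {y} {c} nz (nondeg p q r) = nondeg (*-≢0 nz p) (*-≢0 nz q)
      (λ e → r (*-cancelˡ (*-≢0 nz nz) (trans (solve 2 (λ c x → (c :* c) :* (x :* x) := (c :* x) :* (c :* x)) refl c x)
        (trans e (solve 2 (λ c x → (c :* x) :* (c :* x) := (c :* c) :* (x :* x)) refl c y)))))

    -- The regime in which E has the size of y^d. The factor 2 keeps y - x at least y / 2, and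
    -- survives powers because |x| ≤ y / 2 and |x| ≤ y give |x|^(n + 1) ≤ y^(n + 1) / 2.
    record Small (x y : Carrier) : Set where
      constructor small
      field
        x≢0 : x ≢ 0#
        0<y : 0# < y
        2∣x∣≤y : ∣ fromℕ 2 * x ∣≤ y

    small⇒nondeg : ∀ {x y} → Small x y → Nondegenerate x y
    small⇒nondeg {x} {y} (small p q r) = nondeg p (λ e → proj₂ q (sym e)) λ e →
      <⇒≱ (*-pos (fromℕ-pos 2) (*-pos q q)) (+-cancelˡ-≤ (y * y) (≤-trans (≤-reflexive
        (trans (solve 1 (λ u → u :+ con (pos 3) :* u := con (pos 4) :* u) refl (y * y))
          (trans (cong (fromℕ 4 *_) (sym e)) (solve 1 (λ x → con (pos 4) :* (x :* x) := (con (pos 2) :* x) :* (con (pos 2) :* x)) refl x))))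
        (≤-trans (proj₁ (abs-* r r)) (≤-reflexive (sym (+-identityʳ _))))))

    small⇒abs : ∀ {x y} → Small x y → ∣ x ∣≤ y
    small⇒abs {x} {y} (small _ (0≤y , _) (p , q)) = halve-≤ (≤-trans p y≤2y) ,
      halve-≤ (≤-trans (≤-reflexive (solve 1 (λ x → con (pos 2) :* :- x := :- (con (pos 2) :* x)) refl x)) (≤-trans q y≤2y))
      where
      y≤2y : y ≤ fromℕ 2 * y
      y≤2y = ≤-trans (x≤y+x 0≤y) (≤-reflexive (solve 1 (λ y → y :+ y := con (pos 2) :* y) refl y))

    small-^ : ∀ {x y} n → Small x y → Small (x ^ suc n) (y ^ suc n)
    small-^ {x} {y} n s@(small p q r) = small (^-≢0 (suc n) p) (^-pos (suc n) q)
      (subst (∣_∣≤ y ^ suc n) (*-assoc _ x (x ^ n)) (abs-* r (abs-^ n (small⇒abs s))))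

    -- A factorisation y^L − x^L = E C into forms of nearly equal degrees d = (L + 1)/2 and L − d.
    record BalancedFactorisation : Set where
      field
        t : ℕ
        E C : Expr
      L = suc (t ℕ.+ t)
      d = suc t
      field
        product : ∀ {x y} → Nondegenerate x y → E ⟦ x , y ⟧ * C ⟦ x , y ⟧ ≡ y ^ L - x ^ L
        double : ∀ {x y} → Nondegenerate x y → E ⟦ x * x , y * y ⟧ ≡ E ⟦ x , y ⟧ * E ⟦ - x , y ⟧
        homogeneous : ∀ {x y} c → c ≢ 0# → Nondegenerate x y → E ⟦ c * x , c * y ⟧ ≡ c ^ d * E ⟦ x , y ⟧
        -- This is -1 for the form y - x and 1 from then on. Symmetry is what makes the value of E
        -- at a pair of conjugates a rational integer.
        swapSign : Carrier
        swapSign≢0 : swapSign ≢ 0#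
        swap : ∀ {x y} → Nondegenerate x y → E ⟦ y , x ⟧ ≡ swapSign * E ⟦ x , y ⟧
        -- Comparison with y^d is kept in both directions because the next E is a quotient of values
        -- of the present one.
        k : ℕ
        lower : ∀ {x y} → Small x y → y ^ d ≤ fromℕ k * E ⟦ x , y ⟧
        upper : ∀ {x y} → Small x y → E ⟦ x , y ⟧ ≤ fromℕ k * y ^ d

      odd-≢ : ∀ {x y} → Nondegenerate x y → y ^ L ≢ x ^ L
      odd-≢ {x} {y} n e = x²≢y² (nondeg-^ (t ℕ.+ t) n) (cong₂ _*_ (sym e) (sym e))

      E≢0 : ∀ {x y} → Nondegenerate x y → E ⟦ x , y ⟧ ≢ 0#
      E≢0 {x} {y} n e = odd-≢ n (x-y≡0⇒x≡y (trans (sym (product n)) (trans (cong (_* C ⟦ x , y ⟧) e) (zeroˡ _))))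

    pos-cancelˡ : ∀ {k e} → 0# ≤ k → 0# < k * e → 0# < e
    pos-cancelˡ {k} {e} p q with ≤-total e 0#
    ... | inj₁ r = ⊥-elim (<⇒≱ q (≤-trans (*-monoˡ-≤ k p r) (≤-reflexive (zeroʳ k))))
    ... | inj₂ r = r , λ { refl → proj₂ q (sym (zeroʳ k)) }

    module _ (B : BalancedFactorisation) where
      open BalancedFactorisation B

      private
        F = suc (suc L)
        x^L = var 𝑥 ↑ L
        y^L = var 𝑦 ↑ L
        p u : Var → Expr
        p = ⟨ var 𝑥 ⊗ var 𝑥 ⊗ y^L , var 𝑦 ⊗ var 𝑦 ⊗ y^L ⟩
        -- Since y^F = y² y^L exactly, only the first variable gets an increment.
        u = ⟨ var 𝑥 ⊗ var 𝑥 , one ⊕ ⊖ one ⟩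
        m = x^L ⊕ ⊖ y^L
        S = Δ p u m E

        -- In E(x^F, y^F) = y^(L d) E(x², y²) + (x^L - y^L) S both terms contain E(x, y), by E(x²,
        -- y²) = E(x, y) E(-x, y) and x^L - y^L = -E C. Removing it leaves `E′`; the removed factor
        -- goes to `C′`.
        E′ C′ : Expr
        E′ = y^L ↑ d ⊗ substitute ⟨ ⊖ var 𝑥 , var 𝑦 ⟩ E ⊕ ⊖ (C ⊗ S)
        C′ = substitute ⟨ var 𝑥 ↑ F , var 𝑦 ↑ F ⟩ C ⊗ E

        substitute-XY : ∀ x y a b e → eval ⟨ x , y ⟩ (substitute ⟨ a , b ⟩ e) ≡ e ⟦ eval ⟨ x , y ⟩ a , eval ⟨ x , y ⟩ b ⟧
        substitute-XY x y a b e = trans (eval-substitute ⟨ a , b ⟩ e) (eval-cong e λ { 𝑥 → refl ; 𝑦 → refl })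

        -- x^F = x² y^L + x² (x^L − y^L), so modulo x^L − y^L the value at (x^F, y^F) is y^(L d) times the one at (x², y²).
        E′*E : ∀ {x y} → Nondegenerate x y → E′ ⟦ x , y ⟧ * E ⟦ x , y ⟧ ≡ E ⟦ x ^ F , y ^ F ⟧
        E′*E {x} {y} n = sym (begin
          E ⟦ x ^ F , y ^ F ⟧
            ≡⟨ eval-cong E (λ
               { 𝑥 → trans (solve 3 (λ x a b → x :* (x :* a) := (x :* x :* b) :+ (a :+ :- b) :* (x :* x)) refl x (x ^ L) (y ^ L))
                       (cong₂ (λ a b → (x * x * b) + (a + - b) * (x * x)) (sym (eval-↑ (var 𝑥) L)) (sym (eval-↑ (var 𝑦) L)))
               ; 𝑦 → trans (solve 3 (λ y a b → y :* (y :* b) := (y :* y :* b) :+ (a :+ :- b) :* (con (pos 1) :+ :- con (pos 1))) refl y (x ^ L) (y ^ L))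
                       (cong₂ (λ a b → (y * y * b) + (a + - b) * (1# + - 1#)) (sym (eval-↑ (var 𝑥) L)) (sym (eval-↑ (var 𝑦) L))) }) ⟩
          eval (λ v → eval ρ (p v) + eval ρ m * eval ρ (u v)) E
            ≡⟨ eval-Δ p u m E ⟩
          eval (λ v → eval ρ (p v)) E + eval ρ m * eval ρ S
            ≡⟨ cong₂ (λ a b → a + b * eval ρ S)
                 (trans (eval-cong E (λ
                    { 𝑥 → trans (cong (x * x *_) (eval-↑ (var 𝑦) L)) (*-comm _ _)
                    ; 𝑦 → trans (cong (y * y *_) (eval-↑ (var 𝑦) L)) (*-comm _ _) }))
                   (trans (homogeneous (y ^ L) (^-≢0 L (y≢0 n)) (nondeg-square n)) (cong ((y ^ L) ^ d *_) (double n))))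
                 (trans (cong₂ (λ a b → a + - b) (eval-↑ (var 𝑥) L) (eval-↑ (var 𝑦) L))
                   (trans (solve 2 (λ a b → a :+ :- b := :- (b :- a)) refl (x ^ L) (y ^ L)) (cong -_ (sym (product n))))) ⟩
          (y ^ L) ^ d * (E ⟦ x , y ⟧ * E ⟦ - x , y ⟧) + - (E ⟦ x , y ⟧ * C ⟦ x , y ⟧) * eval ρ S
            ≡⟨ solve 5 (λ q e e⁻ c s → q :* (e :* e⁻) :+ :- (e :* c) :* s := (q :* e⁻ :+ :- (c :* s)) :* e) refl
                 ((y ^ L) ^ d) (E ⟦ x , y ⟧) (E ⟦ - x , y ⟧) (C ⟦ x , y ⟧) (eval ρ S) ⟩
          ((y ^ L) ^ d * E ⟦ - x , y ⟧ + - (C ⟦ x , y ⟧ * eval ρ S)) * E ⟦ x , y ⟧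
            ≡⟨ cong₂ (λ q e⁻ → (q * e⁻ + - (C ⟦ x , y ⟧ * eval ρ S)) * E ⟦ x , y ⟧)
                 (sym (trans (eval-↑ y^L d) (cong (_^ d) (eval-↑ (var 𝑦) L)))) (sym (substitute-XY x y (⊖ var 𝑥) (var 𝑦) E)) ⟩
          E′ ⟦ x , y ⟧ * E ⟦ x , y ⟧ ∎)
          where
          open ≡-Reasoning
          ρ = ⟨ x , y ⟩

        ^F-+ : ∀ y → y ^ (F ℕ.* d) ≡ y ^ (suc L ℕ.* d) * y ^ d
        ^F-+ y = trans (^-+ y d (suc L ℕ.* d)) (*-comm _ _)

        -- This is (L F - 1)/2 for L = 2t + 1 and F = 2t + 3.
        t′ : ℕ
        t′ = suc (2 ℕ.* (t ℕ.* t) ℕ.+ 4 ℕ.* t)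

        L′≡ : suc (t′ ℕ.+ t′) ≡ L ℕ.* F
        L′≡ = ℕₛ.solve 1 (λ t → ℕₛ.con 1 ℕₛ.:+ ((ℕₛ.con 1 ℕₛ.:+ (ℕₛ.con 2 ℕₛ.:* (t ℕₛ.:* t) ℕₛ.:+ ℕₛ.con 4 ℕₛ.:* t)) ℕₛ.:+ (ℕₛ.con 1 ℕₛ.:+ (ℕₛ.con 2 ℕₛ.:* (t ℕₛ.:* t) ℕₛ.:+ ℕₛ.con 4 ℕₛ.:* t)))
          ℕₛ.:= (ℕₛ.con 1 ℕₛ.:+ (t ℕₛ.:+ t)) ℕₛ.:* (ℕₛ.con 3 ℕₛ.:+ (t ℕₛ.:+ t))) refl t

        d′≡ : suc t′ ≡ suc L ℕ.* d
        d′≡ = ℕₛ.solve 1 (λ t → ℕₛ.con 1 ℕₛ.:+ (ℕₛ.con 1 ℕₛ.:+ (ℕₛ.con 2 ℕₛ.:* (t ℕₛ.:* t) ℕₛ.:+ ℕₛ.con 4 ℕₛ.:* t))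
          ℕₛ.:= (ℕₛ.con 2 ℕₛ.:+ (t ℕₛ.:+ t)) ℕₛ.:* (ℕₛ.con 1 ℕₛ.:+ t)) refl t

        neg-^-odd : ∀ n x → (- x) ^ suc (n ℕ.+ n) ≡ - x ^ suc (n ℕ.+ n)
        neg-^-odd zero x = solve 1 (λ x → :- x :* con (pos 1) := :- (x :* con (pos 1))) refl x
        neg-^-odd (suc n) x = subst (λ k → (- x) ^ suc (suc k) ≡ - x ^ suc (suc k)) (sym (ℕₚ.+-suc n n))
          (trans (cong (λ z → - x * (- x * z)) (neg-^-odd n x)) (solve 2 (λ x z → :- x :* (:- x :* (:- z)) := :- (x :* (x :* z))) refl x (x ^ suc (n ℕ.+ n))))

        neg-^F : ∀ x → (- x) ^ F ≡ - x ^ F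
        neg-^F x = trans (cong (λ z → - x * (- x * z)) (neg-^-odd t x)) (solve 2 (λ x z → :- x :* (:- x :* (:- z)) := :- (x :* (x :* z))) refl x (x ^ L))

        -- After multiplication by the nonzero value of E, both sides become values of E at F-th
        -- powers, where the law for E applies; F is odd, so (-x)^F = -x^F. Homogeneity and symmetry
        -- of `E′` follow by the same cancellation.
        double′ : ∀ {x y} → Nondegenerate x y → E′ ⟦ x * x , y * y ⟧ ≡ E′ ⟦ x , y ⟧ * E′ ⟦ - x , y ⟧
        double′ {x} {y} n = *-cancelʳ (E≢0 (nondeg-square n)) (begin
          E′ ⟦ x * x , y * y ⟧ * E ⟦ x * x , y * y ⟧ ≡⟨ E′*E (nondeg-square n) ⟩
          E ⟦ (x * x) ^ F , (y * y) ^ F ⟧ ≡⟨ cong₂ (λ a b → E ⟦ a , b ⟧) (^-distrib-* x x F) (^-distrib-* y y F) ⟩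
          E ⟦ x ^ F * x ^ F , y ^ F * y ^ F ⟧ ≡⟨ double (nondeg-^ (suc L) n) ⟩
          E ⟦ x ^ F , y ^ F ⟧ * E ⟦ - x ^ F , y ^ F ⟧ ≡⟨ cong₂ _*_ (sym (E′*E n)) (trans (cong (λ a → E ⟦ a , y ^ F ⟧) (sym (neg-^F x))) (sym (E′*E (nondeg-neg n)))) ⟩
          (E′ ⟦ x , y ⟧ * E ⟦ x , y ⟧) * (E′ ⟦ - x , y ⟧ * E ⟦ - x , y ⟧)
            ≡⟨ solve 4 (λ a b c d → (a :* b) :* (c :* d) := (a :* c) :* (b :* d)) refl (E′ ⟦ x , y ⟧) (E ⟦ x , y ⟧) (E′ ⟦ - x , y ⟧) (E ⟦ - x , y ⟧) ⟩
          (E′ ⟦ x , y ⟧ * E′ ⟦ - x , y ⟧) * (E ⟦ x , y ⟧ * E ⟦ - x , y ⟧) ≡⟨ cong (E′ ⟦ x , y ⟧ * E′ ⟦ - x , y ⟧ *_) (sym (double n)) ⟩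
          (E′ ⟦ x , y ⟧ * E′ ⟦ - x , y ⟧) * E ⟦ x * x , y * y ⟧ ∎)
          where open ≡-Reasoning

        homogeneous′ : ∀ {x y} c → c ≢ 0# → Nondegenerate x y → E′ ⟦ c * x , c * y ⟧ ≡ c ^ suc t′ * E′ ⟦ x , y ⟧
        homogeneous′ {x} {y} c nz n = *-cancelʳ (E≢0 (nondeg-scale nz n)) (begin
          E′ ⟦ c * x , c * y ⟧ * E ⟦ c * x , c * y ⟧ ≡⟨ E′*E (nondeg-scale nz n) ⟩
          E ⟦ (c * x) ^ F , (c * y) ^ F ⟧ ≡⟨ cong₂ (λ a b → E ⟦ a , b ⟧) (^-distrib-* c x F) (^-distrib-* c y F) ⟩
          E ⟦ c ^ F * x ^ F , c ^ F * y ^ F ⟧ ≡⟨ homogeneous (c ^ F) (^-≢0 F nz) (nondeg-^ (suc L) n) ⟩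
          (c ^ F) ^ d * E ⟦ x ^ F , y ^ F ⟧ ≡⟨ cong₂ _*_ (trans (sym (^-* c F d)) (^F-+ c)) (sym (E′*E n)) ⟩
          (c ^ (suc L ℕ.* d) * c ^ d) * (E′ ⟦ x , y ⟧ * E ⟦ x , y ⟧)
            ≡⟨ solve 4 (λ a b c d → (a :* b) :* (c :* d) := (a :* c) :* (b :* d)) refl (c ^ (suc L ℕ.* d)) (c ^ d) (E′ ⟦ x , y ⟧) (E ⟦ x , y ⟧) ⟩
          (c ^ (suc L ℕ.* d) * E′ ⟦ x , y ⟧) * (c ^ d * E ⟦ x , y ⟧) ≡⟨ cong₂ _*_ (cong (λ k → c ^ k * E′ ⟦ x , y ⟧) (sym d′≡)) (sym (homogeneous c nz n)) ⟩
          (c ^ suc t′ * E′ ⟦ x , y ⟧) * E ⟦ c * x , c * y ⟧ ∎)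
          where open ≡-Reasoning

        -- Numerator and denominator both change by `swapSign`, so the quotient is symmetric even
        -- when E is not.
        swap′ : ∀ {x y} → Nondegenerate x y → E′ ⟦ y , x ⟧ ≡ E′ ⟦ x , y ⟧
        swap′ {x} {y} n = *-cancelʳ (*-≢0 swapSign≢0 (E≢0 n)) (begin
          E′ ⟦ y , x ⟧ * (swapSign * E ⟦ x , y ⟧) ≡⟨ cong (E′ ⟦ y , x ⟧ *_) (sym (swap n)) ⟩
          E′ ⟦ y , x ⟧ * E ⟦ y , x ⟧ ≡⟨ E′*E (nondeg-swap n) ⟩
          E ⟦ y ^ F , x ^ F ⟧ ≡⟨ swap (nondeg-^ (suc L) n) ⟩
          swapSign * E ⟦ x ^ F , y ^ F ⟧ ≡⟨ cong (swapSign *_) (sym (E′*E n)) ⟩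
          swapSign * (E′ ⟦ x , y ⟧ * E ⟦ x , y ⟧) ≡⟨ solve 3 (λ s a b → s :* (a :* b) := a :* (s :* b)) refl swapSign (E′ ⟦ x , y ⟧) (E ⟦ x , y ⟧) ⟩
          E′ ⟦ x , y ⟧ * (swapSign * E ⟦ x , y ⟧) ∎)
          where open ≡-Reasoning

        product′ : ∀ {x y} → Nondegenerate x y → E′ ⟦ x , y ⟧ * C′ ⟦ x , y ⟧ ≡ y ^ suc (t′ ℕ.+ t′) - x ^ suc (t′ ℕ.+ t′)
        product′ {x} {y} n = begin
          E′ ⟦ x , y ⟧ * (eval ⟨ x , y ⟩ (substitute ⟨ var 𝑥 ↑ F , var 𝑦 ↑ F ⟩ C) * E ⟦ x , y ⟧)
            ≡⟨ solve 3 (λ a b c → a :* (b :* c) := (a :* c) :* b) refl (E′ ⟦ x , y ⟧) _ (E ⟦ x , y ⟧) ⟩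
          (E′ ⟦ x , y ⟧ * E ⟦ x , y ⟧) * eval ⟨ x , y ⟩ (substitute ⟨ var 𝑥 ↑ F , var 𝑦 ↑ F ⟩ C)
            ≡⟨ cong₂ _*_ (E′*E n) (trans (substitute-XY x y (var 𝑥 ↑ F) (var 𝑦 ↑ F) C) (cong₂ (λ a b → C ⟦ a , b ⟧) (eval-↑ (var 𝑥) F) (eval-↑ (var 𝑦) F))) ⟩
          E ⟦ x ^ F , y ^ F ⟧ * C ⟦ x ^ F , y ^ F ⟧ ≡⟨ product (nondeg-^ (suc L) n) ⟩
          (y ^ F) ^ L - (x ^ F) ^ L ≡⟨ cong₂ _-_ (pow y) (pow x) ⟩
          y ^ suc (t′ ℕ.+ t′) - x ^ suc (t′ ℕ.+ t′) ∎
          where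
          open ≡-Reasoning
          pow : ∀ z → (z ^ F) ^ L ≡ z ^ suc (t′ ℕ.+ t′)
          pow z = trans (sym (^-* z F L)) (cong (z ^_) (trans (ℕₚ.*-comm F L) (sym L′≡)))

        E-pos : ∀ {x y} → Small x y → 0# < E ⟦ x , y ⟧
        E-pos {x} {y} s = pos-cancelˡ (fromℕ-nonNeg k) (<-≤-trans (^-pos d (Small.0<y s)) (lower s))

        E′-pos : ∀ {x y} → Small x y → 0# < E′ ⟦ x , y ⟧
        E′-pos {x} {y} s = pos-cancelˡ (proj₁ (E-pos s)) (subst (0# <_) (sym (trans (*-comm _ _) (E′*E (small⇒nondeg s)))) (E-pos (small-^ (suc L) s)))

        ^F-pow : ∀ y → (y ^ F) ^ d ≡ y ^ suc t′ * y ^ d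
        ^F-pow y = trans (sym (^-* y F d)) (trans (^F-+ y) (cong (λ k → y ^ k * y ^ d) (sym d′≡)))

        -- The lower bound for the numerator meets the upper bound for the denominator, at the cost
        -- of a factor k each.
        lower′ : ∀ {x y} → Small x y → y ^ suc t′ ≤ fromℕ (k ℕ.* k) * E′ ⟦ x , y ⟧
        lower′ {x} {y} s = *-cancelˡ-≤ (^-pos d (Small.0<y s)) (begin
          y ^ d * y ^ suc t′ ≡⟨ trans (*-comm _ _) (sym (^F-pow y)) ⟩
          (y ^ F) ^ d ≤⟨ lower (small-^ (suc L) s) ⟩
          fromℕ k * E ⟦ x ^ F , y ^ F ⟧ ≡⟨ cong (fromℕ k *_) (sym (E′*E (small⇒nondeg s))) ⟩
          fromℕ k * (E′ ⟦ x , y ⟧ * E ⟦ x , y ⟧) ≤⟨ *-monoˡ-≤ _ (fromℕ-nonNeg k) (*-monoˡ-≤ _ (proj₁ (E′-pos s)) (upper s)) ⟩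
          fromℕ k * (E′ ⟦ x , y ⟧ * (fromℕ k * y ^ d)) ≡⟨ solve 3 (λ k e p → k :* (e :* (k :* p)) := p :* ((k :* k) :* e)) refl (fromℕ k) (E′ ⟦ x , y ⟧) (y ^ d) ⟩
          y ^ d * ((fromℕ k * fromℕ k) * E′ ⟦ x , y ⟧) ≡⟨ cong (λ z → y ^ d * (z * E′ ⟦ x , y ⟧)) (sym (fromℕ-* k k)) ⟩
          y ^ d * (fromℕ (k ℕ.* k) * E′ ⟦ x , y ⟧) ∎)
          where open ≤-Reasoning

        upper′ : ∀ {x y} → Small x y → E′ ⟦ x , y ⟧ ≤ fromℕ (k ℕ.* k) * y ^ suc t′
        upper′ {x} {y} s = *-cancelˡ-≤ (E-pos s) (begin
          E ⟦ x , y ⟧ * E′ ⟦ x , y ⟧ ≡⟨ trans (*-comm _ _) (E′*E (small⇒nondeg s)) ⟩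
          E ⟦ x ^ F , y ^ F ⟧ ≤⟨ upper (small-^ (suc L) s) ⟩
          fromℕ k * (y ^ F) ^ d ≡⟨ cong (fromℕ k *_) (^F-pow y) ⟩
          fromℕ k * (y ^ suc t′ * y ^ d) ≤⟨ *-monoˡ-≤ _ (fromℕ-nonNeg k) (*-monoˡ-≤ _ (^-nonNeg (suc t′) (proj₁ (Small.0<y s))) (lower s)) ⟩
          fromℕ k * (y ^ suc t′ * (fromℕ k * E ⟦ x , y ⟧)) ≡⟨ solve 3 (λ k q e → k :* (q :* (k :* e)) := e :* ((k :* k) :* q)) refl (fromℕ k) (y ^ suc t′) (E ⟦ x , y ⟧) ⟩
          E ⟦ x , y ⟧ * ((fromℕ k * fromℕ k) * y ^ suc t′) ≡⟨ cong (λ z → E ⟦ x , y ⟧ * (z * y ^ suc t′)) (sym (fromℕ-* k k)) ⟩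
          E ⟦ x , y ⟧ * (fromℕ (k ℕ.* k) * y ^ suc t′) ∎)
          where open ≤-Reasoning

      next : BalancedFactorisation
      next = record
        { t = t′ ; E = E′ ; C = C′ ; product = product′ ; double = double′ ; homogeneous = homogeneous′
        ; swapSign = 1# ; swapSign≢0 = 1≢0 ; swap = λ n → trans (swap′ n) (sym (*-identityˡ _))
        ; k = k ℕ.* k ; lower = lower′ ; upper = upper′ }

      t<next : t ℕ.< t′
      t<next = ℕ.s≤s (ℕₚ.≤-trans (ℕₚ.m≤m+n t (t ℕ.+ (t ℕ.+ (t ℕ.+ 0)))) (ℕₚ.m≤n+m (4 ℕ.* t) (2 ℕ.* (t ℕ.* t))))

    linear : BalancedFactorisation
    linear = record
      { t = 0 ; E = var 𝑦 ⊕ ⊖ var 𝑥 ; C = one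
      ; product = λ {x} {y} _ → solve 2 (λ x y → (y :+ :- x) :* con (pos 1) := y :* con (pos 1) :- x :* con (pos 1)) refl x y
      ; double = λ {x} {y} _ → solve 2 (λ x y → y :* y :+ :- (x :* x) := (y :+ :- x) :* (y :+ :- :- x)) refl x y
      ; homogeneous = λ {x} {y} c _ _ → solve 3 (λ c x y → c :* y :+ :- (c :* x) := (c :* con (pos 1)) :* (y :+ :- x)) refl c x y
      ; swapSign = - 1# ; swapSign≢0 = λ e → 1≢0 (trans (solve 1 (λ x → x := :- :- x) refl 1#) (trans (cong -_ e) (solve 0 (:- con (pos 0) := con (pos 0)) refl)))
      ; swap = λ {x} {y} _ → solve 2 (λ x y → x :+ :- y := :- con (pos 1) :* (y :+ :- x)) refl x y
      -- From |x| ≤ y / 2 one gets y ≤ 2 (y - x), and y - x ≤ 2y.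
      ; k = 2
      ; lower = λ {x} {y} s → ≤-trans (≤-reflexive (solve 2 (λ x y → y :* con (pos 1) := (con (pos 2) :* y :+ :- (con (pos 2) :* x)) :+ (con (pos 2) :* x :+ :- y)) refl x y))
          (≤-trans (+-monoʳ-≤ _ (≤-trans (+-monoˡ-≤ (- y) (proj₁ (Small.2∣x∣≤y s))) (≤-reflexive (-‿inverseʳ y))))
            (≤-reflexive (solve 2 (λ x y → (con (pos 2) :* y :+ :- (con (pos 2) :* x)) :+ con (pos 0) := con (pos 2) :* (y :+ :- x)) refl x y)))
      ; upper = λ {x} {y} s → ≤-trans (+-monoʳ-≤ y (proj₂ (small⇒abs s))) (≤-reflexive (solve 1 (λ y → y :+ y := con (pos 2) :* (y :* con (pos 1))) refl y))
      }

    factorisation : ℕ → BalancedFactorisation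
    factorisation zero = linear
    factorisation (suc n) = next (factorisation n)

    -- The degrees are unbounded, so the loss 1/(L + 1) falls below any prescribed ε.
    n≤t : ∀ n → n ℕ.≤ BalancedFactorisation.t (factorisation n)
    n≤t zero = ℕ.z≤n
    n≤t (suc n) = ℕₚ.≤-trans (ℕ.s≤s (n≤t n)) (t<next (factorisation n))

  -- Real quadratic integers

  module QuadraticIntegers
    (D : ℕ) (√D : Carrier) (1≤√D : 1# ≤ √D) (√D² : √D * √D ≡ fromℕ D)
    (irrational : ∀ a b → fromℤ a + fromℤ b * √D ≡ 0# → b ≡ 0ℤ) where
    open Evaluation

    0<√D : 0# < √D
    0<√D = <-≤-trans 0<1 1≤√D

    √D≢0 : √D ≢ 0#
    √D≢0 e = proj₂ 0<√D (sym e)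

    √D≤D : √D ≤ fromℕ D
    √D≤D = ≤-trans (≤-reflexive (sym (*-identityʳ √D))) (≤-trans (*-monoˡ-≤ √D (proj₁ 0<√D) 1≤√D) (≤-reflexive √D²))

    open Dirichlet D √D (proj₁ 0<√D) √D²

    -- In an abstract ordered domain containing √D conjugation is not a map; it becomes a relation
    -- witnessed by integer coordinates.
    record Conjugate (x x̄ : Carrier) : Set where
      constructor conjugate
      field
        re im : ℤ
        x≡ : x ≡ fromℤ re + fromℤ im * √D
        x̄≡ : x̄ ≡ fromℤ re - fromℤ im * √D

    conj-sym : ∀ {x x̄} → Conjugate x x̄ → Conjugate x̄ x
    conj-sym (conjugate a b p q) = conjugate a (ℤ.- b)
      (trans q (trans (solve 3 (λ a b w → a :- b :* w := a :+ (:- b) :* w) refl (fromℤ a) (fromℤ b) √D) (cong (λ z → fromℤ a + z * √D) (sym (fromℤ-neg b)))))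
      (trans p (trans (solve 3 (λ a b w → a :+ b :* w := a :- (:- b) :* w) refl (fromℤ a) (fromℤ b) √D) (cong (λ z → fromℤ a - z * √D) (sym (fromℤ-neg b)))))

    conj-fromℤ : ∀ a → Conjugate (fromℤ a) (fromℤ a)
    conj-fromℤ a = conjugate a 0ℤ (solve 2 (λ a w → a := a :+ con 0ℤ :* w) refl (fromℤ a) √D) (solve 2 (λ a w → a := a :- con 0ℤ :* w) refl (fromℤ a) √D)

    conj-+ : ∀ {x x̄ y ȳ} → Conjugate x x̄ → Conjugate y ȳ → Conjugate (x + y) (x̄ + ȳ)
    conj-+ (conjugate a b p q) (conjugate c d r s) = conjugate (a ℤ.+ c) (b ℤ.+ d)
      (trans (cong₂ _+_ p r) (trans (solve 5 (λ a b c d w → (a :+ b :* w) :+ (c :+ d :* w) := (a :+ c) :+ (b :+ d) :* w) refl (fromℤ a) (fromℤ b) (fromℤ c) (fromℤ d) √D)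
        (cong₂ (λ u v → u + v * √D) (sym (fromℤ-+ a c)) (sym (fromℤ-+ b d)))))
      (trans (cong₂ _+_ q s) (trans (solve 5 (λ a b c d w → (a :- b :* w) :+ (c :- d :* w) := (a :+ c) :- (b :+ d) :* w) refl (fromℤ a) (fromℤ b) (fromℤ c) (fromℤ d) √D)
        (cong₂ (λ u v → u - v * √D) (sym (fromℤ-+ a c)) (sym (fromℤ-+ b d)))))

    conj-neg : ∀ {x x̄} → Conjugate x x̄ → Conjugate (- x) (- x̄)
    conj-neg (conjugate a b p q) = conjugate (ℤ.- a) (ℤ.- b)
      (trans (cong -_ p) (trans (solve 3 (λ a b w → :- (a :+ b :* w) := :- a :+ (:- b) :* w) refl (fromℤ a) (fromℤ b) √D)
        (cong₂ (λ u v → u + v * √D) (sym (fromℤ-neg a)) (sym (fromℤ-neg b)))))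
      (trans (cong -_ q) (trans (solve 3 (λ a b w → :- (a :- b :* w) := :- a :- (:- b) :* w) refl (fromℤ a) (fromℤ b) √D)
        (cong₂ (λ u v → u - v * √D) (sym (fromℤ-neg a)) (sym (fromℤ-neg b)))))

    conj-* : ∀ {x x̄ y ȳ} → Conjugate x x̄ → Conjugate y ȳ → Conjugate (x * y) (x̄ * ȳ)
    conj-* (conjugate a b p q) (conjugate c d r s) = conjugate (a ℤ.* c ℤ.+ pos D ℤ.* (b ℤ.* d)) (a ℤ.* d ℤ.+ b ℤ.* c)
      (trans (cong₂ _*_ p r) (trans (solve 5 (λ a b c d w → (a :+ b :* w) :* (c :+ d :* w) := (a :* c :+ (w :* w) :* (b :* d)) :+ (a :* d :+ b :* c) :* w) refl (fromℤ a) (fromℤ b) (fromℤ c) (fromℤ d) √D)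
        (cong₂ (λ u v → u + v * √D) re≡ im≡)))
      (trans (cong₂ _*_ q s) (trans (solve 5 (λ a b c d w → (a :- b :* w) :* (c :- d :* w) := (a :* c :+ (w :* w) :* (b :* d)) :- (a :* d :+ b :* c) :* w) refl (fromℤ a) (fromℤ b) (fromℤ c) (fromℤ d) √D)
        (cong₂ (λ u v → u - v * √D) re≡ im≡)))
      where
      re≡ : fromℤ a * fromℤ c + (√D * √D) * (fromℤ b * fromℤ d) ≡ fromℤ (a ℤ.* c ℤ.+ pos D ℤ.* (b ℤ.* d))
      re≡ = trans (cong₂ _+_ (sym (fromℤ-* a c)) (trans (cong₂ _*_ √D² (sym (fromℤ-* b d))) (sym (fromℤ-* (pos D) (b ℤ.* d))))) (sym (fromℤ-+ (a ℤ.* c) _))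
      im≡ : fromℤ a * fromℤ d + fromℤ b * fromℤ c ≡ fromℤ (a ℤ.* d ℤ.+ b ℤ.* c)
      im≡ = trans (cong₂ _+_ (sym (fromℤ-* a d)) (sym (fromℤ-* b c))) (sym (fromℤ-+ (a ℤ.* d) _))

    conj-^ : ∀ {x x̄} n → Conjugate x x̄ → Conjugate (x ^ n) (x̄ ^ n)
    conj-^ zero p = conj-fromℤ (pos 1)
    conj-^ (suc n) p = conj-* p (conj-^ n p)

    -- Conjugation exchanges the two variables. Hence symmetric forms take rational integer values
    -- at (x, x̄), and antisymmetric forms integer multiples of √D.
    conj-eval : ∀ {x x̄} e → Conjugate x x̄ → Conjugate (e ⟦ x , x̄ ⟧) (e ⟦ x̄ , x ⟧)
    conj-eval (var 𝑥) p = p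
    conj-eval (var 𝑦) p = conj-sym p
    conj-eval one p = conj-fromℤ (pos 1)
    conj-eval (a ⊕ b) p = conj-+ (conj-eval a p) (conj-eval b p)
    conj-eval (a ⊗ b) p = conj-* (conj-eval a p) (conj-eval b p)
    conj-eval (⊖ a) p = conj-neg (conj-eval a p)

    x+x≡0⇒x≡0 : ∀ {x} → x + x ≡ 0# → x ≡ 0#
    x+x≡0⇒x≡0 {x} e = [ (λ p → ⊥-elim (two≢0 p)) , (λ p → p) ]′ (zero-product (fromℕ 2) x (trans (solve 1 (λ x → con (pos 2) :* x := x :+ x) refl x) e))

    selfConjugate : ∀ {x} → Conjugate x x → ∃ λ a → x ≡ fromℤ a
    selfConjugate {x} (conjugate a b p q) = a , trans p (trans (cong (fromℤ a +_) (x+x≡0⇒x≡0 (trans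
      (solve 2 (λ a v → v :+ v := (a :+ v) :- (a :- v)) refl (fromℤ a) (fromℤ b * √D)) (trans (cong₂ _-_ (sym p) (sym q)) (-‿inverseʳ x))))) (+-identityʳ _))

    antiConjugate : ∀ {x} → Conjugate x (- x) → ∃ λ b → x ≡ fromℤ b * √D
    antiConjugate {x} (conjugate a b p q) = b , trans p (trans (cong (_+ fromℤ b * √D) (x+x≡0⇒x≡0 (trans
      (solve 2 (λ a v → a :+ a := (a :+ v) :+ (a :- v)) refl (fromℤ a) (fromℤ b * √D)) (trans (cong₂ _+_ (sym p) (sym q)) (-‿inverseʳ x))))) (+-identityˡ _))

    conj-≢0 : ∀ {x x̄} → Conjugate x x̄ → x ≢ 0# → x̄ ≢ 0#
    conj-≢0 {x} {x̄} (conjugate a b p q) nz e = nz (trans p (trans (solve 2 (λ a v → a :+ v := (a :- v) :+ (v :+ v)) refl (fromℤ a) (fromℤ b * √D))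
      (trans (cong₂ (λ u v → u + (v * √D + v * √D)) (trans (sym q) e) b≡0) (solve 1 (λ w → con 0ℤ :+ (con 0ℤ :* w :+ con 0ℤ :* w) := con 0ℤ) refl √D))))
      where
      b≡0 : fromℤ b ≡ 0#
      b≡0 = cong fromℤ (trans (sym (ℤₚ.neg-involutive b)) (cong ℤ.-_ (irrational a (ℤ.- b) (trans (cong (λ z → fromℤ a + z * √D) (fromℤ-neg b))
        (trans (solve 3 (λ a b w → a :+ (:- b) :* w := a :- b :* w) refl (fromℤ a) (fromℤ b) √D) (trans (sym q) e))))))

    -- A natural number above |a ± b√D|, because √D ≤ D.
    height : ℤ → ℤ → ℕ
    height a b = ℤ.∣ a ∣ ℕ.+ ℤ.∣ b ∣ ℕ.* D

    abs-height : ∀ {x x̄} (c : Conjugate x x̄) → ∣ x ∣≤ fromℕ (height (Conjugate.re c) (Conjugate.im c))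
    abs-height (conjugate a b p q) = subst₂ ∣_∣≤_ (sym p) (trans (cong (fromℕ ℤ.∣ a ∣ +_) (sym (fromℕ-* ℤ.∣ b ∣ D))) (sym (fromℕ-+ ℤ.∣ a ∣ _)))
      (abs-+ (abs-fromℤ a) (abs-* (abs-fromℤ b) (abs-mono (abs-refl (proj₁ 0<√D)) √D≤D)))

    abs-≥1 : ∀ {i M} → fromℤ i ≢ 0# → ∣ fromℤ i ∣≤ M → 1# ≤ M
    abs-≥1 {pos zero} nz _ = ⊥-elim (nz refl)
    abs-≥1 {pos (suc n)} nz (p , _) = ≤-trans (fromℕ-mono (ℕ.s≤s (ℕ.z≤n {n}))) p
    abs-≥1 { -[1+ n ]} nz (_ , p) = ≤-trans (fromℕ-mono (ℕ.s≤s (ℕ.z≤n {n}))) (≤-trans (≤-reflexive (solve 1 (λ x → x := :- :- x) refl (fromℕ (suc n)))) p)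

    -- Liouville's argument: the norm x x̄ is a nonzero integer, and x is bounded by its height.
    conj-height : ∀ {x x̄} (c : Conjugate x x̄) → x ≢ 0# → 0# ≤ x̄ → 1# ≤ fromℕ (height (Conjugate.re c) (Conjugate.im c)) * x̄
    conj-height {x} {x̄} c nz p = abs-≥1 {proj₁ norm} (λ z → *-≢0 nz (conj-≢0 c nz) (trans (proj₂ norm) z))
        (subst (∣_∣≤ fromℕ (height re im) * x̄) (proj₂ norm) (abs-* (abs-height c) (abs-refl p)))
      where
      open Conjugate c using (re; im)
      norm : ∃ λ n → x * x̄ ≡ fromℤ n
      norm = selfConjugate (subst (Conjugate (x * x̄)) (*-comm x̄ x) (conj-* c (conj-sym c)))

    pos-fromℤ : ∀ {i} → 0# < fromℤ i → ∃ λ n → i ≡ pos (suc n)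
    pos-fromℤ {pos zero} p = ⊥-elim (proj₂ p refl)
    pos-fromℤ {pos (suc n)} p = n , refl
    pos-fromℤ { -[1+ n ]} p = ⊥-elim (<⇒≱ p (≤-trans (neg-mono-≤ (fromℕ-nonNeg (suc n))) (≤-reflexive (solve 0 (:- con 0ℤ := con 0ℤ) refl))))

    record DominatedBy (x x̄ : Carrier) : Set where
      constructor dominated
      field
        m n : ℕ
        x≡ : x ≡ fromℕ (suc m) - fromℕ (suc n) * √D
        x̄≡ : x̄ ≡ fromℕ (suc m) + fromℕ (suc n) * √D
        m≤ : fromℕ (suc m) ≤ x̄
        n≤ : fromℕ (suc n) ≤ x̄

    -- The coordinates are recovered from 4a = 2x̄ + 2x and -4b√D = 2x̄ - 2x. Both are at least x̄
    -- and hence positive, so x has the form u - v√D with u, v ≥ 1.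
    dominatedBy : ∀ {x x̄} → Conjugate x x̄ → 0# < x̄ → ∣ fromℕ 2 * x ∣≤ x̄ → DominatedBy x x̄
    dominatedBy {x} {x̄} (conjugate a b p q) 0<x̄ (r , s) = helper (pos-fromℤ 0<a) (pos-fromℤ {ℤ.- b} (subst (0# <_) (sym (fromℤ-neg b)) 0<-b))
      where
      A = fromℤ a
      B = fromℤ b
      4a≥ : x̄ ≤ fromℕ 4 * A
      4a≥ = ≤-trans (≤-reflexive (trans q (solve 3 (λ a b w → a :- b :* w := con (pos 4) :* a :+ (:- (con (pos 2) :* (a :+ b :* w)) :- (a :- b :* w))) refl A B √D)))
        (≤-trans (+-monoʳ-≤ _ (subst₂ (λ u v → - (fromℕ 2 * u) - v ≤ 0#) p q (≤-trans (+-monoˡ-≤ (- x̄) s) (≤-reflexive (-‿inverseʳ x̄))))) (≤-reflexive (+-identityʳ _)))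
      -4bw≥ : x̄ ≤ (fromℕ 4 * √D) * - B
      -4bw≥ = ≤-trans (≤-reflexive (trans q (solve 3 (λ a b w → a :- b :* w := (con (pos 4) :* w) :* (:- b) :+ (con (pos 2) :* (a :+ b :* w) :- (a :- b :* w))) refl A B √D)))
        (≤-trans (+-monoʳ-≤ _ (subst₂ (λ u v → fromℕ 2 * u - v ≤ 0#) p q (≤-trans (+-monoˡ-≤ (- x̄) r) (≤-reflexive (-‿inverseʳ x̄))))) (≤-reflexive (+-identityʳ _)))
      0<a : 0# < A
      0<a = pos-cancelˡ (fromℕ-nonNeg 4) (<-≤-trans 0<x̄ 4a≥)
      0<-b : 0# < - B
      0<-b = pos-cancelˡ (*-nonNeg (fromℕ-nonNeg 4) (proj₁ 0<√D)) (<-≤-trans 0<x̄ -4bw≥)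
      helper : (∃ λ m → a ≡ pos (suc m)) → (∃ λ n → ℤ.- b ≡ pos (suc n)) → DominatedBy x x̄
      helper (m , refl) (n , e) = dominated m n
        (trans p (trans (solve 3 (λ a b w → a :+ b :* w := a :- (:- b) :* w) refl A B √D) (cong (λ z → A - z * √D) -B≡)))
        x̄≡′
        (≤-trans (x≤y+x (*-nonNeg (fromℕ-nonNeg (suc n)) (proj₁ 0<√D))) (≤-reflexive (trans (+-comm _ _) (sym x̄≡′))))
        (≤-trans (≤-reflexive (sym (*-identityʳ _))) (≤-trans (*-monoˡ-≤ _ (fromℕ-nonNeg (suc n)) 1≤√D) (≤-trans (x≤y+x (fromℕ-nonNeg (suc m))) (≤-reflexive (sym x̄≡′)))))
        where
        -B≡ : - B ≡ fromℕ (suc n)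
        -B≡ = trans (sym (fromℤ-neg b)) (cong fromℤ e)
        x̄≡′ : x̄ ≡ fromℕ (suc m) + fromℕ (suc n) * √D
        x̄≡′ = trans q (trans (solve 3 (λ a b w → a :- b :* w := a :+ (:- b) :* w) refl A B √D) (cong (λ z → A + z * √D) -B≡))

    *-cancelˡ-abs : ∀ {x M z} → 0# < z → ∣ z * x ∣≤ z * M → ∣ x ∣≤ M
    *-cancelˡ-abs {x} {M} {z} p (q , r) = *-cancelˡ-≤ p q , *-cancelˡ-≤ p (≤-trans (≤-reflexive (solve 2 (λ z x → z :* :- x := :- (z :* x)) refl z x)) r)

    -- From κ̄ = κ + 2y√D with κ ≤ 1 and y ≤ N one gets κ̄ ≤ (1 + 2D) N.
    K₀ : ℕ
    K₀ = suc (2 ℕ.* D)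

    record Approximation (N : ℕ) : Set where
      field
        κ κ̄ : Carrier
        conj : Conjugate κ κ̄
        κ≢0 : κ ≢ 0#
        Nκ≤1 : ∣ fromℕ N * κ ∣≤ 1#
        1≤κ̄ : 1# ≤ κ̄
        κ̄≤ : κ̄ ≤ fromℕ K₀ * fromℕ N

      0<κ̄ : 0# < κ̄
      0<κ̄ = <-≤-trans 0<1 1≤κ̄

      2κ≤1 : 2 ℕ.≤ N → ∣ fromℕ 2 * κ ∣≤ 1#
      2κ≤1 2≤N = *-cancelˡ-abs (<-≤-trans (fromℕ-pos 1) (fromℕ-mono 2≤N)) (subst₂ ∣_∣≤_
        (solve 2 (λ n k → con (pos 2) :* (n :* k) := n :* (con (pos 2) :* k)) refl (fromℕ N) κ)
        (sym (*-identityʳ (fromℕ N)))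
        (abs-mono (abs-* (abs-refl (fromℕ-nonNeg 2)) Nκ≤1) (≤-trans (≤-reflexive (*-identityʳ _)) (fromℕ-mono 2≤N))))

    approximation : ∀ N → 1 ℕ.≤ N → Approximation N
    approximation N 1≤N with dirichlet N 1≤N
    ... | x , suc y , _ , y≤N , bound = record
      { κ = κ ; κ̄ = κ̄
      ; conj = conjugate x (ℤ.- pos (suc y))
          (solve 3 (λ x y w → x :- y :* w := x :+ (:- y) :* w) refl (fromℤ x) Y′ √D)
          (solve 3 (λ x y w → x :+ y :* w := x :- (:- y) :* w) refl (fromℤ x) Y′ √D)
      ; κ≢0 = λ e → -[1+]≢0 (irrational x -[1+ y ] (trans (solve 3 (λ x y w → x :+ (:- y) :* w := x :- y :* w) refl (fromℤ x) Y′ √D) e))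
      ; Nκ≤1 = bound
      ; 1≤κ̄ = 1≤κ̄
      ; κ̄≤ = begin
          κ̄ ≡⟨ κ̄≡ ⟩
          κ + fromℕ 2 * (Y′ * √D) ≤⟨ +-mono-≤ (proj₁ κ≤1) (*-monoˡ-≤ _ (fromℕ-nonNeg 2) (*-mono-≤ (fromℕ-nonNeg (suc y)) (fromℕ-nonNeg D) (fromℕ-mono y≤N) √D≤D)) ⟩
          1# + fromℕ 2 * (fromℕ N * fromℕ D) ≤⟨ +-monoˡ-≤ _ (fromℕ-mono 1≤N) ⟩
          fromℕ N + fromℕ 2 * (fromℕ N * fromℕ D) ≡⟨ solve 2 (λ n d → n :+ con (pos 2) :* (n :* d) := (con (pos 1) :+ con (pos 2) :* d) :* n) refl (fromℕ N) (fromℕ D) ⟩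
          (1# + fromℕ 2 * fromℕ D) * fromℕ N ≡⟨ cong (_* fromℕ N) (sym (trans (fromℕ-suc (2 ℕ.* D)) (cong (1# +_) (fromℕ-* 2 D)))) ⟩
          fromℕ K₀ * fromℕ N ∎ }
      where
      open ≤-Reasoning
      Y′ = fromℕ (suc y)
      κ = fromℤ x - Y′ * √D
      κ̄ = fromℤ x + Y′ * √D
      -[1+]≢0 : ∀ {n} → -[1+ n ] ≢ 0ℤ
      -[1+]≢0 ()
      κ̄≡ : κ̄ ≡ κ + fromℕ 2 * (Y′ * √D)
      κ̄≡ = solve 3 (λ x y w → x :+ y :* w := (x :- y :* w) :+ con (pos 2) :* (y :* w)) refl (fromℤ x) Y′ √D
      0<N : 0# < fromℕ N
      0<N = <-≤-trans 0<1 (fromℕ-mono 1≤N)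
      κ≤1 : ∣ κ ∣≤ 1#
      κ≤1 = *-cancelˡ-abs 0<N (abs-mono bound (≤-trans (fromℕ-mono 1≤N) (≤-reflexive (sym (*-identityʳ _)))))
      1≤κ̄ : 1# ≤ κ̄
      1≤κ̄ = begin
        1# ≡⟨ solve 0 (con (pos 1) := (:- con (pos 1)) :+ con (pos 2) :* (con (pos 1) :* con (pos 1))) refl ⟩
        - 1# + fromℕ 2 * (1# * 1#) ≤⟨ +-mono-≤ (≤-trans (neg-mono-≤ (proj₂ κ≤1)) (≤-reflexive (solve 1 (λ x → :- :- x := x) refl κ)))
             (*-monoˡ-≤ _ (fromℕ-nonNeg 2) (*-mono-≤ 0≤1 (proj₁ 0<√D) (fromℕ-mono {1} {suc y} (ℕ.s≤s ℕ.z≤n)) 1≤√D)) ⟩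
        κ + fromℕ 2 * (Y′ * √D) ≡⟨ sym κ̄≡ ⟩
        κ̄ ∎

  -- Approximants for rational multiples of squares.

  module Core
    (D : ℕ) (√D : Carrier) (1≤√D : 1# ≤ √D) (√D² : √D * √D ≡ fromℕ D)
    (irrational : ∀ a b → fromℤ a + fromℤ b * √D ≡ 0# → b ≡ 0ℤ) where
    open Evaluation
    open RationalApproximation
    open QuadraticIntegers D √D 1≤√D √D² irrational

    fromℤ-≢0 : ∀ {i} → i ≢ 0ℤ → fromℤ i ≢ 0#
    fromℤ-≢0 p e = p (fromℤ-injective {j = 0ℤ} e)

    -- The estimate `dominates` needs N ≥ 2M², and N ≥ 2 ensures 2|κ| ≤ 1.
    threshold : ℕ → ℕ
    threshold M = 2 ℕ.+ 2 ℕ.* (M ℕ.* M)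

    2≤threshold : ∀ {M N} → threshold M ℕ.≤ N → 2 ℕ.≤ N
    2≤threshold = ℕₚ.≤-trans (ℕₚ.m≤m+n 2 _)

    -- The left side is at most 2M / N, the right side at least 1 / M.
    dominates : ∀ {x₀ y₀ z z̄} M N → ∣ x₀ ∣≤ fromℕ M → 1# ≤ fromℕ M * y₀ → threshold M ℕ.≤ N →
      ∣ fromℕ N * z ∣≤ 1# → 1# ≤ z̄ → ∣ fromℕ 2 * (x₀ * z) ∣≤ y₀ * z̄
    dominates {x₀} {y₀} {z} {z̄} M N x₀≤ 1≤y₀ N≥ Nz≤1 1≤z̄ = *-cancelˡ-abs (*-pos 0<M 0<N) (abs-mono
        (subst (∣_∣≤ (fromℕ 2 * fromℕ M) * (fromℕ M * 1#))
          (solve 4 (λ m n x z → (con (pos 2) :* m) :* (x :* (n :* z)) := (m :* n) :* (con (pos 2) :* (x :* z))) refl (fromℕ M) (fromℕ N) x₀ z)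
          (abs-* (abs-refl (*-nonNeg (fromℕ-nonNeg 2) (fromℕ-nonNeg M))) (abs-* x₀≤ Nz≤1)))
        (begin
          (fromℕ 2 * fromℕ M) * (fromℕ M * 1#) ≡⟨ solve 1 (λ m → (con (pos 2) :* m) :* (m :* con (pos 1)) := con (pos 2) :* (m :* m)) refl (fromℕ M) ⟩
          fromℕ 2 * (fromℕ M * fromℕ M) ≡⟨ sym (trans (fromℕ-* 2 (M ℕ.* M)) (cong (fromℕ 2 *_) (fromℕ-* M M))) ⟩
          fromℕ (2 ℕ.* (M ℕ.* M)) ≤⟨ fromℕ-mono (ℕₚ.≤-trans (ℕₚ.m≤n+m _ 2) N≥) ⟩
          fromℕ N ≡⟨ sym (trans (*-identityʳ _) (*-identityʳ _)) ⟩
          (fromℕ N * 1#) * 1# ≤⟨ *-mono-≤ (*-nonNeg (proj₁ 0<N) 0≤1) (≤-trans 0≤1 1≤z̄) (*-monoˡ-≤ _ (proj₁ 0<N) 1≤y₀) 1≤z̄ ⟩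
          (fromℕ N * (fromℕ M * y₀)) * z̄ ≡⟨ solve 4 (λ m n y z → (n :* (m :* y)) :* z := (m :* n) :* (y :* z)) refl (fromℕ M) (fromℕ N) y₀ z̄ ⟩
          (fromℕ M * fromℕ N) * (y₀ * z̄) ∎))
      where
      open ≤-Reasoning
      0<N : 0# < fromℕ N
      0<N = <-≤-trans 0<1 (fromℕ-mono (ℕₚ.≤-trans (ℕ.s≤s ℕ.z≤n) (2≤threshold {M} N≥)))
      0<M : 0# < fromℕ M
      0<M = fromℕ-nonNeg M , λ e → 1≢0 (≤-antisym (≤-trans 1≤y₀ (≤-reflexive (trans (cong (_* y₀) (sym e)) (zeroˡ y₀)))) 0≤1)

    private
      bound₃ : ∀ {x y z P Q R} → x ℕ.≤ P → y ℕ.≤ Q → z ℕ.≤ R → x ℕ.* y ℕ.* z ℕ.≤ P ℕ.* Q ℕ.* R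
      bound₃ p q r = ℕₚ.*-mono-≤ (ℕₚ.*-mono-≤ p q) r

    module SquareClass (α : Carrier) (p q : ℕ) (1≤p : 1 ℕ.≤ p) (1≤q : 1 ℕ.≤ q) (u v : ℤ) (u≢0 : u ≢ 0ℤ) (v≢0 : v ≢ 0ℤ)
      (0<γ : 0# < fromℤ u + fromℤ v * √D)
      (α≡ : fromℕ q * α ≡ fromℕ p * ((fromℤ u + fromℤ v * √D) * (fromℤ u + fromℤ v * √D))) where

      private
        γ γ̄ : Carrier
        γ = fromℤ u + fromℤ v * √D
        γ̄ = fromℤ u - fromℤ v * √D
        γγ̄ : Conjugate γ γ̄
        γγ̄ = conjugate u v refl refl
        γ̄γ : Conjugate γ̄ γ
        γ̄γ = conj-sym γγ̄
        M M′ : ℕ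
        M = height u (ℤ.- v)
        M′ = height u v
        γ̄≢0 : γ̄ ≢ 0#
        γ̄≢0 = conj-≢0 γγ̄ (λ e → proj₂ 0<γ (sym e))

      module _ (N : ℕ) (approx : Approximation N) where
        open Approximation approx

        module _ (κ-dominated : DominatedBy κ κ̄) (η-dominated : DominatedBy (γ̄ * κ) (γ * κ̄)) where
          private
            module κ = DominatedBy κ-dominated
            module η = DominatedBy η-dominated
            m n z s : ℕ
            m = suc κ.m
            n = suc κ.n
            z = suc η.m
            s = suc η.n

            κ̄-bound : ∀ {x} → fromℕ x ≤ κ̄ → x ℕ.≤ K₀ ℕ.* N
            κ̄-bound h = fromℕ-cancel (≤-trans h (≤-trans κ̄≤ (≤-reflexive (sym (fromℕ-* K₀ N)))))
            η̄-bound : ∀ {x} → fromℕ x ≤ γ * κ̄ → x ℕ.≤ M′ ℕ.* (K₀ ℕ.* N)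
            η̄-bound h = fromℕ-cancel (≤-trans h (≤-trans (*-mono-≤ (proj₁ 0<γ) (*-nonNeg (fromℕ-nonNeg K₀) (fromℕ-nonNeg N)) (proj₁ (abs-height γγ̄)) κ̄≤)
              (≤-reflexive (sym (trans (fromℕ-* M′ (K₀ ℕ.* N)) (cong (fromℕ M′ *_) (fromℕ-* K₀ N)))))))

          -- Each factor is κ̄ or γκ̄ in size, up to a multiplier 1, p or q; p + q covers the
          -- multipliers, M′ + 1 the possible factor γ, and K₀ the ratio of κ̄ to N.
          k : ℕ
          k = (p ℕ.+ q) ℕ.* suc M′ ℕ.* K₀

          -- The defect p (γ² m n - z s), which is O(N^(-2)) because N|κ| ≤ 1.
          gap₀ : Carrier
          gap₀ = - (fromℕ p * (fromℤ u * fromℤ v)) * (κ * κ)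

          private
            S = k ℕ.* N ℕ.^ 1
            S≡ : (p ℕ.+ q) ℕ.* suc M′ ℕ.* (K₀ ℕ.* N) ≡ S
            S≡ = trans (sym (ℕₚ.*-assoc ((p ℕ.+ q) ℕ.* suc M′) K₀ N)) (cong (k ℕ.*_) (sym (ℕₚ.*-identityʳ N)))
            1≤p+q = ℕₚ.≤-trans 1≤p (ℕₚ.m≤m+n p q)
            κ̄-small : ∀ {l x} → l ℕ.≤ p ℕ.+ q → x ℕ.≤ K₀ ℕ.* N → l ℕ.* x ℕ.≤ S
            κ̄-small {l} {x} h h′ = subst₂ ℕ._≤_ (cong (ℕ._* x) (ℕₚ.*-identityʳ l)) S≡ (bound₃ h (ℕ.s≤s (ℕ.z≤n {M′})) h′)
            η̄-small : ∀ {l x} → l ℕ.≤ p ℕ.+ q → x ℕ.≤ M′ ℕ.* (K₀ ℕ.* N) → l ℕ.* x ℕ.≤ S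
            η̄-small {l} {x} h h′ = ℕₚ.≤-trans (ℕₚ.*-mono-≤ h h′) (subst₂ ℕ._≤_ (ℕₚ.*-assoc (p ℕ.+ q) M′ (K₀ ℕ.* N)) S≡
              (bound₃ (ℕₚ.≤-refl {p ℕ.+ q}) (ℕₚ.n≤1+n M′) (ℕₚ.≤-refl {K₀ ℕ.* N})))

            -- With κ = m − n√D and γ̄κ = z − s√D one has 4mn√D = κ̄² − κ² and 4zs√D = γ²κ̄² − γ̄²κ².
            core : γ * γ * (fromℕ m * fromℕ n) - fromℕ z * fromℕ s ≡ - (fromℤ u * fromℤ v) * (κ * κ)
            core = *-cancelˡ (*-≢0 (λ e → proj₂ (fromℕ-pos 3) (sym e)) √D≢0) (begin
              (fromℕ 4 * √D) * (γ * γ * (fromℕ m * fromℕ n) - fromℕ z * fromℕ s)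
                ≡⟨ solve 6 (λ g w m n z s → (con (pos 4) :* w) :* (g :* g :* (m :* n) :- z :* s)
                     := g :* g :* ((m :+ n :* w) :* (m :+ n :* w) :- (m :- n :* w) :* (m :- n :* w)) :- ((z :+ s :* w) :* (z :+ s :* w) :- (z :- s :* w) :* (z :- s :* w)))
                     refl γ √D (fromℕ m) (fromℕ n) (fromℕ z) (fromℕ s) ⟩
              γ * γ * ((fromℕ m + fromℕ n * √D) * (fromℕ m + fromℕ n * √D) - (fromℕ m - fromℕ n * √D) * (fromℕ m - fromℕ n * √D))
                - ((fromℕ z + fromℕ s * √D) * (fromℕ z + fromℕ s * √D) - (fromℕ z - fromℕ s * √D) * (fromℕ z - fromℕ s * √D))
                ≡⟨ cong₂ _-_ (cong₂ (λ a b → γ * γ * (a * a - b * b)) (sym κ.x̄≡) (sym κ.x≡)) (cong₂ (λ a b → a * a - b * b) (sym η.x̄≡) (sym η.x≡)) ⟩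
              γ * γ * (κ̄ * κ̄ - κ * κ) - ((γ * κ̄) * (γ * κ̄) - (γ̄ * κ) * (γ̄ * κ))
                ≡⟨ solve 5 (λ u v w k k̄ → (u :+ v :* w) :* (u :+ v :* w) :* (k̄ :* k̄ :- k :* k)
                       :- (((u :+ v :* w) :* k̄) :* ((u :+ v :* w) :* k̄) :- ((u :- v :* w) :* k) :* ((u :- v :* w) :* k))
                     := (con (pos 4) :* w) :* (:- (u :* v) :* (k :* k))) refl (fromℤ u) (fromℤ v) √D κ κ̄ ⟩
              (fromℕ 4 * √D) * (- (fromℤ u * fromℤ v) * (κ * κ)) ∎)
              where open ≡-Reasoning

            gap₀≡ : gap₀ ≡ α * fromℕ ((q ℕ.* m) ℕ.* (1 ℕ.* n)) - fromℕ ((p ℕ.* z) ℕ.* (1 ℕ.* s))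
            gap₀≡ = sym (begin
              α * fromℕ ((q ℕ.* m) ℕ.* (1 ℕ.* n)) - fromℕ ((p ℕ.* z) ℕ.* (1 ℕ.* s))
                ≡⟨ cong₂ (λ a b → α * a - b) (split q m n) (split p z s) ⟩
              α * ((fromℕ q * fromℕ m) * fromℕ n) - (fromℕ p * fromℕ z) * fromℕ s
                ≡⟨ solve 7 (λ α q m n p z s → α :* ((q :* m) :* n) :- (p :* z) :* s := (q :* α) :* (m :* n) :- p :* (z :* s)) refl α (fromℕ q) (fromℕ m) (fromℕ n) (fromℕ p) (fromℕ z) (fromℕ s) ⟩
              (fromℕ q * α) * (fromℕ m * fromℕ n) - fromℕ p * (fromℕ z * fromℕ s)
                ≡⟨ cong (λ a → a * (fromℕ m * fromℕ n) - fromℕ p * (fromℕ z * fromℕ s)) α≡ ⟩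
              (fromℕ p * (γ * γ)) * (fromℕ m * fromℕ n) - fromℕ p * (fromℕ z * fromℕ s)
                ≡⟨ solve 4 (λ p g a b → (p :* g) :* a :- p :* b := p :* (g :* a :- b)) refl (fromℕ p) (γ * γ) (fromℕ m * fromℕ n) (fromℕ z * fromℕ s) ⟩
              fromℕ p * (γ * γ * (fromℕ m * fromℕ n) - fromℕ z * fromℕ s) ≡⟨ cong (fromℕ p *_) core ⟩
              fromℕ p * (- (fromℤ u * fromℤ v) * (κ * κ)) ≡⟨ solve 3 (λ p a b → p :* ((:- a) :* b) := (:- (p :* a)) :* b) refl (fromℕ p) (fromℤ u * fromℤ v) (κ * κ) ⟩
              gap₀ ∎)
              where
              open ≡-Reasoning
              split : ∀ q m n → fromℕ ((q ℕ.* m) ℕ.* (1 ℕ.* n)) ≡ (fromℕ q * fromℕ m) * fromℕ n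
              split q m n = trans (fromℕ-* (q ℕ.* m) (1 ℕ.* n)) (cong₂ _*_ (fromℕ-* q m) (cong fromℕ (ℕₚ.*-identityˡ n)))

            gap₀≢0 : gap₀ ≢ 0#
            gap₀≢0 e = *-≢0 (*-≢0 (λ e → proj₂ (<-≤-trans 0<1 (fromℕ-mono 1≤p)) (sym e)) (*-≢0 (fromℤ-≢0 u≢0) (fromℤ-≢0 v≢0))) (*-≢0 κ≢0 κ≢0)
              (trans (solve 2 (λ a b → a :* b := :- ((:- a) :* b)) refl (fromℕ p * (fromℤ u * fromℤ v)) (κ * κ)) (trans (cong -_ e) (solve 0 (:- con 0ℤ := con 0ℤ) refl)))

          squareApproximant : Approximant α S
          squareApproximant = record
            -- The multiplier 1 lets `κ̄-small` and `η̄-small` bound all four factors uniformly.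
            { a = q ℕ.* m ; b = 1 ℕ.* n ; c = p ℕ.* z ; d = 1 ℕ.* s
            ; 1≤a = ℕₚ.*-mono-≤ 1≤q (ℕ.s≤s ℕ.z≤n) ; 1≤b = ℕ.s≤s ℕ.z≤n
            ; 1≤c = ℕₚ.*-mono-≤ 1≤p (ℕ.s≤s ℕ.z≤n) ; 1≤d = ℕ.s≤s ℕ.z≤n
            ; a≤S = κ̄-small (ℕₚ.m≤n+m q p) (κ̄-bound κ.m≤) ; b≤S = κ̄-small 1≤p+q (κ̄-bound κ.n≤)
            ; c≤S = η̄-small (ℕₚ.m≤m+n p q) (η̄-bound η.m≤) ; d≤S = η̄-small 1≤p+q (η̄-bound η.n≤)
            ; gap = gap₀ ; gap≡ = gap₀≡ ; gap≢0 = gap₀≢0 }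

          gap₀≤ : ∣ gap₀ * fromℕ (N ℕ.^ 2) ∣≤ fromℕ (p ℕ.* (ℤ.∣ u ∣ ℕ.* ℤ.∣ v ∣))
          gap₀≤ = subst₂ ∣_∣≤_
            (trans (solve 3 (λ a k n → (:- a) :* ((n :* k) :* (n :* k)) := (:- a) :* (k :* k) :* (n :* (n :* con (pos 1)))) refl (fromℕ p * (fromℤ u * fromℤ v)) κ (fromℕ N)) (cong (gap₀ *_) (sym (fromℕ-^ N 2))))
            (trans (solve 1 (λ x → x :* (con (pos 1) :* con (pos 1)) := x) refl _) (trans (cong (fromℕ p *_) (sym (fromℕ-* ℤ.∣ u ∣ ℤ.∣ v ∣))) (sym (fromℕ-* p _))))
            (abs-* (abs-neg (abs-* (abs-refl (fromℕ-nonNeg p)) (abs-* (abs-fromℤ u) (abs-fromℤ v)))) (abs-* Nκ≤1 Nκ≤1))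

      squareApproximable : Approximable α 1 2
      squareApproximable = record
        { k₁ = (p ℕ.+ q) ℕ.* suc M′ ℕ.* K₀ ; k₂ = p ℕ.* (ℤ.∣ u ∣ ℕ.* ℤ.∣ v ∣) ; N₀ = threshold M
        ; approximant = λ N N≥ →
            let 2≤N = 2≤threshold {M} N≥
                approx = approximation N (ℕₚ.≤-trans (ℕ.s≤s ℕ.z≤n) 2≤N)
                open Approximation approx
                κ-dominated = dominatedBy conj 0<κ̄ (abs-mono (2κ≤1 2≤N) 1≤κ̄)
                η-dominated = dominatedBy (conj-* γ̄γ conj) (*-pos 0<γ 0<κ̄)
                  (dominates M N (abs-height γ̄γ) (conj-height γ̄γ γ̄≢0 (proj₁ 0<γ)) N≥ Nκ≤1 1≤κ̄)
            in squareApproximant N approx κ-dominated η-dominated , gap₀≤ N approx κ-dominated η-dominated }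

  -- Approximants for general quadratic slopes.

  module GeneralCore
    (D : ℕ) (√D : Carrier) (1≤√D : 1# ≤ √D) (√D² : √D * √D ≡ fromℕ D)
    (irrational : ∀ a b → fromℤ a + fromℤ b * √D ≡ 0# → b ≡ 0ℤ) where
    open Evaluation
    open RationalApproximation
    open QuadraticIntegers D √D 1≤√D √D² irrational
    open Core D √D 1≤√D √D² irrational

    module General (α : Carrier) (q : ℕ) (1≤q : 1 ℕ.≤ q) (a₀ b₀ : ℤ) (b₀≢0 : b₀ ≢ 0ℤ)
      (α≡ : fromℕ q * α ≡ fromℤ a₀ + fromℤ b₀ * √D) (0<y₀ : 0# < fromℤ a₀ + fromℤ b₀ * √D)
      (B : BalancedFactorisation) where
      open BalancedFactorisation B

      module _ (symmetric : ∀ {x y} → Nondegenerate x y → E ⟦ y , x ⟧ ≡ E ⟦ x , y ⟧) where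

        private
          x₀ y₀ : Carrier
          x₀ = fromℤ a₀ - fromℤ b₀ * √D
          y₀ = fromℤ a₀ + fromℤ b₀ * √D
          y₀x₀ : Conjugate y₀ x₀
          y₀x₀ = conjugate a₀ b₀ refl refl
          x₀y₀ : Conjugate x₀ y₀
          x₀y₀ = conj-sym y₀x₀
          M M′ N₁ : ℕ
          M = height a₀ (ℤ.- b₀)
          M′ = height a₀ b₀
          N₁ = M′ ℕ.* (K₀ ℕ.* K₀)
          -- Since σ̄ ≤ N₁ N², the factors 4qu and v are at most r₁ N^(L + 1), the value of E at
          -- most r₂ N^(L + 1), and C / √D at most r₃ N^(L - 1). The last constant bounds 2|b₀| (N^L
          -- θ)².
          r₁ r₂ r₃ k₁ k₂ : ℕ
          r₁ = 4 ℕ.* q ℕ.* (N₁ ℕ.^ t ℕ.* K₀)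
          r₂ = k ℕ.* N₁ ℕ.^ d
          r₃ = 2 ℕ.* k ℕ.* N₁ ℕ.^ t
          k₁ = r₁ ℕ.+ r₂ ℕ.+ r₃
          k₂ = 2 ℕ.* ℤ.∣ b₀ ∣ ℕ.* (M ℕ.^ t ℕ.* M ℕ.^ t)
          r₁≤k₁ : r₁ ℕ.≤ k₁
          r₁≤k₁ = ℕₚ.≤-trans (ℕₚ.m≤m+n r₁ r₂) (ℕₚ.m≤m+n (r₁ ℕ.+ r₂) r₃)
          r₂≤k₁ : r₂ ℕ.≤ k₁
          r₂≤k₁ = ℕₚ.≤-trans (ℕₚ.m≤n+m r₂ r₁) (ℕₚ.m≤m+n (r₁ ℕ.+ r₂) r₃)
          r₃≤k₁ : r₃ ℕ.≤ k₁
          r₃≤k₁ = ℕₚ.m≤n+m r₃ (r₁ ℕ.+ r₂)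
          x₀≢0 : x₀ ≢ 0#
          x₀≢0 = conj-≢0 y₀x₀ (λ e → proj₂ 0<y₀ (sym e))

        E-pos : ∀ {x y} → Small x y → 0# < E ⟦ x , y ⟧
        E-pos s = pos-cancelˡ (fromℕ-nonNeg k) (<-≤-trans (^-pos d (Small.0<y s)) (lower s))

        C-pos : ∀ {x y} → Small x y → 0# < C ⟦ x , y ⟧
        C-pos {x} {y} s = pos-cancelˡ (proj₁ (E-pos s)) (subst (0# <_) (sym (product nd))
            (nonNeg⇒0≤ (diff (proj₁ (small⇒abs (small-^ (t ℕ.+ t) s)))) , λ e → odd-≢ nd (x-y≡0⇒x≡y (sym e))))
          where nd = small⇒nondeg s

        -- C is (y^L - x^L) / E, with numerator at most 2 y^L and denominator at least y^d / k.
        C-upper : ∀ {x y} → Small x y → C ⟦ x , y ⟧ ≤ fromℕ (2 ℕ.* k) * y ^ t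
        C-upper {x} {y} s = *-cancelˡ-≤ (^-pos d (Small.0<y s)) (begin
          y ^ d * C ⟦ x , y ⟧ ≤⟨ *-monoʳ-≤ _ (proj₁ (C-pos s)) (lower s) ⟩
          fromℕ k * E ⟦ x , y ⟧ * C ⟦ x , y ⟧ ≡⟨ trans (*-assoc _ _ _) (cong (fromℕ k *_) (product (small⇒nondeg s))) ⟩
          fromℕ k * (y ^ L - x ^ L) ≤⟨ *-monoˡ-≤ _ (fromℕ-nonNeg k) (+-monoʳ-≤ (y ^ L) (proj₂ (small⇒abs (small-^ (t ℕ.+ t) s)))) ⟩
          fromℕ k * (y ^ L + y ^ L) ≡⟨ cong (λ z → fromℕ k * (z + z)) (trans (cong (y ^_) (sym (ℕₚ.+-suc t t))) (^-+ y t d)) ⟩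
          fromℕ k * (y ^ t * y ^ d + y ^ t * y ^ d) ≡⟨ solve 3 (λ k a b → k :* (a :* b :+ a :* b) := b :* ((con (pos 2) :* k) :* a)) refl (fromℕ k) (y ^ t) (y ^ d) ⟩
          y ^ d * ((fromℕ 2 * fromℕ k) * y ^ t) ≡⟨ cong (λ z → y ^ d * (z * y ^ t)) (sym (fromℕ-* 2 k)) ⟩
          y ^ d * (fromℕ (2 ℕ.* k) * y ^ t) ∎)
          where open ≤-Reasoning

        -- The product y^L - x^L changes sign under the exchange and E does not. So C at a pair of
        -- conjugates supplies the factor √D of σ̄^L - σ^L.
        C-antisymmetric : ∀ {x y} → Nondegenerate x y → C ⟦ y , x ⟧ ≡ - C ⟦ x , y ⟧
        C-antisymmetric {x} {y} n = *-cancelˡ (E≢0 n) (begin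
          E ⟦ x , y ⟧ * C ⟦ y , x ⟧ ≡⟨ cong (_* C ⟦ y , x ⟧) (sym (symmetric n)) ⟩
          E ⟦ y , x ⟧ * C ⟦ y , x ⟧ ≡⟨ product (nondeg-swap n) ⟩
          x ^ L - y ^ L ≡⟨ solve 2 (λ a b → a :- b := :- (b :- a)) refl (x ^ L) (y ^ L) ⟩
          - (y ^ L - x ^ L) ≡⟨ cong -_ (sym (product n)) ⟩
          - (E ⟦ x , y ⟧ * C ⟦ x , y ⟧) ≡⟨ solve 2 (λ a b → :- (a :* b) := a :* (:- b)) refl (E ⟦ x , y ⟧) (C ⟦ x , y ⟧) ⟩
          E ⟦ x , y ⟧ * - C ⟦ x , y ⟧ ∎)
          where open ≡-Reasoning

        -- Applied with w = 1 to the value of E and with w = √D to that of C.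
        positiveInteger : ∀ {z} w → 0# ≤ w → 0# < z → (∃ λ i → z ≡ fromℤ i * w) → ∃ λ n → z ≡ fromℕ (suc n) * w
        positiveInteger {z} w 0≤w 0<z (i , z≡) = n , trans z≡ (cong (λ i → fromℤ i * w) i≡)
          where
          natural : ∃ λ n → i ≡ pos (suc n)
          natural = pos-fromℤ {i} (pos-cancelˡ 0≤w (subst (0# <_) (trans z≡ (*-comm _ _)) 0<z))
          n = proj₁ natural
          i≡ = proj₂ natural

        E-integral : ∀ {x y} → Conjugate x y → Small x y → ∃ λ e → E ⟦ x , y ⟧ ≡ fromℕ (suc e) * 1#
        E-integral {x} {y} c s = positiveInteger 1# 0≤1 (E-pos s)
          (proj₁ integer , trans (proj₂ integer) (sym (*-identityʳ _)))
          where
          integer : ∃ λ i → E ⟦ x , y ⟧ ≡ fromℤ i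
          integer = selfConjugate (subst (Conjugate (E ⟦ x , y ⟧)) (symmetric (small⇒nondeg s)) (conj-eval E c))

        C-integral : ∀ {x y} → Conjugate x y → Small x y → ∃ λ c → C ⟦ x , y ⟧ ≡ fromℕ (suc c) * √D
        C-integral {x} {y} c s = positiveInteger √D (proj₁ 0<√D) (C-pos s)
          (antiConjugate (subst (Conjugate (C ⟦ x , y ⟧)) (C-antisymmetric (small⇒nondeg s)) (conj-eval C c)))

        module _ (N : ℕ) (1≤N : 1 ℕ.≤ N) (approx : Approximation N) where
          open Approximation approx

          module _ (σ-small : Small (x₀ * (κ * κ)) (y₀ * (κ̄ * κ̄)))
            (θ-dominated : DominatedBy ((x₀ * (κ * κ)) ^ t * κ) ((y₀ * (κ̄ * κ̄)) ^ t * κ̄))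
            (e c : ℕ) (E≡ : E ⟦ x₀ * (κ * κ) , y₀ * (κ̄ * κ̄) ⟧ ≡ fromℕ (suc e))
            (C≡ : C ⟦ x₀ * (κ * κ) , y₀ * (κ̄ * κ̄) ⟧ ≡ fromℕ (suc c) * √D) where
            private
              σ σ̄ θ θ̄ : Carrier
              σ = x₀ * (κ * κ)
              σ̄ = y₀ * (κ̄ * κ̄)
              θ = σ ^ t * κ
              θ̄ = σ̄ ^ t * κ̄
              module θ = DominatedBy θ-dominated
              u v : ℕ
              u = suc θ.m
              v = suc θ.n
              τ : ℕ
              τ = N₁ ℕ.* (N ℕ.* N)

              0≤σ̄ : 0# ≤ σ̄
              0≤σ̄ = proj₁ (Small.0<y σ-small)

              σ̄≤τ : σ̄ ≤ fromℕ τ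
              σ̄≤τ = begin
                y₀ * (κ̄ * κ̄) ≤⟨ *-mono-≤ (proj₁ 0<y₀) (*-nonNeg 0≤KN 0≤KN) (proj₁ (abs-height y₀x₀)) (*-mono-≤ (proj₁ 0<κ̄) 0≤KN κ̄≤ κ̄≤) ⟩
                fromℕ M′ * ((fromℕ K₀ * fromℕ N) * (fromℕ K₀ * fromℕ N)) ≡⟨ solve 3 (λ m k n → m :* ((k :* n) :* (k :* n)) := (m :* (k :* k)) :* (n :* n)) refl (fromℕ M′) (fromℕ K₀) (fromℕ N) ⟩
                (fromℕ M′ * (fromℕ K₀ * fromℕ K₀)) * (fromℕ N * fromℕ N) ≡⟨ sym (trans (fromℕ-* N₁ (N ℕ.* N)) (cong₂ _*_ (trans (fromℕ-* M′ (K₀ ℕ.* K₀)) (cong (fromℕ M′ *_) (fromℕ-* K₀ K₀))) (fromℕ-* N N))) ⟩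
                fromℕ τ ∎
                where
                open ≤-Reasoning
                0≤KN : 0# ≤ fromℕ K₀ * fromℕ N
                0≤KN = *-nonNeg (fromℕ-nonNeg K₀) (fromℕ-nonNeg N)

              σ̄^≤τ^ : ∀ j → σ̄ ^ j ≤ fromℕ (τ ℕ.^ j)
              σ̄^≤τ^ j = ≤-trans (^-mono-≤ j 0≤σ̄ σ̄≤τ) (≤-reflexive (sym (fromℕ-^ τ j)))

              θ̄-bound : ∀ {x} → fromℕ x ≤ θ̄ → x ℕ.≤ τ ℕ.^ t ℕ.* (K₀ ℕ.* N)
              θ̄-bound h = fromℕ-cancel (≤-trans h (≤-trans (*-mono-≤ (^-nonNeg t 0≤σ̄) (*-nonNeg (fromℕ-nonNeg K₀) (fromℕ-nonNeg N)) (σ̄^≤τ^ t) κ̄≤)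
                (≤-reflexive (sym (trans (fromℕ-* (τ ℕ.^ t) (K₀ ℕ.* N)) (cong (fromℕ (τ ℕ.^ t) *_) (fromℕ-* K₀ N)))))))

              e-bound : suc e ℕ.≤ k ℕ.* τ ℕ.^ d
              e-bound = fromℕ-cancel (≤-trans (≤-reflexive (sym E≡)) (≤-trans (upper σ-small) (≤-trans (*-monoˡ-≤ _ (fromℕ-nonNeg k) (σ̄^≤τ^ d)) (≤-reflexive (sym (fromℕ-* k (τ ℕ.^ d)))))))

              c-bound : suc c ℕ.≤ 2 ℕ.* k ℕ.* τ ℕ.^ t
              c-bound = fromℕ-cancel (≤-trans (≤-reflexive (sym (*-identityʳ _))) (≤-trans (*-monoˡ-≤ _ (fromℕ-nonNeg (suc c)) 1≤√D)
                (≤-trans (≤-reflexive (sym C≡)) (≤-trans (C-upper σ-small) (≤-trans (*-monoˡ-≤ _ (fromℕ-nonNeg (2 ℕ.* k)) (σ̄^≤τ^ t)) (≤-reflexive (sym (fromℕ-* (2 ℕ.* k) (τ ℕ.^ t)))))))))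

            private
              S P : ℕ
              S = k₁ ℕ.* N ℕ.^ suc L
              P = N ℕ.* N

              N≤P : N ℕ.≤ P
              N≤P = subst (ℕ._≤ P) (ℕₚ.*-identityˡ N) (ℕₚ.*-monoˡ-≤ N 1≤N)

              S≡ : S ≡ k₁ ℕ.* P ℕ.^ d
              S≡ = cong (k₁ ℕ.*_) (trans (cong (N ℕ.^_) (solveℕ t)) (trans (sym (ℕₚ.^-*-assoc N 2 d)) (cong (λ z → (N ℕ.* z) ℕ.^ d) (ℕₚ.*-identityʳ N))))
                where
                solveℕ : ∀ t → suc (suc (t ℕ.+ t)) ≡ 2 ℕ.* suc t
                solveℕ = ℕₛ.solve 1 (λ t → ℕₛ.con 2 ℕₛ.:+ (t ℕₛ.:+ t) ℕₛ.:= ℕₛ.con 2 ℕₛ.:* (ℕₛ.con 1 ℕₛ.:+ t)) refl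

              ^-distrib : ∀ a b n → (a ℕ.* b) ℕ.^ n ≡ a ℕ.^ n ℕ.* b ℕ.^ n
              ^-distrib a b zero = refl
              ^-distrib a b (suc n) = trans (cong (a ℕ.* b ℕ.*_) (^-distrib a b n)) (ℕₚ.[m*n]*[o*p]≡[m*o]*[n*p] a b (a ℕ.^ n) (b ℕ.^ n))

              P^t≤ : P ℕ.^ t ℕ.≤ P ℕ.^ d
              P^t≤ = subst (ℕ._≤ P ℕ.^ d) (ℕₚ.*-identityˡ _) (ℕₚ.*-monoˡ-≤ (P ℕ.^ t) (ℕₚ.≤-trans 1≤N N≤P))

              uv-bound : ∀ {x} → x ℕ.≤ τ ℕ.^ t ℕ.* (K₀ ℕ.* N) → x ℕ.≤ (N₁ ℕ.^ t ℕ.* K₀) ℕ.* P ℕ.^ d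
              uv-bound {x} h = begin
                x ≤⟨ h ⟩
                -- Here u and v have size N^L only; rounding N up to P = N² is harmless, since the
                -- bound for E is already of order N^(L + 1).
                τ ℕ.^ t ℕ.* (K₀ ℕ.* N) ≤⟨ ℕₚ.*-monoʳ-≤ (τ ℕ.^ t) (ℕₚ.*-monoʳ-≤ K₀ N≤P) ⟩
                τ ℕ.^ t ℕ.* (K₀ ℕ.* P) ≡⟨ cong (ℕ._* (K₀ ℕ.* P)) (^-distrib N₁ P t) ⟩
                N₁ ℕ.^ t ℕ.* P ℕ.^ t ℕ.* (K₀ ℕ.* P) ≡⟨ ℕₛ.solve 4 (λ a b k p → (a ℕₛ.:* b) ℕₛ.:* (k ℕₛ.:* p) ℕₛ.:= (a ℕₛ.:* k) ℕₛ.:* (p ℕₛ.:* b)) refl (N₁ ℕ.^ t) (P ℕ.^ t) K₀ P ⟩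
                (N₁ ℕ.^ t ℕ.* K₀) ℕ.* P ℕ.^ d ∎
                where
                open ℕₚ.≤-Reasoning

              ≤S : ∀ {r x} → r ℕ.≤ k₁ → x ℕ.≤ r ℕ.* P ℕ.^ d → x ℕ.≤ S
              ≤S {r} r≤k₁ h = ℕₚ.≤-trans h (ℕₚ.≤-trans (ℕₚ.*-monoˡ-≤ (P ℕ.^ d) r≤k₁) (ℕₚ.≤-reflexive (sym S≡)))

              a≤S : 4 ℕ.* q ℕ.* u ℕ.≤ S
              a≤S = ≤S r₁≤k₁ (ℕₚ.≤-trans (ℕₚ.*-monoʳ-≤ (4 ℕ.* q) (uv-bound (θ̄-bound θ.m≤)))
                (ℕₚ.≤-reflexive (sym (ℕₚ.*-assoc (4 ℕ.* q) (N₁ ℕ.^ t ℕ.* K₀) (P ℕ.^ d)))))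

              b≤S : v ℕ.≤ S
              b≤S = ≤S r₁≤k₁ (ℕₚ.≤-trans (uv-bound (θ̄-bound θ.n≤)) (ℕₚ.*-monoˡ-≤ (P ℕ.^ d)
                (subst (ℕ._≤ r₁) (ℕₚ.*-identityˡ (N₁ ℕ.^ t ℕ.* K₀)) (ℕₚ.*-monoˡ-≤ (N₁ ℕ.^ t ℕ.* K₀) (ℕₚ.*-mono-≤ {1} {4} {1} {q} (ℕ.s≤s ℕ.z≤n) 1≤q)))))

              c≤S : suc e ℕ.≤ S
              c≤S = ≤S r₂≤k₁ (ℕₚ.≤-trans e-bound (ℕₚ.≤-reflexive (trans (cong (k ℕ.*_) (^-distrib N₁ P d)) (sym (ℕₚ.*-assoc k (N₁ ℕ.^ d) (P ℕ.^ d))))))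

              d≤S : suc c ℕ.≤ S
              d≤S = ≤S r₃≤k₁ (ℕₚ.≤-trans c-bound (ℕₚ.≤-trans
                (ℕₚ.≤-reflexive (trans (cong (2 ℕ.* k ℕ.*_) (^-distrib N₁ P t)) (sym (ℕₚ.*-assoc (2 ℕ.* k) (N₁ ℕ.^ t) (P ℕ.^ t)))))
                (ℕₚ.*-monoʳ-≤ r₃ P^t≤)))

              -- Because L = 2t + 1 is odd, exactly one factor z is left outside the square.
              power : ∀ z k → (z * (k * k)) ^ L ≡ z * (((z * (k * k)) ^ t * k) * ((z * (k * k)) ^ t * k))
              power z k = trans (cong (z * (k * k) *_) (^-+ (z * (k * k)) t t))
                (solve 3 (λ z k p → (z :* (k :* k)) :* (p :* p) := z :* ((p :* k) :* (p :* k))) refl z k ((z * (k * k)) ^ t))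

              -- θ = u − v√D gives 4uv√D = θ̄² − θ², while e c √D = σ̄^L − σ^L = y₀ θ̄² − x₀ θ².
              core : y₀ * (fromℕ 4 * (fromℕ u * fromℕ v)) - fromℕ (suc e) * fromℕ (suc c) ≡ - (fromℕ 2 * fromℤ b₀) * (θ * θ)
              core = *-cancelˡ √D≢0 (begin
                √D * (y₀ * (fromℕ 4 * (fromℕ u * fromℕ v)) - fromℕ (suc e) * fromℕ (suc c))
                  ≡⟨ solve 6 (λ w y u v e c → w :* (y :* (con (pos 4) :* (u :* v)) :- e :* c)
                       := y :* ((u :+ v :* w) :* (u :+ v :* w) :- (u :- v :* w) :* (u :- v :* w)) :- e :* (c :* w)) refl √D y₀ (fromℕ u) (fromℕ v) (fromℕ (suc e)) (fromℕ (suc c)) ⟩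
                y₀ * ((fromℕ u + fromℕ v * √D) * (fromℕ u + fromℕ v * √D) - (fromℕ u - fromℕ v * √D) * (fromℕ u - fromℕ v * √D)) - fromℕ (suc e) * (fromℕ (suc c) * √D)
                  ≡⟨ cong₂ _-_ (cong₂ (λ a b → y₀ * (a * a - b * b)) (sym θ.x̄≡) (sym θ.x≡)) (trans (cong₂ _*_ (sym E≡) (sym C≡)) (product (small⇒nondeg σ-small))) ⟩
                y₀ * (θ̄ * θ̄ - θ * θ) - (σ̄ ^ L - σ ^ L)
                  ≡⟨ cong₂ (λ a b → y₀ * (θ̄ * θ̄ - θ * θ) - (a - b)) (power y₀ κ̄) (power x₀ κ) ⟩
                y₀ * (θ̄ * θ̄ - θ * θ) - (y₀ * (θ̄ * θ̄) - x₀ * (θ * θ))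
                  ≡⟨ solve 5 (λ a b w s t → (a :+ b :* w) :* (s :- t) :- ((a :+ b :* w) :* s :- (a :- b :* w) :* t) := w :* (:- (con (pos 2) :* b) :* t)) refl (fromℤ a₀) (fromℤ b₀) √D (θ̄ * θ̄) (θ * θ) ⟩
                √D * (- (fromℕ 2 * fromℤ b₀) * (θ * θ)) ∎)
                where open ≡-Reasoning

              gap₀ : Carrier
              gap₀ = - (fromℕ 2 * fromℤ b₀) * (θ * θ)

              gap₀≡ : gap₀ ≡ α * fromℕ ((4 ℕ.* q ℕ.* u) ℕ.* v) - fromℕ (suc e ℕ.* suc c)
              gap₀≡ = sym (begin
                α * fromℕ ((4 ℕ.* q ℕ.* u) ℕ.* v) - fromℕ (suc e ℕ.* suc c)
                  ≡⟨ cong₂ (λ a b → α * a - b) (trans (fromℕ-* (4 ℕ.* q ℕ.* u) v) (cong (_* fromℕ v) (trans (fromℕ-* (4 ℕ.* q) u) (cong (_* fromℕ u) (fromℕ-* 4 q))))) (fromℕ-* (suc e) (suc c)) ⟩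
                α * (fromℕ 4 * fromℕ q * fromℕ u * fromℕ v) - fromℕ (suc e) * fromℕ (suc c)
                  ≡⟨ cong (_- fromℕ (suc e) * fromℕ (suc c)) (trans (solve 4 (λ a q u v → a :* (con (pos 4) :* q :* u :* v) := (q :* a) :* (con (pos 4) :* (u :* v))) refl α (fromℕ q) (fromℕ u) (fromℕ v)) (cong (_* (fromℕ 4 * (fromℕ u * fromℕ v))) α≡)) ⟩
                y₀ * (fromℕ 4 * (fromℕ u * fromℕ v)) - fromℕ (suc e) * fromℕ (suc c) ≡⟨ core ⟩
                gap₀ ∎)
                where open ≡-Reasoning

              gap₀≢0 : gap₀ ≢ 0#
              gap₀≢0 e = *-≢0 (*-≢0 two≢0 (fromℤ-≢0 b₀≢0)) (*-≢0 θ≢0 θ≢0)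
                (trans (solve 2 (λ a b → a :* b := :- ((:- a) :* b)) refl (fromℕ 2 * fromℤ b₀) (θ * θ)) (trans (cong -_ e) (solve 0 (:- con 0ℤ := con 0ℤ) refl)))
                where
                θ≢0 : θ ≢ 0#
                θ≢0 = *-≢0 (^-≢0 t (*-≢0 x₀≢0 (*-≢0 κ≢0 κ≢0))) κ≢0

              -- θ has degree L in κ, so every κ absorbs one factor N and is then bounded by 1.
              θN^L : θ * fromℕ (N ℕ.^ L) ≡ (x₀ * ((fromℕ N * κ) * (fromℕ N * κ))) ^ t * (fromℕ N * κ)
              θN^L = begin
                σ ^ t * κ * fromℕ (N ℕ.^ L) ≡⟨ cong (θ *_) (trans (fromℕ-^ N L) (cong (fromℕ N *_) (^-+ (fromℕ N) t t))) ⟩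
                σ ^ t * κ * (fromℕ N * (fromℕ N ^ t * fromℕ N ^ t)) ≡⟨ solve 4 (λ s k n p → s :* k :* (n :* (p :* p)) := (s :* (p :* p)) :* (n :* k)) refl (σ ^ t) κ (fromℕ N) (fromℕ N ^ t) ⟩
                (σ ^ t * (fromℕ N ^ t * fromℕ N ^ t)) * (fromℕ N * κ) ≡⟨ cong (_* (fromℕ N * κ)) (trans (cong (σ ^ t *_) (sym (^-distrib-* (fromℕ N) (fromℕ N) t))) (sym (^-distrib-* σ (fromℕ N * fromℕ N) t))) ⟩
                (σ * (fromℕ N * fromℕ N)) ^ t * (fromℕ N * κ) ≡⟨ cong (λ z → z ^ t * (fromℕ N * κ)) (solve 3 (λ x k n → (x :* (k :* k)) :* (n :* n) := x :* ((n :* k) :* (n :* k))) refl x₀ κ (fromℕ N)) ⟩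
                (x₀ * ((fromℕ N * κ) * (fromℕ N * κ))) ^ t * (fromℕ N * κ) ∎
                where open ≡-Reasoning

            approximant′ : Σ (Approximant α S) λ A → ∣ Approximant.gap A * fromℕ (N ℕ.^ (L ℕ.+ L)) ∣≤ fromℕ k₂
            approximant′ = record
              { a = 4 ℕ.* q ℕ.* u ; b = v ; c = suc e ; d = suc c
              ; 1≤a = ℕₚ.*-mono-≤ {1} {4 ℕ.* q} {1} {u} (ℕₚ.*-mono-≤ {1} {4} (ℕ.s≤s ℕ.z≤n) 1≤q) (ℕ.s≤s ℕ.z≤n) ; 1≤b = ℕ.s≤s ℕ.z≤n ; 1≤c = ℕ.s≤s ℕ.z≤n ; 1≤d = ℕ.s≤s ℕ.z≤n
              ; a≤S = a≤S ; b≤S = b≤S ; c≤S = c≤S ; d≤S = d≤S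
              ; gap = gap₀ ; gap≡ = gap₀≡ ; gap≢0 = gap₀≢0 }
              , subst₂ ∣_∣≤_ lhs rhs (abs-* (abs-neg (abs-* (abs-refl (fromℕ-nonNeg 2)) (abs-fromℤ b₀))) (abs-* θ-bound θ-bound))
              where
              θ-bound : ∣ θ * fromℕ (N ℕ.^ L) ∣≤ fromℕ (M ℕ.^ t)
              θ-bound = subst₂ ∣_∣≤_ (sym θN^L)
                (trans (*-identityʳ _) (trans (cong (_^ t) (solve 1 (λ m → m :* (con (pos 1) :* con (pos 1)) := m) refl (fromℕ M))) (sym (fromℕ-^ M t))))
                (abs-* (abs-^ t (abs-* (abs-height x₀y₀) (abs-* Nκ≤1 Nκ≤1))) Nκ≤1)
              lhs : - (fromℕ 2 * fromℤ b₀) * ((θ * fromℕ (N ℕ.^ L)) * (θ * fromℕ (N ℕ.^ L))) ≡ gap₀ * fromℕ (N ℕ.^ (L ℕ.+ L))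
              lhs = trans (solve 3 (λ b s n → :- (con (pos 2) :* b) :* ((s :* n) :* (s :* n)) := :- (con (pos 2) :* b) :* (s :* s) :* (n :* n)) refl (fromℤ b₀) θ (fromℕ (N ℕ.^ L)))
                (cong (gap₀ *_) (sym (trans (cong fromℕ (ℕₚ.^-distribˡ-+-* N L L)) (fromℕ-* (N ℕ.^ L) (N ℕ.^ L)))))
              rhs : fromℕ 2 * fromℕ ℤ.∣ b₀ ∣ * (fromℕ (M ℕ.^ t) * fromℕ (M ℕ.^ t)) ≡ fromℕ k₂
              rhs = trans (cong₂ _*_ (sym (fromℕ-* 2 ℤ.∣ b₀ ∣)) (sym (fromℕ-* (M ℕ.^ t) (M ℕ.^ t)))) (sym (fromℕ-* (2 ℕ.* ℤ.∣ b₀ ∣) _))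

        generalApproximable : Approximable α (suc L) (L ℕ.+ L)
        generalApproximable = record
          { k₁ = k₁ ; k₂ = k₂
          ; N₀ = threshold M
          ; approximant = λ N N≥ →
              let 2≤N = 2≤threshold {M} N≥
                  1≤N = ℕₚ.≤-trans (ℕ.s≤s ℕ.z≤n) 2≤N
                  approx = approximation N 1≤N
                  open Approximation approx
                  κ≤1 = *-cancelˡ-abs {κ} {1#} (fromℕ-pos 1) (abs-mono (2κ≤1 2≤N) (≤-trans (fromℕ-mono {1} {2} (ℕ.s≤s ℕ.z≤n)) (≤-reflexive (sym (*-identityʳ _)))))
                  Nκκ≤1 = subst₂ ∣_∣≤_ (*-assoc (fromℕ N) κ κ) (*-identityˡ 1#) (abs-* Nκ≤1 κ≤1)
                  1≤κ̄κ̄ = ≤-trans (≤-reflexive (sym (*-identityˡ 1#))) (*-mono-≤ 0≤1 (proj₁ 0<κ̄) 1≤κ̄ 1≤κ̄)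
                  σ-small = small (*-≢0 x₀≢0 (*-≢0 κ≢0 κ≢0)) (*-pos 0<y₀ (*-pos 0<κ̄ 0<κ̄))
                    (dominates M N (abs-height x₀y₀) (conj-height x₀y₀ x₀≢0 (proj₁ 0<y₀)) N≥ Nκκ≤1 1≤κ̄κ̄)
                  conj-σ = conj-* x₀y₀ (conj-* conj conj)
                  θ-dominated = dominatedBy (conj-* (conj-^ t conj-σ) conj) (*-pos (^-pos t (Small.0<y σ-small)) 0<κ̄)
                    (subst (∣_∣≤ (y₀ * (κ̄ * κ̄)) ^ t * κ̄) (solve 2 (λ s k → s :* (con (pos 2) :* k) := con (pos 2) :* (s :* k)) refl ((x₀ * (κ * κ)) ^ t) κ)
                      (abs-* (abs-^ t (small⇒abs σ-small)) (abs-mono (2κ≤1 2≤N) 1≤κ̄)))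
                  eE = E-integral conj-σ σ-small
                  cC = C-integral conj-σ σ-small
              in approximant′ N 1≤N approx σ-small θ-dominated (proj₁ eE) (proj₁ cC) (trans (proj₂ eE) (*-identityʳ _)) (proj₂ cC) }

  -- Counting eigenvalues

  module Spectrum
    (isNonNeg : Carrier → Bool) (sound : ∀ x → T (isNonNeg x) → NonNeg x) (complete : ∀ x → NonNeg x → T (isNonNeg x))
    (α : Carrier) (0<α : 0# < α)
    (injective : ∀ m n m′ n′ → α * fromℕ (m ℕ.* m) + fromℕ (n ℕ.* n) ≡ α * fromℕ (m′ ℕ.* m′) + fromℕ (n′ ℕ.* n′) → m ≡ m′ × n ≡ n′)
    (c₀ : ℕ) (α+1≤c₀ : α + 1# ≤ fromℕ c₀) (1≤c₀α : 1# ≤ fromℕ c₀ * α) where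

    eigenvalue : ℕ → ℕ → Carrier
    eigenvalue m n = α * fromℕ (m ℕ.* m) + fromℕ (n ℕ.* n)

    _≤?_ : ∀ x y → Dec (x ≤ y)
    x ≤? y = map′ (λ t → fromDiff (sound (y - x) t)) (λ p → complete (y - x) (diff p)) (T? (isNonNeg (y - x)))

    indicator : Carrier → ℕ → ℕ → ℕ
    indicator μ m n = if isNonNeg (μ - eigenvalue m n) then 1 else 0

    private
      if-T : ∀ b → T b → (if b then 1 else 0) ≡ 1
      if-T true _ = refl
      if-¬T : ∀ b → ¬ T b → (if b then 1 else 0) ≡ 0
      if-¬T true p = ⊥-elim (p tt)
      if-¬T false _ = refl
      if-≤1 : ∀ b → (if b then 1 else 0) ℕ.≤ 1
      if-≤1 true = ℕₚ.≤-refl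
      if-≤1 false = ℕ.z≤n

    indicator-1 : ∀ {μ m n} → eigenvalue m n ≤ μ → indicator μ m n ≡ 1
    indicator-1 {μ} {m} {n} p = if-T _ (complete (μ - eigenvalue m n) (diff p))

    indicator-0 : ∀ {μ m n} → ¬ (eigenvalue m n ≤ μ) → indicator μ m n ≡ 0
    indicator-0 {μ} {m} {n} p = if-¬T _ (λ t → p (fromDiff (sound (μ - eigenvalue m n) t)))

    count : Carrier → ℕ → ℕ
    count μ B = sumBox (indicator μ) B B

    count-≤ : ∀ μ B → count μ B ℕ.≤ B ℕ.* B
    count-≤ μ B = sumBox-≤ B B (λ m n → if-≤1 (isNonNeg (μ - eigenvalue m n)))

    Box : Carrier → ℕ → Set
    Box μ B = ∀ m n → 1 ℕ.≤ m → 1 ℕ.≤ n → eigenvalue m n ≤ μ → m ℕ.≤ B × n ℕ.≤ B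

    record Lambda (i : ℕ) (μ : Carrier) : Set where
      field
        m n : ℕ
        1≤m : 1 ℕ.≤ m
        1≤n : 1 ℕ.≤ n
        μ≡ : eigenvalue m n ≡ μ
        B : ℕ
        box : Box μ B
        count≡ : count μ B ≡ i

    record ConsecutiveGap (N : ℕ) (G : Carrier) : Set where
      field
        i : ℕ
        1≤i : 1 ℕ.≤ i
        i<N : i ℕ.< N
        μ μ′ : Carrier
        λᵢ : Lambda i μ
        λᵢ₊₁ : Lambda (suc i) μ′
        0≤gap : 0# ≤ μ′ - μ
        gap≤ : μ′ - μ ≤ G

    square≤c₀α*square : ∀ {m} → fromℕ (m ℕ.* m) ≤ fromℕ c₀ * (α * fromℕ (m ℕ.* m))
    square≤c₀α*square {m} = ≤-trans (≤-reflexive (sym (*-identityˡ _))) (≤-trans (*-monoʳ-≤ _ (fromℕ-nonNeg (m ℕ.* m)) 1≤c₀α) (≤-reflexive (*-assoc _ _ _)))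

    1≤c₀ : 1 ℕ.≤ c₀
    1≤c₀ = fromℕ-cancel (≤-trans (x≤y+x (proj₁ 0<α)) α+1≤c₀)

    square-cancel : ∀ {m n} → m ℕ.* m ℕ.≤ n ℕ.* n → m ℕ.≤ n
    square-cancel {m} {n} p with m ℕ.≤? n
    ... | yes q = q
    ... | no q = ⊥-elim (ℕₚ.<⇒≱ (ℕₚ.*-mono-< (ℕₚ.≰⇒> q) (ℕₚ.≰⇒> q)) p)

    -- The constant c₀ bounds both α + 1 and 1/α: an eigenvalue below this one is at most c₀S²,
    -- whence n′² ≤ c₀S² and m′² ≤ c₀²S².
    box-bound : ∀ m n S → m ℕ.≤ S → n ℕ.≤ S → Box (eigenvalue m n) (c₀ ℕ.* S)
    box-bound m n S m≤S n≤S m′ n′ _ _ p = square-cancel (fromℕ-cancel m′²≤) , square-cancel (fromℕ-cancel n′²≤)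
      where
      open ≤-Reasoning
      S² = fromℕ (S ℕ.* S)
      ev≤ : eigenvalue m′ n′ ≤ fromℕ c₀ * S²
      ev≤ = begin
        eigenvalue m′ n′ ≤⟨ p ⟩
        α * fromℕ (m ℕ.* m) + fromℕ (n ℕ.* n) ≤⟨ +-mono-≤ (*-monoˡ-≤ α (proj₁ 0<α) (fromℕ-mono (ℕₚ.*-mono-≤ m≤S m≤S))) (fromℕ-mono (ℕₚ.*-mono-≤ n≤S n≤S)) ⟩
        α * S² + S² ≡⟨ solve 2 (λ a s → a :* s :+ s := (a :+ con (pos 1)) :* s) refl α S² ⟩
        (α + 1#) * S² ≤⟨ *-monoʳ-≤ S² (fromℕ-nonNeg (S ℕ.* S)) α+1≤c₀ ⟩
        fromℕ c₀ * S² ∎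
      B²≡ : fromℕ c₀ * (fromℕ c₀ * S²) ≡ fromℕ ((c₀ ℕ.* S) ℕ.* (c₀ ℕ.* S))
      B²≡ = trans (cong (fromℕ c₀ *_) (sym (fromℕ-* c₀ (S ℕ.* S)))) (trans (sym (fromℕ-* c₀ _))
        (cong fromℕ (ℕₛ.solve 2 (λ c s → c ℕₛ.:* (c ℕₛ.:* (s ℕₛ.:* s)) ℕₛ.:= (c ℕₛ.:* s) ℕₛ.:* (c ℕₛ.:* s)) refl c₀ S)))
      0≤αm² : 0# ≤ α * fromℕ (m′ ℕ.* m′)
      0≤αm² = *-nonNeg (proj₁ 0<α) (fromℕ-nonNeg (m′ ℕ.* m′))
      m′²≤ : fromℕ (m′ ℕ.* m′) ≤ fromℕ ((c₀ ℕ.* S) ℕ.* (c₀ ℕ.* S))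
      m′²≤ = begin
        fromℕ (m′ ℕ.* m′) ≤⟨ square≤c₀α*square {m′} ⟩
        fromℕ c₀ * (α * fromℕ (m′ ℕ.* m′)) ≤⟨ *-monoˡ-≤ _ (fromℕ-nonNeg c₀) (≤-trans (≤-trans (x≤y+x (fromℕ-nonNeg (n′ ℕ.* n′))) (≤-reflexive (+-comm _ _))) ev≤) ⟩
        fromℕ c₀ * (fromℕ c₀ * S²) ≡⟨ B²≡ ⟩
        fromℕ ((c₀ ℕ.* S) ℕ.* (c₀ ℕ.* S)) ∎
      n′²≤ : fromℕ (n′ ℕ.* n′) ≤ fromℕ ((c₀ ℕ.* S) ℕ.* (c₀ ℕ.* S))
      n′²≤ = begin
        fromℕ (n′ ℕ.* n′) ≤⟨ ≤-trans (x≤y+x 0≤αm²) ev≤ ⟩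
        fromℕ c₀ * S² ≡⟨ sym (*-identityˡ _) ⟩
        1# * (fromℕ c₀ * S²) ≤⟨ *-monoʳ-≤ _ (*-nonNeg (fromℕ-nonNeg c₀) (fromℕ-nonNeg (S ℕ.* S))) (fromℕ-mono {1} {c₀} 1≤c₀) ⟩
        fromℕ c₀ * (fromℕ c₀ * S²) ≡⟨ B²≡ ⟩
        fromℕ ((c₀ ℕ.* S) ℕ.* (c₀ ℕ.* S)) ∎

    module _ (m₁ n₁ : ℕ) (1≤m₁ : 1 ℕ.≤ m₁) (1≤n₁ : 1 ℕ.≤ n₁) (B : ℕ) (box : Box (eigenvalue m₁ n₁) B) where
      private
        μ₁ = eigenvalue m₁ n₁
        m₁≤B = proj₁ (box m₁ n₁ 1≤m₁ 1≤n₁ ≤-refl)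
        n₁≤B = proj₂ (box m₁ n₁ 1≤m₁ 1≤n₁ ≤-refl)

      -- Both counts run over the same box, where the indicators differ by the Kronecker delta of
      -- (m₁, n₁).
      count-suc : ∀ μ → μ < μ₁ → (∀ m n → 1 ℕ.≤ m → 1 ℕ.≤ n → eigenvalue m n ≤ μ₁ → (m ≡ m₁ × n ≡ n₁) ⊎ eigenvalue m n ≤ μ) →
        count μ₁ B ≡ suc (count μ B)
      count-suc μ μ<μ₁ next = trans (sumBox-+ {indicator μ₁} {indicator μ} {δ m₁ n₁} B B pointwise)
        (trans (cong (count μ B ℕ.+_) (sumBox-δ m₁ n₁ B B 1≤m₁ m₁≤B 1≤n₁ n₁≤B)) (ℕₚ.+-comm (count μ B) 1))
        where
        pointwise : ∀ m n → 1 ℕ.≤ m → 1 ℕ.≤ n → indicator μ₁ m n ≡ indicator μ m n ℕ.+ δ m₁ n₁ m n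
        pointwise m n 1≤m 1≤n with (m ℕ.≟ m₁) ×-dec (n ℕ.≟ n₁)
        ... | yes (refl , refl) = trans (indicator-1 {μ₁} {m} {n} ≤-refl) (sym (cong (ℕ._+ 1) (indicator-0 {μ} {m} {n} (<⇒≱ μ<μ₁))))
        ... | no ne with eigenvalue m n ≤? μ
        ...   | yes p = trans (indicator-1 {μ₁} {m} {n} (≤-trans p (proj₁ μ<μ₁))) (sym (cong (ℕ._+ 0) (indicator-1 {μ} {m} {n} p)))
        ...   | no p = trans (indicator-0 {μ₁} {m} {n} (λ q → [ ne , p ]′ (next m n 1≤m 1≤n q))) (sym (cong (ℕ._+ 0) (indicator-0 {μ} {m} {n} p)))

      consecutive : ∀ m₀ n₀ → 1 ℕ.≤ m₀ → 1 ℕ.≤ n₀ → eigenvalue m₀ n₀ < μ₁ →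
        (∀ m n → 1 ℕ.≤ m → 1 ℕ.≤ n → eigenvalue m n ≤ μ₁ → (m ≡ m₁ × n ≡ n₁) ⊎ eigenvalue m n ≤ eigenvalue m₀ n₀) →
        ∀ G → μ₁ - eigenvalue m₀ n₀ ≤ G → ∀ N → count μ₁ B ℕ.≤ N → ConsecutiveGap N G
      consecutive m₀ n₀ 1≤m₀ 1≤n₀ μ₀<μ₁ next G gap≤G N count≤N = record
        { i = count μ₀ B
        ; 1≤i = subst (ℕ._≤ count μ₀ B) (indicator-1 {μ₀} {m₀} {n₀} ≤-refl) (sumBox-≥ m₀ n₀ B B 1≤m₀ (proj₁ in-box) 1≤n₀ (proj₂ in-box))
        ; i<N = ℕₚ.≤-trans (ℕₚ.≤-reflexive (sym count≡suc)) count≤N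
        ; μ = μ₀ ; μ′ = μ₁
        ; λᵢ = record { m = m₀ ; n = n₀ ; 1≤m = 1≤m₀ ; 1≤n = 1≤n₀ ; μ≡ = refl ; B = B ; box = λ m n p q r → box m n p q (≤-trans r (proj₁ μ₀<μ₁)) ; count≡ = refl }
        ; λᵢ₊₁ = record { m = m₁ ; n = n₁ ; 1≤m = 1≤m₁ ; 1≤n = 1≤n₁ ; μ≡ = refl ; B = B ; box = box ; count≡ = count≡suc }
        ; 0≤gap = nonNeg⇒0≤ (diff (proj₁ μ₀<μ₁)) ; gap≤ = gap≤G }
        where
        μ₀ = eigenvalue m₀ n₀
        in-box = box m₀ n₀ 1≤m₀ 1≤n₀ (proj₁ μ₀<μ₁)
        count≡suc : count μ₁ B ≡ suc (count μ₀ B)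
        count≡suc = count-suc μ₀ μ₀<μ₁ next

      Below : ℕ × ℕ → Set
      Below (m , n) = 1 ℕ.≤ m × 1 ℕ.≤ n × ¬ (μ₁ ≤ eigenvalue m n)

      below? : ∀ p → Dec (Below p)
      below? (m , n) = (1 ℕ.≤? m) ×-dec ((1 ℕ.≤? n) ×-dec (¬? (μ₁ ≤? eigenvalue m n)))

      ev : ℕ × ℕ → Carrier
      ev (m , n) = eigenvalue m n

      maximum : ∀ p → Below p → (ps : List (ℕ × ℕ)) → ∃ λ q → Below q × ev p ≤ ev q × All (λ r → Below r → ev r ≤ ev q) ps
      maximum p p-below [] = p , p-below , ≤-refl , []
      maximum p p-below (r ∷ ps) = step (maximum p p-below ps) (below? r)
        where
        step : (∃ λ q → Below q × ev p ≤ ev q × All (λ r → Below r → ev r ≤ ev q) ps) → Dec (Below r) →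
          ∃ λ q → Below q × ev p ≤ ev q × All (λ r → Below r → ev r ≤ ev q) (r ∷ ps)
        step (q , q-below , p≤q , max) (no r-not) = q , q-below , p≤q , (λ b → ⊥-elim (r-not b)) ∷ max
        step (q , q-below , p≤q , max) (yes r-below) with ≤-total (ev r) (ev q)
        ... | inj₁ r≤q = q , q-below , p≤q , (λ _ → r≤q) ∷ max
        ... | inj₂ q≤r = r , r-below , ≤-trans p≤q q≤r , (λ _ → ≤-refl) ∷ All.map (λ f b → ≤-trans (f b) q≤r) max

      -- The given smaller eigenvalue need not be the predecessor of μ₁. The largest one below μ₁ in
      -- the finite box is, and replacing the given one by it only shrinks the gap. The index of μ₁
      -- is at most the number B² of points of the box.
      gap-below : ∀ m₀ n₀ → 1 ℕ.≤ m₀ → 1 ℕ.≤ n₀ → eigenvalue m₀ n₀ < μ₁ →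
        ∀ G → μ₁ - eigenvalue m₀ n₀ ≤ G → ∀ N → B ℕ.* B ℕ.≤ N → ConsecutiveGap N G
      gap-below m₀ n₀ 1≤m₀ 1≤n₀ μ₀<μ₁ G gap≤G N B²≤N =
        result (maximum (m₀ , n₀) (1≤m₀ , 1≤n₀ , <⇒≱ μ₀<μ₁) (cartesianProduct (upTo (suc B)) (upTo (suc B))))
        where
        result : (∃ λ q → Below q × eigenvalue m₀ n₀ ≤ ev q × All (λ r → Below r → ev r ≤ ev q) (cartesianProduct (upTo (suc B)) (upTo (suc B)))) → ConsecutiveGap N G
        result ((m , n) , (1≤m , 1≤n , μ₁≰) , μ₀≤μ , max) = consecutive m n 1≤m 1≤n (≰⇒> μ₁≰) next G
          (≤-trans (+-monoʳ-≤ μ₁ (neg-mono-≤ μ₀≤μ)) gap≤G) N (ℕₚ.≤-trans (count-≤ μ₁ B) B²≤N)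
          where
          next : ∀ m′ n′ → 1 ℕ.≤ m′ → 1 ℕ.≤ n′ → eigenvalue m′ n′ ≤ μ₁ → (m′ ≡ m₁ × n′ ≡ n₁) ⊎ eigenvalue m′ n′ ≤ eigenvalue m n
          next m′ n′ p q r with μ₁ ≤? eigenvalue m′ n′
          ... | yes s = inj₁ (injective m′ n′ m₁ n₁ (≤-antisym r s))
          ... | no s = inj₂ (All.lookup max (∈-cartesianProduct⁺ (∈-upTo⁺ (ℕ.s≤s (proj₁ in-box))) (∈-upTo⁺ (ℕ.s≤s (proj₂ in-box)))) (p , q , s))
            where in-box = box m′ n′ p q r

  -- From approximants to eigenvalue gaps.

  module Gaps
    (isNonNeg : Carrier → Bool) (sound : ∀ x → T (isNonNeg x) → NonNeg x) (complete : ∀ x → NonNeg x → T (isNonNeg x))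
    (α : Carrier) (0<α : 0# < α)
    (injective : ∀ m n m′ n′ → α * fromℕ (m ℕ.* m) + fromℕ (n ℕ.* n) ≡ α * fromℕ (m′ ℕ.* m′) + fromℕ (n′ ℕ.* n′) → m ≡ m′ × n ≡ n′)
    (c₀ : ℕ) (α+1≤c₀ : α + 1# ≤ fromℕ c₀) (1≤c₀α : 1# ≤ fromℕ c₀ * α) where
    open RationalApproximation
    open Spectrum isNonNeg sound complete α 0<α injective c₀ α+1≤c₀ 1≤c₀α

    boxSide : ℕ → ℕ
    boxSide S = c₀ ℕ.* (4 ℕ.* S)

    -- With 8ab = m² - m₀² and 8cd = n² - n₀², the eigenvalues at (m, n₀) and (m₀, n) differ by 8 (α
    -- ab - cd). The sign of the difference decides which of them is the upper one.
    approximant⇒gap : ∀ {S} (A : Approximant α S) → ∀ G → ∣ fromℕ 8 * Approximant.gap A ∣≤ G →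
      ∀ N → boxSide S ℕ.* boxSide S ℕ.≤ N → ConsecutiveGap N G
    approximant⇒gap {S} A G (gap≤ , -gap≤) N N≥ = cases (≤-total ν μ)
      where
      open Approximant A
      module AB = SquareDifference (8ab-squareDifference a b S 1≤a 1≤b a≤S b≤S)
      module CD = SquareDifference (8ab-squareDifference c d S 1≤c 1≤d c≤S d≤S)
      μ = eigenvalue AB.m CD.m₀
      ν = eigenvalue AB.m₀ CD.m
      square : ∀ {m m₀ k} → m ℕ.* m ≡ m₀ ℕ.* m₀ ℕ.+ 8 ℕ.* k → fromℕ (m ℕ.* m) ≡ fromℕ (m₀ ℕ.* m₀) + fromℕ 8 * fromℕ k
      square {m} {m₀} {k} e = trans (cong fromℕ e) (trans (fromℕ-+ (m₀ ℕ.* m₀) (8 ℕ.* k)) (cong (fromℕ (m₀ ℕ.* m₀) +_) (fromℕ-* 8 k)))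
      μ-ν : μ - ν ≡ fromℕ 8 * gap
      μ-ν = begin
        (α * fromℕ (AB.m ℕ.* AB.m) + n₀²) - (α * m₀² + fromℕ (CD.m ℕ.* CD.m)) ≡⟨ cong₂ (λ x y → (α * x + n₀²) - (α * m₀² + y)) (square {AB.m} {AB.m₀} {a ℕ.* b} AB.m²≡) (square {CD.m} {CD.m₀} {c ℕ.* d} CD.m²≡) ⟩
        (α * (m₀² + fromℕ 8 * fromℕ (a ℕ.* b)) + n₀²) - (α * m₀² + (n₀² + fromℕ 8 * fromℕ (c ℕ.* d)))
          ≡⟨ solve 5 (λ α m n x y → (α :* (m :+ con (pos 8) :* x) :+ n) :- (α :* m :+ (n :+ con (pos 8) :* y)) := con (pos 8) :* (α :* x :- y)) refl α m₀² n₀² (fromℕ (a ℕ.* b)) (fromℕ (c ℕ.* d)) ⟩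
        fromℕ 8 * (α * fromℕ (a ℕ.* b) - fromℕ (c ℕ.* d)) ≡⟨ cong (fromℕ 8 *_) (sym gap≡) ⟩
        fromℕ 8 * gap ∎
        where
        open ≡-Reasoning
        m₀² = fromℕ (AB.m₀ ℕ.* AB.m₀)
        n₀² = fromℕ (CD.m₀ ℕ.* CD.m₀)
      8gap≢0 : fromℕ 8 * gap ≢ 0#
      8gap≢0 = *-≢0 (λ e → proj₂ (fromℕ-pos 7) (sym e)) gap≢0
      ν≢μ : ν ≢ μ
      ν≢μ e = 8gap≢0 (trans (sym μ-ν) (trans (cong (λ z → μ - z) e) (-‿inverseʳ μ)))
      cases : ν ≤ μ ⊎ μ ≤ ν → ConsecutiveGap N G
      cases (inj₁ p) = gap-below AB.m CD.m₀ AB.1≤m CD.1≤m₀ (boxSide S) (box-bound AB.m CD.m₀ (4 ℕ.* S) AB.m≤ CD.m₀≤)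
        AB.m₀ CD.m AB.1≤m₀ CD.1≤m (p , ν≢μ) G (subst (_≤ G) (sym μ-ν) gap≤) N N≥
      cases (inj₂ p) = gap-below AB.m₀ CD.m AB.1≤m₀ CD.1≤m (boxSide S) (box-bound AB.m₀ CD.m (4 ℕ.* S) AB.m₀≤ CD.m≤)
        AB.m CD.m₀ AB.1≤m CD.1≤m₀ (p , λ e → ν≢μ (sym e)) G
        (subst (_≤ G) (trans (cong -_ (sym μ-ν)) (solve 2 (λ x y → :- (x :- y) := y :- x) refl μ ν)) -gap≤) N N≥

    eigenvalue-mono : ∀ {m m′ n n′} → m ℕ.≤ m′ → n ℕ.≤ n′ → eigenvalue m n ≤ eigenvalue m′ n′
    eigenvalue-mono p q = +-mono-≤ (*-monoˡ-≤ α (proj₁ 0<α) (fromℕ-mono (ℕₚ.*-mono-≤ p p))) (fromℕ-mono (ℕₚ.*-mono-≤ q q))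

    -- Covers the N that are too small for an approximant. λ₁ = α + 1, and λ₂ is the smaller of α +
    -- 4 and 4α + 1, so λ₂ - λ₁ ≤ 3.
    second-eigenvalue : ∀ m n → m ℕ.≤ 2 → n ℕ.≤ 2 → 1 ℕ.≤ m → 1 ℕ.≤ n → ¬ (1 ≡ m × 1 ≡ n) →
      eigenvalue m n ≤ eigenvalue 1 2 → eigenvalue m n ≤ eigenvalue 2 1 → ∀ N → 2 ℕ.≤ N → ConsecutiveGap N (fromℕ 3)
    second-eigenvalue m₁ n₁ m₁≤2 n₁≤2 1≤m₁ 1≤n₁ ≢11 p12 p21 N 2≤N =
      consecutive m₁ n₁ 1≤m₁ 1≤n₁ B box 1 1 ℕₚ.≤-refl ℕₚ.≤-refl first< next (fromℕ 3)
        (≤-trans (+-monoˡ-≤ (- eigenvalue 1 1) p12) (≤-reflexive gap≡3)) N (subst (ℕ._≤ N) (sym count≡2) 2≤N)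
      where
      B = c₀ ℕ.* 2
      box = box-bound m₁ n₁ 2 m₁≤2 n₁≤2
      first< : eigenvalue 1 1 < eigenvalue m₁ n₁
      first< = eigenvalue-mono 1≤m₁ 1≤n₁ , λ e → ≢11 (injective 1 1 m₁ n₁ e)
      gap≡3 : eigenvalue 1 2 - eigenvalue 1 1 ≡ fromℕ 3
      gap≡3 = solve 1 (λ α → (α :* con (pos 1) :+ con (pos 4)) :- (α :* con (pos 1) :+ con (pos 1)) := con (pos 3)) refl α
      next : ∀ m n → 1 ℕ.≤ m → 1 ℕ.≤ n → eigenvalue m n ≤ eigenvalue m₁ n₁ → (m ≡ m₁ × n ≡ n₁) ⊎ eigenvalue m n ≤ eigenvalue 1 1
      next (suc zero) (suc zero) _ _ _ = inj₂ ≤-refl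
      next (suc zero) (suc (suc n)) _ _ p = inj₁ (injective 1 (suc (suc n)) m₁ n₁
        (≤-antisym p (≤-trans p12 (eigenvalue-mono {1} {1} {2} {suc (suc n)} ℕₚ.≤-refl (ℕ.s≤s (ℕ.s≤s ℕ.z≤n))))))
      next (suc (suc m)) (suc n) _ _ p = inj₁ (injective (suc (suc m)) (suc n) m₁ n₁
        (≤-antisym p (≤-trans p21 (eigenvalue-mono {2} {suc (suc m)} {1} {suc n} (ℕ.s≤s (ℕ.s≤s ℕ.z≤n)) (ℕ.s≤s ℕ.z≤n)))))
      1≤B : 1 ℕ.≤ B
      1≤B = ℕₚ.*-mono-≤ {1} {c₀} {1} {2} 1≤c₀ (ℕ.s≤s ℕ.z≤n)
      count-first : count (eigenvalue 1 1) B ≡ 1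
      count-first = trans (sumBox-+ {indicator (eigenvalue 1 1)} {δ 1 1} {λ _ _ → 0} B B pointwise)
        (cong₂ ℕ._+_ (sumBox-δ 1 1 B B ℕₚ.≤-refl 1≤B ℕₚ.≤-refl 1≤B) (sumBox-zero B B))
        where
        only-first : ∀ m n → 1 ℕ.≤ m → 1 ℕ.≤ n → ¬ (m ≡ 1 × n ≡ 1) → ¬ (eigenvalue m n ≤ eigenvalue 1 1)
        only-first m n 1≤m 1≤n ne p = ne (injective m n 1 1 (≤-antisym p (eigenvalue-mono 1≤m 1≤n)))
        pointwise : ∀ m n → 1 ℕ.≤ m → 1 ℕ.≤ n → indicator (eigenvalue 1 1) m n ≡ δ 1 1 m n ℕ.+ 0
        pointwise m n 1≤m 1≤n with m ℕ.≟ 1 | n ℕ.≟ 1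
        ... | yes refl | yes refl = indicator-1 {eigenvalue 1 1} {1} {1} ≤-refl
        ... | yes _ | no q = indicator-0 {eigenvalue 1 1} {m} {n} (only-first m n 1≤m 1≤n (λ e → q (proj₂ e)))
        ... | no q | yes _ = indicator-0 {eigenvalue 1 1} {m} {n} (only-first m n 1≤m 1≤n (λ e → q (proj₁ e)))
        ... | no q | no _ = indicator-0 {eigenvalue 1 1} {m} {n} (only-first m n 1≤m 1≤n (λ e → q (proj₁ e)))
      count≡2 : count (eigenvalue m₁ n₁) B ≡ 2
      count≡2 = trans (count-suc m₁ n₁ 1≤m₁ 1≤n₁ B box (eigenvalue 1 1) first< next) (cong suc count-first)

    first-gap : ∀ N → 2 ℕ.≤ N → ConsecutiveGap N (fromℕ 3)
    first-gap with ≤-total (eigenvalue 1 2) (eigenvalue 2 1)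
    ... | inj₁ p = second-eigenvalue 1 2 (ℕ.s≤s ℕ.z≤n) ℕₚ.≤-refl ℕₚ.≤-refl (ℕ.s≤s ℕ.z≤n) (λ ()) ≤-refl p
    ... | inj₂ p = second-eigenvalue 2 1 ℕₚ.≤-refl (ℕ.s≤s ℕ.z≤n) (ℕ.s≤s ℕ.z≤n) ℕₚ.≤-refl (λ ()) p ≤-refl

    private
      bounding : ∀ x → ∃ λ a → ∣ x ∣≤ a × (∀ z M → ∣ x * z ∣≤ M → a * z ≤ M)
      bounding x with ≤-total 0# x
      ... | inj₁ p = x , abs-refl p , λ z M q → proj₁ q
      ... | inj₂ p = - x , (≤-trans p (0≤-neg p) , ≤-refl) , λ z M q → ≤-trans (≤-reflexive (solve 2 (λ x z → (:- x) :* z := :- (x :* z)) refl x z)) (proj₂ q)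

    ScaledGap : (S Y k : ℕ) → Set
    ScaledGap S Y k = ∃ λ G → 0# ≤ G × G * fromℕ Y ≤ fromℕ (8 ℕ.* k) × (∀ N → boxSide S ℕ.* boxSide S ℕ.≤ N → ConsecutiveGap N G)

    scaled-gap : ∀ {S} (A : Approximant α S) Y k → ∣ Approximant.gap A * fromℕ Y ∣≤ fromℕ k → ScaledGap S Y k
    scaled-gap A Y k bound with bounding (fromℕ 8 * Approximant.gap A)
    ... | G , 8gap≤G , G≤ = G , abs-nonNeg 8gap≤G
      , G≤ (fromℕ Y) (fromℕ (8 ℕ.* k)) (subst₂ ∣_∣≤_ (sym (*-assoc _ _ _)) (sym (fromℕ-* 8 k)) (abs-* (abs-refl (fromℕ-nonNeg 8)) bound))
      , approximant⇒gap A G 8gap≤G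

    boxSide² : ∀ k Y → boxSide (k ℕ.* Y) ℕ.* boxSide (k ℕ.* Y) ≡ (boxSide k ℕ.* boxSide k) ℕ.* (Y ℕ.* Y)
    boxSide² k Y = ℕₛ.solve 3 (λ c k y → (c ℕₛ.:* (ℕₛ.con 4 ℕₛ.:* (k ℕₛ.:* y))) ℕₛ.:* (c ℕₛ.:* (ℕₛ.con 4 ℕₛ.:* (k ℕₛ.:* y)))
        ℕₛ.:= ((c ℕₛ.:* (ℕₛ.con 4 ℕₛ.:* k)) ℕₛ.:* (c ℕₛ.:* (ℕₛ.con 4 ℕₛ.:* k))) ℕₛ.:* (y ℕₛ.:* y)) refl c₀ k Y

    -- The inequality is N G ≤ C N^(p/q), raised to the power q to avoid roots; ε is p/q.
    GapBeyond : (M C p q : ℕ) → Set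
    GapBeyond M C p q = ∃ λ N → M ℕ.≤ N × ∃ λ G → ConsecutiveGap N G × 0# ≤ G × (fromℕ N * G) ^ q ≤ fromℕ C ^ q * fromℕ N ^ p

    -- At scale X take N = c Y² with Y = X^(L + 1), enough for the box. As G X^(2L) is bounded, N G
    -- ≤ C X², and X^(2q) ≤ X^(2L + 2) = Y² ≤ N ≤ N^p.
    infinitely-often : ∀ {L} → Approximable α (suc L) (L ℕ.+ L) → ∀ p q → 1 ℕ.≤ p → q ℕ.≤ suc L →
      ∃ λ C → 1 ℕ.≤ C × (∀ M → GapBeyond M C p q)
    infinitely-often {L} A p q 1≤p q≤ = C , ℕ.s≤s ℕ.z≤n , choose
      where
      open Approximable A
      e = suc L
      c C : ℕ
      c = suc (boxSide k₁ ℕ.* boxSide k₁)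
      C = suc (c ℕ.* (8 ℕ.* k₂))
      choose : ∀ M → GapBeyond M C p q
      choose M = result (scaled-gap (proj₁ A′) (Z ℕ.* Z) k₂ (subst (λ z → ∣ Approximant.gap (proj₁ A′) * fromℕ z ∣≤ fromℕ k₂) (ℕₚ.^-distribˡ-+-* X L L) (proj₂ A′)))
        where
        X Z Y N : ℕ
        -- Past the threshold of the approximation, and large enough for N ≥ M.
        X = suc (N₀ ℕ.+ M)
        Z = X ℕ.^ L
        Y = X ℕ.* Z
        N = c ℕ.* (Y ℕ.* Y)
        A′ : Σ (Approximant α (k₁ ℕ.* Y)) λ A → ∣ Approximant.gap A * fromℕ (X ℕ.^ (L ℕ.+ L)) ∣≤ fromℕ k₂
        A′ = approximant X (ℕₚ.≤-trans (ℕₚ.m≤m+n N₀ M) (ℕₚ.n≤1+n _))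
        1≤Z : 1 ℕ.≤ Z
        1≤Z = ℕₚ.m^n>0 X L
        X≤Y : X ℕ.≤ Y
        X≤Y = subst (ℕ._≤ Y) (ℕₚ.*-identityʳ X) (ℕₚ.*-monoʳ-≤ X 1≤Z)
        Y²≤N : Y ℕ.* Y ℕ.≤ N
        Y²≤N = ℕₚ.m≤m+n (Y ℕ.* Y) _
        1≤Y : 1 ℕ.≤ Y
        1≤Y = ℕₚ.≤-trans (ℕ.s≤s ℕ.z≤n) X≤Y
        Y≤Y² : Y ℕ.≤ Y ℕ.* Y
        Y≤Y² = subst (ℕ._≤ Y ℕ.* Y) (ℕₚ.*-identityʳ Y) (ℕₚ.*-monoʳ-≤ Y 1≤Y)
        M≤N : M ℕ.≤ N
        M≤N = ℕₚ.≤-trans (ℕₚ.≤-trans (ℕₚ.m≤n+m M (suc N₀)) X≤Y) (ℕₚ.≤-trans Y≤Y² Y²≤N)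
        box≤N : boxSide (k₁ ℕ.* Y) ℕ.* boxSide (k₁ ℕ.* Y) ℕ.≤ N
        box≤N = ℕₚ.≤-trans (ℕₚ.≤-reflexive (boxSide² k₁ Y)) (ℕₚ.*-monoˡ-≤ (Y ℕ.* Y) (ℕₚ.n≤1+n (boxSide k₁ ℕ.* boxSide k₁)))
        x = fromℕ X
        X^2q≤N^p : (x * x) ^ q ≤ fromℕ N ^ p
        X^2q≤N^p = ≤-trans (≤-reflexive (trans (cong (_^ q) (sym (fromℕ-* X X))) (sym (fromℕ-^ (X ℕ.* X) q)))) (≤-trans (fromℕ-mono (begin
          (X ℕ.* X) ℕ.^ q ≤⟨ ℕₚ.^-monoʳ-≤ (X ℕ.* X) q≤ ⟩
          (X ℕ.* X) ℕ.^ e ≡⟨ square-^ e ⟩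
          Y ℕ.* Y ≤⟨ Y²≤N ⟩
          N ≡⟨ sym (ℕₚ.^-identityʳ N) ⟩
          N ℕ.^ 1 ≤⟨ ℕₚ.^-monoʳ-≤ N {{ℕ.>-nonZero (ℕₚ.≤-trans 1≤Y (ℕₚ.≤-trans Y≤Y² Y²≤N))}} 1≤p ⟩
          N ℕ.^ p ∎)) (≤-reflexive (fromℕ-^ N p)))
          where
          open ℕₚ.≤-Reasoning
          square-^ : ∀ e → (X ℕ.* X) ℕ.^ e ≡ X ℕ.^ e ℕ.* X ℕ.^ e
          square-^ zero = refl
          square-^ (suc e) = trans (cong (X ℕ.* X ℕ.*_) (square-^ e)) (ℕₚ.[m*n]*[o*p]≡[m*o]*[n*p] X X (X ℕ.^ e) (X ℕ.^ e))
        result : ScaledGap (k₁ ℕ.* Y) (Z ℕ.* Z) k₂ → GapBeyond M C p q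
        result (G , 0≤G , G≤ , gaps) = N , M≤N , G , gaps N box≤N , 0≤G , (begin
          (fromℕ N * G) ^ q ≤⟨ ^-mono-≤ q (*-nonNeg (fromℕ-nonNeg N) 0≤G) NG≤ ⟩
          (fromℕ C * (x * x)) ^ q ≡⟨ ^-distrib-* (fromℕ C) (x * x) q ⟩
          fromℕ C ^ q * (x * x) ^ q ≤⟨ *-monoˡ-≤ _ (^-nonNeg q (fromℕ-nonNeg C)) X^2q≤N^p ⟩
          fromℕ C ^ q * fromℕ N ^ p ∎)
          where
          open ≤-Reasoning
          z = fromℕ Z
          NG≤ : fromℕ N * G ≤ fromℕ C * (x * x)
          NG≤ = begin
            fromℕ N * G ≡⟨ cong (_* G) (trans (fromℕ-* c (Y ℕ.* Y)) (cong (fromℕ c *_) (trans (fromℕ-* Y Y) (cong₂ _*_ (fromℕ-* X Z) (fromℕ-* X Z))))) ⟩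
            (fromℕ c * ((x * z) * (x * z))) * G ≡⟨ solve 4 (λ c x z g → (c :* ((x :* z) :* (x :* z))) :* g := (c :* (g :* (z :* z))) :* (x :* x)) refl (fromℕ c) x z G ⟩
            (fromℕ c * (G * (z * z))) * (x * x) ≡⟨ cong (λ w → (fromℕ c * (G * w)) * (x * x)) (sym (fromℕ-* Z Z)) ⟩
            (fromℕ c * (G * fromℕ (Z ℕ.* Z))) * (x * x) ≤⟨ *-monoʳ-≤ _ (0≤x*x x) (*-monoˡ-≤ _ (fromℕ-nonNeg c) G≤) ⟩
            (fromℕ c * fromℕ (8 ℕ.* k₂)) * (x * x) ≡⟨ cong (_* (x * x)) (sym (fromℕ-* c (8 ℕ.* k₂))) ⟩
            fromℕ (c ℕ.* (8 ℕ.* k₂)) * (x * x) ≤⟨ *-monoʳ-≤ _ (0≤x*x x) (fromℕ-mono {c ℕ.* (8 ℕ.* k₂)} {C} (ℕₚ.n≤1+n _)) ⟩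
            fromℕ C * (x * x) ∎

    -- Given N, the scale is X = ⌊√(N / c)⌋: the box fits because c X² ≤ N, and N < c (X + 1)² ≤ 4c
    -- X² turns the bound on G X² into one on N G. If X does not exceed N₀, then N is bounded and
    -- the first gap suffices.
    always : Approximable α 1 2 → ∃ λ C → 1 ℕ.≤ C × (∀ N → 2 ℕ.≤ N → ∃ λ G → ConsecutiveGap N G × fromℕ N * G ≤ fromℕ C)
    always A = C , ℕ.s≤s ℕ.z≤n , λ N 2≤N → choose N 2≤N (∃-scaledSqrt c (ℕ.s≤s ℕ.z≤n) N)
      where
      open Approximable A
      c C C₁ C₂ : ℕ
      c = suc (boxSide k₁ ℕ.* boxSide k₁)
      C₁ = 4 ℕ.* c ℕ.* (8 ℕ.* k₂)
      C₂ = c ℕ.* (suc N₀ ℕ.* suc N₀) ℕ.* 3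
      C = suc (C₁ ℕ.+ C₂)
      choose : ∀ N → 2 ℕ.≤ N → (∃ λ X → c ℕ.* (X ℕ.* X) ℕ.≤ N × N ℕ.< c ℕ.* (suc X ℕ.* suc X)) → ∃ λ G → ConsecutiveGap N G × fromℕ N * G ≤ fromℕ C
      choose N 2≤N (X , cX²≤N , N<) with suc N₀ ℕ.≤? X
      ... | no X<N₀ = fromℕ 3 , first-gap N 2≤N , ≤-trans (≤-reflexive (sym (fromℕ-* N 3)))
            (fromℕ-mono (ℕₚ.≤-trans (ℕₚ.*-monoˡ-≤ 3 (ℕₚ.≤-trans (ℕₚ.<⇒≤ N<) (ℕₚ.*-monoʳ-≤ c (ℕₚ.*-mono-≤ X≤ X≤)))) (ℕₚ.≤-trans (ℕₚ.m≤n+m C₂ C₁) (ℕₚ.n≤1+n _))))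
        where
        X≤ : suc X ℕ.≤ suc N₀
        X≤ = ℕₚ.≰⇒> X<N₀
      ... | yes N₀<X = result (scaled-gap (proj₁ A′) (X ℕ.^ 2) k₂ (proj₂ A′))
        where
        A′ : Σ (Approximant α (k₁ ℕ.* X ℕ.^ 1)) λ A → ∣ Approximant.gap A * fromℕ (X ℕ.^ 2) ∣≤ fromℕ k₂
        A′ = approximant X (ℕₚ.≤-trans (ℕₚ.n≤1+n N₀) N₀<X)
        1≤X : 1 ℕ.≤ X
        1≤X = ℕₚ.≤-trans (ℕ.s≤s ℕ.z≤n) N₀<X
        box≤N : boxSide (k₁ ℕ.* X ℕ.^ 1) ℕ.* boxSide (k₁ ℕ.* X ℕ.^ 1) ℕ.≤ N
        box≤N = ℕₚ.≤-trans (ℕₚ.≤-reflexive (trans (boxSide² k₁ (X ℕ.^ 1)) (cong (λ z → boxSide k₁ ℕ.* boxSide k₁ ℕ.* (z ℕ.* z)) (ℕₚ.*-identityʳ X))))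
          (ℕₚ.≤-trans (ℕₚ.*-monoˡ-≤ (X ℕ.* X) (ℕₚ.n≤1+n (boxSide k₁ ℕ.* boxSide k₁))) cX²≤N)
        N≤ : N ℕ.≤ 4 ℕ.* c ℕ.* (X ℕ.^ 2)
        N≤ = ℕₚ.≤-trans (ℕₚ.<⇒≤ N<) (ℕₚ.≤-trans (ℕₚ.*-monoʳ-≤ c (ℕₚ.*-mono-≤ X+1≤ X+1≤))
          (ℕₚ.≤-reflexive (ℕₛ.solve 2 (λ c x → c ℕₛ.:* ((x ℕₛ.:+ x) ℕₛ.:* (x ℕₛ.:+ x)) ℕₛ.:= ℕₛ.con 4 ℕₛ.:* c ℕₛ.:* (x ℕₛ.:* (x ℕₛ.:* ℕₛ.con 1))) refl c X)))
          where
          X+1≤ : suc X ℕ.≤ X ℕ.+ X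
          X+1≤ = ℕₚ.+-monoˡ-≤ X 1≤X
        result : ScaledGap (k₁ ℕ.* X ℕ.^ 1) (X ℕ.^ 2) k₂ → ∃ λ G → ConsecutiveGap N G × fromℕ N * G ≤ fromℕ C
        result (G , 0≤G , G≤ , gaps) = G , gaps N box≤N , (begin
          fromℕ N * G ≤⟨ *-monoʳ-≤ G 0≤G (fromℕ-mono N≤) ⟩
          fromℕ (4 ℕ.* c ℕ.* (X ℕ.^ 2)) * G ≡⟨ cong (_* G) (fromℕ-* (4 ℕ.* c) (X ℕ.^ 2)) ⟩
          (fromℕ (4 ℕ.* c) * fromℕ (X ℕ.^ 2)) * G ≡⟨ solve 3 (λ c x g → (c :* x) :* g := c :* (g :* x)) refl (fromℕ (4 ℕ.* c)) (fromℕ (X ℕ.^ 2)) G ⟩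
          fromℕ (4 ℕ.* c) * (G * fromℕ (X ℕ.^ 2)) ≤⟨ *-monoˡ-≤ _ (fromℕ-nonNeg (4 ℕ.* c)) G≤ ⟩
          fromℕ (4 ℕ.* c) * fromℕ (8 ℕ.* k₂) ≡⟨ sym (fromℕ-* (4 ℕ.* c) (8 ℕ.* k₂)) ⟩
          fromℕ C₁ ≤⟨ fromℕ-mono (ℕₚ.≤-trans (ℕₚ.m≤m+n C₁ C₂) (ℕₚ.n≤1+n _)) ⟩
          fromℕ C ∎)
          where open ≤-Reasoning

-- The field ℚ[√D]

ℚ-zero-product : ∀ p q → p ℚ.* q ≡ 0ℚ → p ≡ 0ℚ ⊎ q ≡ 0ℚ
ℚ-zero-product p q e with p ℚₚ.≟ 0ℚ
... | yes z = inj₁ z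
... | no nz = inj₂ (begin
  q ≡⟨ sym (ℚₚ.*-identityˡ q) ⟩
  1ℚ ℚ.* q ≡⟨ cong (ℚ._* q) (sym (ℚₚ.*-inverseˡ p)) ⟩
  ((ℚ.1/ p) ℚ.* p) ℚ.* q ≡⟨ ℚₚ.*-assoc (ℚ.1/ p) p q ⟩
  (ℚ.1/ p) ℚ.* (p ℚ.* q) ≡⟨ cong ((ℚ.1/ p) ℚ.*_) e ⟩
  (ℚ.1/ p) ℚ.* 0ℚ ≡⟨ ℚₚ.*-zeroʳ (ℚ.1/ p) ⟩
  0ℚ ∎)
  where
  open ≡-Reasoning
  instance _ = ℚ.≢-nonZero nz

ℚ-orderedDomain : OrderedDomain
ℚ-orderedDomain = record
  { isCommutativeRing = ℚₚ.+-*-isCommutativeRing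
  ; NonNeg = 0ℚ ℚ.≤_
  ; nonNeg-+ = λ {x} {y} p q → ℚₚ.+-mono-≤ p q
  ; nonNeg-* = λ {x} {y} p q → ℚₚ.nonNegative⁻¹ (x ℚ.* y)
      {{ℚₚ.nonNeg*nonNeg⇒nonNeg x {{ℚ.nonNegative p}} y {{ℚ.nonNegative q}}}}
  ; nonNeg-total = total
  ; nonNeg-antisym = λ {x} p q → ℚₚ.≤-antisym (subst (ℚ._≤ 0ℚ) (neg-neg x) (ℚₚ.neg-antimono-≤ q)) p
  ; 1≢0 = λ ()
  ; zero-product = ℚ-zero-product
  }
  where
  neg-neg : ∀ x → ℚ.- (ℚ.- x) ≡ x
  neg-neg (mkℚ (pos zero) _ _) = refl
  neg-neg (mkℚ (pos (suc n)) _ _) = refl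
  neg-neg (mkℚ -[1+ _ ] _ _) = refl
  total : ∀ x → 0ℚ ℚ.≤ x ⊎ 0ℚ ℚ.≤ ℚ.- x
  total x with ℚₚ.≤-total 0ℚ x
  ... | inj₁ p = inj₁ p
  ... | inj₂ p = inj₂ (ℚₚ.neg-antimono-≤ p)

module Q = OrderedDomainProperties ℚ-orderedDomain

ℚ≤⇒Q≤ : ∀ {p q} → p ℚ.≤ q → p Q.≤ q
ℚ≤⇒Q≤ {p} {q} r = Q.fromDiff (subst (ℚ._≤ q ℚ.- p) (ℚₚ.+-inverseʳ p) (ℚₚ.+-mono-≤ r (ℚₚ.≤-refl {ℚ.- p})))

Q≤⇒ℚ≤ : ∀ {p q} → p Q.≤ q → p ℚ.≤ q
Q≤⇒ℚ≤ {p} {q} r = subst₂ ℚ._≤_ (ℚₚ.+-identityˡ p)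
  (Q.solve 2 (λ p q → (q Q.:- p) Q.:+ p Q.:= q) refl p q) (ℚₚ.+-mono-≤ (Q.diff r) (ℚₚ.≤-refl {p}))

ℕ→ℚ-mkℚ : ∀ n → toℚᵘ (ℕ→ℚ n) ≡ mkℚᵘ (pos n) 0
ℕ→ℚ-mkℚ n = cong toℚᵘ (ℚₚ.normalize-coprime (Coprimality.sym (Coprimality.1-coprimeTo n)))

ℕ→ℚ-suc : ∀ n → ℕ→ℚ (suc n) ≡ 1ℚ ℚ.+ ℕ→ℚ n
ℕ→ℚ-suc n = ℚₚ.toℚᵘ-injective (ℚᵘₚ.≃-trans (ℚᵘₚ.≃-reflexive (ℕ→ℚ-mkℚ (suc n)))
  (ℚᵘₚ.≃-trans step (ℚᵘₚ.≃-trans (ℚᵘₚ.≃-reflexive (cong (toℚᵘ 1ℚ ℚᵘ.+_) (sym (ℕ→ℚ-mkℚ n))))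
    (ℚᵘₚ.≃-sym (ℚₚ.toℚᵘ-homo-+ 1ℚ (ℕ→ℚ n))))))
  where
  step : mkℚᵘ (pos (suc n)) 0 ℚᵘ.≃ toℚᵘ 1ℚ ℚᵘ.+ mkℚᵘ (pos n) 0
  step = *≡* (cong (ℤ._* ℤ.1ℤ) (cong (λ z → ℤ.1ℤ ℤ.+ z) (sym (ℤₚ.*-identityʳ (pos n)))))

ℕ→ℚ≡fromℕ : ∀ n → ℕ→ℚ n ≡ Q.fromℕ n
ℕ→ℚ≡fromℕ zero = refl
ℕ→ℚ≡fromℕ (suc n) = trans (ℕ→ℚ-suc n) (trans (cong (1ℚ ℚ.+_) (ℕ→ℚ≡fromℕ n)) (sym (Q.fromℕ-suc n)))

-- For q = n / d in lowest terms n² = D d², so d divides n² and, being coprime to n, equals 1. Then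
-- D = n², and square-freeness leaves D = 1.
squareFree⇒irrational : ∀ D → 2 ℕ.≤ D → SquareFree D → ∀ q → q ℚ.* q ≢ ℕ→ℚ D
squareFree⇒irrational D 2≤D sf q@(mkℚ n d-1 c) e = ℕₚ.<⇒≢ 2≤D (sym (begin
    D ≡⟨ ℕeq₁ ⟩
    ℤ.∣ n ∣ ℕ.* ℤ.∣ n ∣ ≡⟨ cong (λ k → k ℕ.* k) n≡1 ⟩
    1 ∎))
  where
  open ≡-Reasoning
  d = suc d-1
  ≃₁ : toℚᵘ q ℚᵘ.* toℚᵘ q ℚᵘ.≃ mkℚᵘ (pos D) 0
  ≃₁ = ℚᵘₚ.≃-trans (ℚᵘₚ.≃-sym (ℚₚ.toℚᵘ-homo-* q q)) (ℚᵘₚ.≃-reflexive (trans (cong toℚᵘ e) (ℕ→ℚ-mkℚ D)))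
  ℕeq : ℤ.∣ n ∣ ℕ.* ℤ.∣ n ∣ ≡ D ℕ.* (d ℕ.* d)
  ℕeq with ≃₁
  ... | *≡* p = trans (sym (ℤₚ.abs-* n n)) (trans (cong ℤ.∣_∣ (trans (sym (ℤₚ.*-identityʳ (n ℤ.* n))) p)) (ℤₚ.abs-* (pos D) (pos (d ℕ.* d))))
  coprime : Coprimality.Coprime d ℤ.∣ n ∣
  coprime = Coprimality.sym (Coprimality.recompute c)
  d≡1 : d ≡ 1
  d≡1 = coprime (∣-refl , Coprimality.coprime-divisor coprime
    (divides (D ℕ.* d) (trans ℕeq (sym (ℕₚ.*-assoc D d d)))))
  ℕeq₁ : D ≡ ℤ.∣ n ∣ ℕ.* ℤ.∣ n ∣
  ℕeq₁ = sym (trans ℕeq (trans (cong (λ k → D ℕ.* (k ℕ.* k)) d≡1) (ℕₚ.*-identityʳ D)))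
  n≡1 : ℤ.∣ n ∣ ≡ 1
  n≡1 = sf ℤ.∣ n ∣ (subst (ℤ.∣ n ∣ ℕ.* ℤ.∣ n ∣ ∣_) (sym ℕeq₁) ∣-refl)

ℚ-inverse : ∀ p → p ≢ 0ℚ → ∃ λ i → p ℚ.* i ≡ 1ℚ
ℚ-inverse p nz = ℚ.1/ p , ℚₚ.*-inverseʳ p
  where instance _ = ℚ.≢-nonZero nz

fromℤ-mkℚ : ∀ i → toℚᵘ (Q.fromℤ i) ≡ mkℚᵘ i 0
fromℤ-mkℚ (pos n) = trans (cong toℚᵘ (sym (ℕ→ℚ≡fromℕ n))) (ℕ→ℚ-mkℚ n)
fromℤ-mkℚ -[1+ n ] = lem (Q.fromℕ (suc n)) (fromℤ-mkℚ (pos (suc n)))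
  where
  lem : ∀ p → toℚᵘ p ≡ mkℚᵘ (pos (suc n)) 0 → toℚᵘ (ℚ.- p) ≡ mkℚᵘ -[1+ n ] 0
  lem (mkℚ (pos (suc n)) zero _) refl = refl

clearDenominator : ∀ p → Q.fromℕ (ℚ.↧ₙ p) ℚ.* p ≡ Q.fromℤ (ℚ.↥ p)
clearDenominator p@(mkℚ n d-1 _) = ℚₚ.toℚᵘ-injective (ℚᵘₚ.≃-trans (ℚₚ.toℚᵘ-homo-* (Q.fromℕ (suc d-1)) p)
  (ℚᵘₚ.≃-trans (ℚᵘₚ.≃-reflexive (cong (ℚᵘ._* mkℚᵘ n d-1) (fromℤ-mkℚ (pos (suc d-1)))))
    (ℚᵘₚ.≃-trans (*≡* (trans (ℤₚ.*-identityʳ _) (trans (ℤₚ.*-comm (pos (suc d-1)) n) (cong (λ z → n ℤ.* pos (suc z)) (sym (ℕₚ.+-identityʳ d-1))))))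
      (ℚᵘₚ.≃-reflexive (sym (fromℤ-mkℚ n))))))

module QuadraticField (D : ℕ) (2≤D : 2 ℕ.≤ D) (squareFree : SquareFree D) where
  open Field D

  0≤Dq : 0ℚ Q.≤ Dq
  0≤Dq = subst (0ℚ Q.≤_) (sym (ℕ→ℚ≡fromℕ D)) (Q.fromℕ-nonNeg D)

  open OverField.QuadraticExtension ℚ-orderedDomain (ℚₚ._≟ 0ℚ) ℚ-inverse Dq 0≤Dq
    (squareFree⇒irrational D 2≤D squareFree)
    using (norm; orderedDomain) public

  open OrderedDomainProperties orderedDomain
  open AbsoluteBounds orderedDomain

  private
    norm-form : ∀ a b → a ℚ.* a Q.- b ℚ.* b ℚ.* Dq ≡ norm (a , b)
    norm-form a b = Q.solve 3 (λ a b D → a Q.:* a Q.:- b Q.:* b Q.:* D Q.:= a Q.:* a Q.:- D Q.:* (b Q.:* b)) refl a b Dq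
    neg-norm-form : ∀ a b → b ℚ.* b ℚ.* Dq Q.- a ℚ.* a ≡ ℚ.- norm (a , b)
    neg-norm-form a b = Q.solve 3 (λ a b D → b Q.:* b Q.:* D Q.:- a Q.:* a Q.:= Q.:- (a Q.:* a Q.:- D Q.:* (b Q.:* b))) refl a b Dq

    0≤norm : ∀ a b → b ℚ.* b ℚ.* Dq ℚ.≤ a ℚ.* a → Q.NonNeg (norm (a , b))
    0≤norm a b p = subst Q.NonNeg (norm-form a b) (Q.diff (ℚ≤⇒Q≤ p))
    norm≤0 : ∀ a b → a ℚ.* a ℚ.≤ b ℚ.* b ℚ.* Dq → Q.NonNeg (ℚ.- norm (a , b))
    norm≤0 a b p = subst Q.NonNeg (neg-norm-form a b) (Q.diff (ℚ≤⇒Q≤ p))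
    0≤norm⁻¹ : ∀ a b → Q.NonNeg (norm (a , b)) → b ℚ.* b ℚ.* Dq ℚ.≤ a ℚ.* a
    0≤norm⁻¹ a b p = Q≤⇒ℚ≤ (Q.fromDiff (subst Q.NonNeg (sym (norm-form a b)) p))
    norm≤0⁻¹ : ∀ a b → Q.NonNeg (ℚ.- norm (a , b)) → a ℚ.* a ℚ.≤ b ℚ.* b ℚ.* Dq
    norm≤0⁻¹ a b p = Q≤⇒ℚ≤ (Q.fromDiff (subst Q.NonNeg (sym (neg-norm-form a b)) p))

  -- The two branches of the cone, with the comparisons written as in the Boolean test. When both
  -- coordinates are nonnegative the test compares nothing, and totality picks a branch.
  NonNegℚ : ℚ → ℚ → Set
  NonNegℚ a b = (0ℚ ℚ.≤ a × b ℚ.* b ℚ.* Dq ℚ.≤ a ℚ.* a) ⊎ (0ℚ ℚ.≤ b × a ℚ.* a ℚ.≤ b ℚ.* b ℚ.* Dq)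

  nonnegB⇒NonNegℚ : ∀ a b → T (nonnegB (a , b)) → NonNegℚ a b
  nonnegB⇒NonNegℚ a b t with 0ℚ ℚₚ.≤? a | 0ℚ ℚₚ.≤? b
  nonnegB⇒NonNegℚ a b t | yes p | yes q with ℚₚ.≤-total (b ℚ.* b ℚ.* Dq) (a ℚ.* a)
  ... | inj₁ r = inj₁ (p , r)
  ... | inj₂ r = inj₂ (q , r)
  nonnegB⇒NonNegℚ a b t | yes p | no q with (b ℚ.* b ℚ.* Dq) ℚₚ.≤? (a ℚ.* a)
  ... | yes r = inj₁ (p , r)
  nonnegB⇒NonNegℚ a b t | no p | yes q with (a ℚ.* a) ℚₚ.≤? (b ℚ.* b ℚ.* Dq)
  ... | yes r = inj₂ (q , r)

  NonNegℚ⇒nonnegB : ∀ a b → NonNegℚ a b → T (nonnegB (a , b))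
  NonNegℚ⇒nonnegB a b t with 0ℚ ℚₚ.≤? a | 0ℚ ℚₚ.≤? b
  NonNegℚ⇒nonnegB a b t | yes p | yes q = tt
  NonNegℚ⇒nonnegB a b t | yes p | no q with (b ℚ.* b ℚ.* Dq) ℚₚ.≤? (a ℚ.* a)
  ... | yes r = tt
  ... | no r = [ (λ (_ , s) → r s) , (λ (s , _) → q s) ]′ t
  NonNegℚ⇒nonnegB a b t | no p | yes q with (a ℚ.* a) ℚₚ.≤? (b ℚ.* b ℚ.* Dq)
  ... | yes r = tt
  ... | no r = [ (λ (s , _) → p s) , (λ (_ , s) → r s) ]′ t
  NonNegℚ⇒nonnegB a b t | no p | no q = [ (λ (s , _) → p s) , (λ (s , _) → q s) ]′ t

  posB⇒nonnegB : ∀ a b → T (posB (a , b)) → T (nonnegB (a , b))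
  posB⇒nonnegB a b t with 0ℚ ℚₚ.≤? a | 0ℚ ℚₚ.≤? b
  posB⇒nonnegB a b t | yes p | yes q = tt
  posB⇒nonnegB a b t | yes p | no q with (b ℚ.* b ℚ.* Dq) ℚₚ.<? (a ℚ.* a) | (b ℚ.* b ℚ.* Dq) ℚₚ.≤? (a ℚ.* a)
  ... | yes r | yes _ = tt
  ... | yes r | no r′ = r′ (ℚₚ.<⇒≤ r)
  posB⇒nonnegB a b t | no p | yes q with (a ℚ.* a) ℚₚ.<? (b ℚ.* b ℚ.* Dq) | (a ℚ.* a) ℚₚ.≤? (b ℚ.* b ℚ.* Dq)
  ... | yes r | yes _ = tt
  ... | yes r | no r′ = r′ (ℚₚ.<⇒≤ r)

  nonnegB⇒NonNeg : ∀ x → T (nonnegB x) → NonNeg x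
  nonnegB⇒NonNeg (a , b) t = [ (λ (p , r) → inj₁ (p , 0≤norm a b r)) , (λ (q , r) → inj₂ (q , norm≤0 a b r)) ]′ (nonnegB⇒NonNegℚ a b t)

  NonNeg⇒nonnegB : ∀ x → NonNeg x → T (nonnegB x)
  NonNeg⇒nonnegB (a , b) t = NonNegℚ⇒nonnegB a b ([ (λ (p , r) → inj₁ (p , 0≤norm⁻¹ a b r)) , (λ (q , r) → inj₂ (q , norm≤0⁻¹ a b r)) ]′ t)

  ≤K⇒≤ : ∀ {x y} → x ≤K y → x ≤ y
  ≤K⇒≤ {x} {y} p = fromDiff (nonnegB⇒NonNeg (y -K x) p)

  ≤⇒≤K : ∀ {x y} → x ≤ y → x ≤K y
  ≤⇒≤K {x} {y} p = NonNeg⇒nonnegB (y -K x) (diff p)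

  Pos⇒0< : ∀ x → Pos x → 0# < x
  -- At zero `posB` computes to `false`.
  Pos⇒0< (a , b) t = nonNeg⇒0≤ (nonnegB⇒NonNeg (a , b) (posB⇒nonnegB a b t)) , λ { refl → t }

  √D : K
  √D = (0ℚ , 1ℚ)

  fromℕ≡ι : ∀ n → fromℕ n ≡ ι (Q.fromℕ n)
  fromℕ≡ι zero = refl
  fromℕ≡ι (suc n) = trans (fromℕ-suc n) (trans (cong (1# +_) (fromℕ≡ι n)) (cong (_, 0ℚ) (sym (Q.fromℕ-suc n))))

  ιℕ≡fromℕ : ∀ n → ιℕ n ≡ fromℕ n
  ιℕ≡fromℕ n = trans (cong ι (ℕ→ℚ≡fromℕ n)) (sym (fromℕ≡ι n))

  fromℤ≡ι : ∀ i → fromℤ i ≡ ι (Q.fromℤ i)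
  fromℤ≡ι (pos n) = fromℕ≡ι n
  fromℤ≡ι -[1+ n ] = cong (λ z → - z) (fromℕ≡ι (suc n))

  ι-scale : ∀ p q → ι p * (q , 0ℚ) ≡ ι (p ℚ.* q)
  ι-scale p q = cong₂ _,_ (Q.solve 3 (λ p q D → p Q.:* q Q.:+ D Q.:* (Q.con (pos 0) Q.:* Q.con (pos 0)) Q.:= p Q.:* q) refl p q Dq)
    (Q.solve 2 (λ p q → p Q.:* Q.con (pos 0) Q.:+ Q.con (pos 0) Q.:* q Q.:= Q.con (pos 0)) refl p q)

  ι-* : ∀ p x → ι p * x ≡ (p ℚ.* proj₁ x , p ℚ.* proj₂ x)
  ι-* p (a , b) = cong₂ _,_ (Q.solve 4 (λ p a b D → p Q.:* a Q.:+ D Q.:* (Q.con (pos 0) Q.:* b) Q.:= p Q.:* a) refl p a b Dq)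
    (Q.solve 3 (λ p a b → p Q.:* b Q.:+ Q.con (pos 0) Q.:* a Q.:= p Q.:* b) refl p a b)

  *-√D : ∀ p → ι p * √D ≡ (0ℚ , p)
  *-√D p = trans (ι-* p √D) (cong₂ _,_ (Q.zeroʳ p) (Q.*-identityʳ p))

  integer-coordinates : ∀ a b → fromℤ a + fromℤ b * √D ≡ (Q.fromℤ a , Q.fromℤ b)
  integer-coordinates a b = trans (cong₂ (λ x y → x + y * √D) (fromℤ≡ι a) (fromℤ≡ι b))
    (trans (cong (ι (Q.fromℤ a) +_) (*-√D (Q.fromℤ b))) (cong₂ _,_ (Q.+-identityʳ _) (Q.+-identityˡ _)))

  √D² : √D * √D ≡ fromℕ D
  √D² = trans (cong₂ _,_ (Q.solve 1 (λ D → Q.con (pos 0) Q.:* Q.con (pos 0) Q.:+ D Q.:* (Q.con (pos 1) Q.:* Q.con (pos 1)) Q.:= D) refl Dq) refl) (ιℕ≡fromℕ D)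

  1≤√D : 1# ≤ √D
  1≤√D = square-cancel-≤ (nonNeg⇒0≤ (inj₂ (ℚₚ.<⇒≤ (ℚₚ.positive⁻¹ 1ℚ) , norm≤0 0ℚ 1ℚ (Q≤⇒ℚ≤ (subst (0ℚ Q.≤_) (sym (trans (cong (ℚ._* Dq) (Q.*-identityˡ 1ℚ)) (Q.*-identityˡ Dq))) 0≤Dq)))))
    (subst₂ _≤_ (sym (*-identityˡ 1#)) (sym √D²) (fromℕ-mono {1} {D} (ℕₚ.≤-trans (ℕ.s≤s ℕ.z≤n) 2≤D)))

  √D-irrational : ∀ a b → fromℤ a + fromℤ b * √D ≡ 0# → b ≡ ℤ.0ℤ
  √D-irrational a b e = AbsoluteBounds.fromℤ-injective ℚ-orderedDomain {b} {ℤ.0ℤ} (cong proj₂ (trans (sym (integer-coordinates a b)) e))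

  clearDenominators : ∀ x → ∃ λ q → ∃ λ a → ∃ λ b → 1 ℕ.≤ q × fromℕ q * x ≡ fromℤ a + fromℤ b * √D
  clearDenominators (x , y) = p ℕ.* q , ℚ.↥ x ℤ.* pos q , ℚ.↥ y ℤ.* pos p , ℕ.s≤s ℕ.z≤n , eq
    where
    p q : ℕ
    p = ℚ.↧ₙ x
    q = ℚ.↧ₙ y
    re≡ : Q.fromℕ (p ℕ.* q) ℚ.* x ≡ Q.fromℤ (ℚ.↥ x ℤ.* pos q)
    re≡ = begin
      Q.fromℕ (p ℕ.* q) ℚ.* x ≡⟨ cong (ℚ._* x) (Q.fromℕ-* p q) ⟩
      Q.fromℕ p ℚ.* Q.fromℕ q ℚ.* x ≡⟨ Q.solve 3 (λ p q x → p Q.:* q Q.:* x Q.:= (p Q.:* x) Q.:* q) refl (Q.fromℕ p) (Q.fromℕ q) x ⟩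
      Q.fromℕ p ℚ.* x ℚ.* Q.fromℕ q ≡⟨ cong (ℚ._* Q.fromℕ q) (clearDenominator x) ⟩
      Q.fromℤ (ℚ.↥ x) ℚ.* Q.fromℕ q ≡⟨ sym (Q.fromℤ-* (ℚ.↥ x) (pos q)) ⟩
      Q.fromℤ (ℚ.↥ x ℤ.* pos q) ∎
      where open ≡-Reasoning
    im≡ : Q.fromℕ (p ℕ.* q) ℚ.* y ≡ Q.fromℤ (ℚ.↥ y ℤ.* pos p)
    im≡ = begin
      Q.fromℕ (p ℕ.* q) ℚ.* y ≡⟨ cong (ℚ._* y) (Q.fromℕ-* p q) ⟩
      Q.fromℕ p ℚ.* Q.fromℕ q ℚ.* y ≡⟨ Q.solve 3 (λ p q y → p Q.:* q Q.:* y Q.:= (q Q.:* y) Q.:* p) refl (Q.fromℕ p) (Q.fromℕ q) y ⟩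
      Q.fromℕ q ℚ.* y ℚ.* Q.fromℕ p ≡⟨ cong (ℚ._* Q.fromℕ p) (clearDenominator y) ⟩
      Q.fromℤ (ℚ.↥ y) ℚ.* Q.fromℕ p ≡⟨ sym (Q.fromℤ-* (ℚ.↥ y) (pos p)) ⟩
      Q.fromℤ (ℚ.↥ y ℤ.* pos p) ∎
      where open ≡-Reasoning
    eq : fromℕ (p ℕ.* q) * (x , y) ≡ fromℤ (ℚ.↥ x ℤ.* pos q) + fromℤ (ℚ.↥ y ℤ.* pos p) * √D
    eq = begin
      fromℕ (p ℕ.* q) * (x , y) ≡⟨ cong (_* (x , y)) (fromℕ≡ι (p ℕ.* q)) ⟩
      ι (Q.fromℕ (p ℕ.* q)) * (x , y) ≡⟨ ι-* (Q.fromℕ (p ℕ.* q)) (x , y) ⟩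
      (Q.fromℕ (p ℕ.* q) ℚ.* x , Q.fromℕ (p ℕ.* q) ℚ.* y) ≡⟨ cong₂ _,_ re≡ im≡ ⟩
      (Q.fromℤ (ℚ.↥ x ℤ.* pos q) , Q.fromℤ (ℚ.↥ y ℤ.* pos p)) ≡⟨ sym (integer-coordinates (ℚ.↥ x ℤ.* pos q) (ℚ.↥ y ℤ.* pos p)) ⟩
      fromℤ (ℚ.↥ x ℤ.* pos q) + fromℤ (ℚ.↥ y ℤ.* pos p) * √D ∎
      where open ≡-Reasoning

square-injective : ∀ {m n} → m ℕ.* m ≡ n ℕ.* n → m ≡ n
square-injective {m} {n} e with ℕₚ.<-cmp m n
... | tri< p _ _ = ⊥-elim (ℕₚ.<⇒≢ (ℕₚ.*-mono-< p p) e)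
... | tri≈ _ p _ = p
... | tri> _ _ p = ⊥-elim (ℕₚ.<⇒≢ (ℕₚ.*-mono-< p p) (sym e))

ℕ→ℚ-pos : ∀ {n} → 1 ℕ.≤ n → 0ℚ ℚ.< ℕ→ℚ n
ℕ→ℚ-pos {suc n} _ = subst (0ℚ ℚ.<_) (sym (ℕ→ℚ≡fromℕ (suc n)))
  (ℚₚ.≰⇒> λ p → Q.<⇒≱ (Q.fromℕ-pos n) (ℚ≤⇒Q≤ p))

numerator-pos : ∀ r → 0ℚ ℚ.< r → ∃ λ k → ℚ.↥ r ≡ pos (suc k)
numerator-pos r 0<r = helper r (ℚ.positive 0<r)
  where
  helper : ∀ r → ℚ.Positive r → ∃ λ k → ℚ.↥ r ≡ pos (suc k)
  helper (mkℚ (pos (suc k)) _ _) _ = k , refl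

Qfromℕ-injective : ∀ {m n} → Q.fromℕ m ≡ Q.fromℕ n → m ≡ n
Qfromℕ-injective {m} {n} e = ℤₚ.+-injective (AbsoluteBounds.fromℤ-injective ℚ-orderedDomain {pos m} {pos n} e)

Qfromℕ-≢0 : ∀ {n} → 1 ℕ.≤ n → Q.fromℕ n ≢ 0ℚ
Qfromℕ-≢0 {suc n} _ e = proj₂ (Q.fromℕ-pos n) (sym e)

Qfromℤ-≢0 : ∀ {i} → Q.fromℤ i ≢ 0ℚ → i ≢ 0ℤ
Qfromℤ-≢0 p refl = p refl

-- Transfer to the eigenvalues over ℚ[√D].

module GapBounds (D : ℕ) (2≤D : 2 ℕ.≤ D) (squareFree : SquareFree D) where
  open Field D
  open QuadraticField D 2≤D squareFree
  open OrderedDomainProperties orderedDomain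
  open AbsoluteBounds orderedDomain
  open OverOrderedDomain orderedDomain
  open Evaluation using (module BalancedFactorisation; factorisation; n≤t; next)
  open QuadraticIntegers D √D 1≤√D √D² √D-irrational using (height; Conjugate; conjugate; conj-sym; conj-≢0; abs-height; conj-height)
  open RationalApproximation
  module SC = Core D √D 1≤√D √D² √D-irrational
  module GC = GeneralCore D √D 1≤√D √D² √D-irrational

  ^K≡^ : ∀ x n → x ^K n ≡ x ^ n
  ^K≡^ x zero = refl
  ^K≡^ x (suc n) = cong (x *_) (^K≡^ x n)

  fromℕ*-proj₂ : ∀ n x → proj₂ (fromℕ n * x) ≡ Q.fromℕ n ℚ.* proj₂ x
  fromℕ*-proj₂ n x = cong proj₂ (trans (cong (_* x) (fromℕ≡ι n)) (ι-* (Q.fromℕ n) x))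

  Conclusion₁ : K → ℕ → ℕ → Set
  Conclusion₁ α p q = Σ ℚ λ C → (0ℚ ℚ.< C) ×
    (∀ N₀ → ∃ λ N → N₀ ℕ.≤ N × DeltaMinLe α N (λ g → ((ιℕ N *K g) ^K q) ≤K ((ι C ^K q) *K (ιℕ N ^K p))))

  Conclusion₂ : K → Set
  Conclusion₂ α = Σ ℚ λ C → (0ℚ ℚ.< C) × (∀ N → 2 ℕ.≤ N → DeltaMinLe α N (λ g → (ιℕ N *K g) ≤K ι C))

  module WithSlope (α : K) (α₂≢0 : proj₂ α ≢ 0ℚ) (0<α : 0# < α)
    (q₀ : ℕ) (a₀ b₀ : ℤ) (1≤q₀ : 1 ℕ.≤ q₀) (q₀α≡ : fromℕ q₀ * α ≡ fromℤ a₀ + fromℤ b₀ * √D) where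

    private
      y₀ : K
      y₀ = fromℤ a₀ + fromℤ b₀ * √D

      0<y₀ : 0# < y₀
      0<y₀ = subst (0# <_) q₀α≡ (*-pos (<-≤-trans 0<1 (fromℕ-mono {1} {q₀} 1≤q₀)) 0<α)

      b₀≢0 : b₀ ≢ 0ℤ
      b₀≢0 = Qfromℤ-≢0 λ e → Q.*-≢0 (Qfromℕ-≢0 1≤q₀) α₂≢0
        (trans (sym (fromℕ*-proj₂ q₀ α)) (trans (cong proj₂ (trans q₀α≡ (integer-coordinates a₀ b₀))) e))

      -- The summand M + 1 accounts for α + 1 ≤ c₀, as α ≤ y₀ ≤ M. The summand M′ q₀ accounts for 1
      -- ≤ c₀ α, by Liouville's bound 1 ≤ M′ y₀ with y₀ = q₀ α.
      M M′ c₀ : ℕ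
      M = height a₀ b₀
      M′ = height a₀ (ℤ.- b₀)
      c₀ = suc M ℕ.+ M′ ℕ.* q₀

      y₀-conj : Conjugate y₀ (fromℤ a₀ - fromℤ b₀ * √D)
      y₀-conj = conjugate a₀ b₀ refl refl

      α+1≤c₀ : α + 1# ≤ fromℕ c₀
      α+1≤c₀ = begin
        α + 1# ≡⟨ cong (_+ 1#) (sym (*-identityˡ α)) ⟩
        1# * α + 1# ≤⟨ +-monoˡ-≤ 1# (*-monoʳ-≤ α (proj₁ 0<α) (fromℕ-mono {1} {q₀} 1≤q₀)) ⟩
        fromℕ q₀ * α + 1# ≡⟨ cong (_+ 1#) q₀α≡ ⟩
        y₀ + 1# ≤⟨ +-monoˡ-≤ 1# (proj₁ (abs-height y₀-conj)) ⟩
        fromℕ M + 1# ≡⟨ trans (+-comm (fromℕ M) 1#) (sym (fromℕ-suc M)) ⟩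
        fromℕ (suc M) ≤⟨ fromℕ-mono (ℕₚ.m≤m+n (suc M) (M′ ℕ.* q₀)) ⟩
        fromℕ c₀ ∎
        where open ≤-Reasoning

      1≤c₀α : 1# ≤ fromℕ c₀ * α
      1≤c₀α = begin
        1# ≤⟨ conj-height (conj-sym y₀-conj) (conj-≢0 y₀-conj (λ e → proj₂ 0<y₀ (sym e))) (proj₁ 0<y₀) ⟩
        fromℕ M′ * y₀ ≡⟨ cong (fromℕ M′ *_) (sym q₀α≡) ⟩
        fromℕ M′ * (fromℕ q₀ * α) ≡⟨ trans (sym (*-assoc (fromℕ M′) (fromℕ q₀) α)) (cong (_* α) (sym (fromℕ-* M′ q₀))) ⟩
        fromℕ (M′ ℕ.* q₀) * α ≤⟨ *-monoʳ-≤ α (proj₁ 0<α) (fromℕ-mono {M′ ℕ.* q₀} {c₀} (ℕₚ.m≤n+m (M′ ℕ.* q₀) (suc M))) ⟩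
        fromℕ c₀ * α ∎
        where open ≤-Reasoning

      fromℕ-injective : ∀ {m n} → fromℕ m ≡ fromℕ n → m ≡ n
      fromℕ-injective e = ℕₚ.≤-antisym (fromℕ-cancel (≤-reflexive e)) (fromℕ-cancel (≤-reflexive (sym e)))

      coordinate : ∀ a b → proj₂ (α * fromℕ a + fromℕ b) ≡ Q.fromℕ a ℚ.* proj₂ α
      coordinate a b = trans (cong proj₂ (cong₂ _+_ (*-comm α (fromℕ a)) (fromℕ≡ι b)))
        (trans (cong (ℚ._+ 0ℚ) (fromℕ*-proj₂ a α)) (Q.+-identityʳ _))

      -- The coefficient of √D is m² times that of α, which is nonzero; so m² is determined, and
      -- then n².
      injective : ∀ m n m′ n′ → α * fromℕ (m ℕ.* m) + fromℕ (n ℕ.* n) ≡ α * fromℕ (m′ ℕ.* m′) + fromℕ (n′ ℕ.* n′) → m ≡ m′ × n ≡ n′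
      injective m n m′ n′ e = square-injective m²≡ , square-injective (fromℕ-injective (+-cancelˡ (α * fromℕ (m ℕ.* m))
          (trans e (cong (λ z → α * fromℕ z + fromℕ (n′ ℕ.* n′)) (sym m²≡)))))
        where
        m²≡ : m ℕ.* m ≡ m′ ℕ.* m′
        m²≡ = Qfromℕ-injective (Q.*-cancelʳ α₂≢0 (trans (sym (coordinate (m ℕ.* m) (n ℕ.* n))) (trans (cong proj₂ e) (coordinate (m′ ℕ.* m′) (n′ ℕ.* n′)))))
        +-cancelˡ : ∀ x {y z} → x + y ≡ x + z → y ≡ z
        +-cancelˡ x {y} {z} e = ≤-antisym (+-cancelˡ-≤ x (≤-reflexive e)) (+-cancelˡ-≤ x (≤-reflexive (sym e)))

    open Spectrum nonnegB nonnegB⇒NonNeg NonNeg⇒nonnegB α 0<α injective c₀ α+1≤c₀ 1≤c₀α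
      using (eigenvalue; indicator; count; Lambda; ConsecutiveGap)
    open Gaps nonnegB nonnegB⇒NonNeg NonNeg⇒nonnegB α 0<α injective c₀ α+1≤c₀ 1≤c₀α
      using (GapBeyond; infinitely-often; always)

    ev≡ : ∀ m n → ev α m n ≡ eigenvalue m n
    ev≡ m n = cong₂ (λ x y → α * x + y) (ιℕ≡fromℕ (m ℕ.* m)) (ιℕ≡fromℕ (n ℕ.* n))

    countRow≡ : ∀ μ m N → countRow α μ m N ≡ sumRow (indicator μ) m N
    countRow≡ μ m zero = refl
    countRow≡ μ m (suc n) = cong₂ ℕ._+_ (cong (λ e → if nonnegB (μ - e) then 1 else 0) (ev≡ m (suc n))) (countRow≡ μ m n)

    countBox≡ : ∀ μ M N → countBox α μ M N ≡ sumBox (indicator μ) M N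
    countBox≡ μ zero N = refl
    countBox≡ μ (suc m) N = cong₂ ℕ._+_ (countRow≡ μ (suc m) N) (countBox≡ μ m N)

    Lambda⇒IsLambda : ∀ {i μ} → Lambda i μ → IsLambda α i μ
    Lambda⇒IsLambda {i} {μ} l = (m , n , 1≤m , 1≤n , trans (ev≡ m n) μ≡)
        , (B , (λ m′ n′ p q r → box m′ n′ p q (subst (_≤ μ) (ev≡ m′ n′) (≤K⇒≤ r))) , trans (countBox≡ μ B B) count≡)
      where open Lambda l

    ConsecutiveGap⇒DeltaMinLe : ∀ {N G} {Bnd : K → Set} → ConsecutiveGap N G → (∀ g → 0# ≤ g → g ≤ G → Bnd g) → DeltaMinLe α N Bnd
    ConsecutiveGap⇒DeltaMinLe c bnd = i , 1≤i , i<N , μ , μ′ , Lambda⇒IsLambda λᵢ , Lambda⇒IsLambda λᵢ₊₁ , bnd (μ′ - μ) 0≤gap gap≤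
      where open ConsecutiveGap c

    part₁ : ∀ p q → 1 ℕ.≤ p → 1 ℕ.≤ q → Conclusion₁ α p q
    part₁ p q 1≤p 1≤q = convert (infinitely-often {L} approximable p q 1≤p q≤)
      where
      -- The index q makes L + 1 ≥ q; being a successor, it also guarantees a symmetric E.
      B = factorisation (suc q)
      open BalancedFactorisation B using (L; t)
      approximable : Approximable α (suc L) (L ℕ.+ L)
      approximable = GC.General.generalApproximable α q₀ 1≤q₀ a₀ b₀ b₀≢0 q₀α≡ 0<y₀ B
        (λ n → trans (BalancedFactorisation.swap B n) (*-identityˡ _))
      q≤ : q ℕ.≤ suc L
      q≤ = ℕₚ.≤-trans (ℕₚ.n≤1+n q) (ℕₚ.≤-trans (n≤t (suc q)) (ℕₚ.≤-trans (ℕₚ.m≤m+n t t) (ℕₚ.m≤n+m _ 2)))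
      convert : (∃ λ C → 1 ℕ.≤ C × (∀ M → GapBeyond M C p q)) → Conclusion₁ α p q
      convert (C , 1≤C , f) = ℕ→ℚ C , ℕ→ℚ-pos 1≤C , λ N₀ → each (f N₀)
        where
        each : ∀ {N₀} → GapBeyond N₀ C p q →
          ∃ λ N → N₀ ℕ.≤ N × DeltaMinLe α N (λ g → ((ιℕ N *K g) ^K q) ≤K ((ι (ℕ→ℚ C) ^K q) *K (ιℕ N ^K p)))
        each (N , N₀≤N , G , c , 0≤G , bound) = N , N₀≤N , ConsecutiveGap⇒DeltaMinLe c λ g 0≤g g≤G → ≤⇒≤K (begin
          (ιℕ N *K g) ^K q ≡⟨ trans (^K≡^ (ιℕ N *K g) q) (cong (λ z → (z * g) ^ q) (ιℕ≡fromℕ N)) ⟩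
          (fromℕ N * g) ^ q ≤⟨ ^-mono-≤ q (*-nonNeg (fromℕ-nonNeg N) 0≤g) (*-monoˡ-≤ (fromℕ N) (fromℕ-nonNeg N) g≤G) ⟩
          (fromℕ N * G) ^ q ≤⟨ bound ⟩
          fromℕ C ^ q * fromℕ N ^ p ≡⟨ cong₂ _*_ (sym (trans (^K≡^ (ιℕ C) q) (cong (_^ q) (ιℕ≡fromℕ C)))) (sym (trans (^K≡^ (ιℕ N) p) (cong (_^ p) (ιℕ≡fromℕ N)))) ⟩
          (ι (ℕ→ℚ C) ^K q) *K (ιℕ N ^K p) ∎)
          where open ≤-Reasoning

    module _ (p q : ℕ) (u v : ℤ) (1≤p : 1 ℕ.≤ p) (1≤q : 1 ℕ.≤ q)
      (qα≡ : fromℕ q * α ≡ fromℕ p * ((fromℤ u + fromℤ v * √D) * (fromℤ u + fromℤ v * √D))) where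

      private
        imaginary : proj₂ (fromℕ p * ((fromℤ u + fromℤ v * √D) * (fromℤ u + fromℤ v * √D))) ≡ Q.fromℕ p ℚ.* (Q.fromℤ u ℚ.* Q.fromℤ v ℚ.+ Q.fromℤ v ℚ.* Q.fromℤ u)
        imaginary = trans (fromℕ*-proj₂ p _) (cong (λ z → Q.fromℕ p ℚ.* proj₂ (z * z)) (integer-coordinates u v))
        qα₂≢0 : proj₂ (fromℕ q * α) ≢ 0ℚ
        qα₂≢0 e = Q.*-≢0 (Qfromℕ-≢0 1≤q) α₂≢0 (trans (sym (fromℕ*-proj₂ q α)) e)
        -- The coefficient of √D in q α is 2puv, and α is irrational.
        uv≢0 : Q.fromℤ u ℚ.* Q.fromℤ v ≢ 0ℚ
        uv≢0 e = qα₂≢0 (trans (cong proj₂ qα≡) (trans imaginary (trans (cong (Q.fromℕ p ℚ.*_) (cong₂ ℚ._+_ e (trans (Q.*-comm (Q.fromℤ v) (Q.fromℤ u)) e))) (Q.zeroʳ (Q.fromℕ p)))))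
        u≢0 : u ≢ 0ℤ
        u≢0 = Qfromℤ-≢0 λ e → uv≢0 (trans (cong (ℚ._* Q.fromℤ v) e) (Q.zeroˡ (Q.fromℤ v)))
        v≢0 : v ≢ 0ℤ
        v≢0 = Qfromℤ-≢0 λ e → uv≢0 (trans (cong (Q.fromℤ u ℚ.*_) e) (Q.zeroʳ (Q.fromℤ u)))

      positive-root : 0# ≤ fromℤ u + fromℤ v * √D → Approximable α 1 2
      positive-root 0≤γ = SC.SquareClass.squareApproximable α p q 1≤p 1≤q u v u≢0 v≢0
        (0≤γ , λ e → v≢0 (√D-irrational u v (sym e))) qα≡

    -- Only γ² matters, so γ may be replaced by -γ to make it positive.
    approximable-square : ∀ p q u v → 1 ℕ.≤ p → 1 ℕ.≤ q →
      fromℕ q * α ≡ fromℕ p * ((fromℤ u + fromℤ v * √D) * (fromℤ u + fromℤ v * √D)) → Approximable α 1 2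
    approximable-square p q u v 1≤p 1≤q e = sign (≤-total 0# γ)
      where
      γ : K
      γ = fromℤ u + fromℤ v * √D
      -γ≡ : - γ ≡ fromℤ (ℤ.- u) + fromℤ (ℤ.- v) * √D
      -γ≡ = trans (solve 3 (λ u v w → :- (u :+ v :* w) := :- u :+ (:- v) :* w) refl (fromℤ u) (fromℤ v) √D)
        (sym (cong₂ (λ x y → x + y * √D) (fromℤ-neg u) (fromℤ-neg v)))
      sign : 0# ≤ γ ⊎ γ ≤ 0# → Approximable α 1 2
      sign (inj₁ 0≤γ) = positive-root p q u v 1≤p 1≤q e 0≤γ
      sign (inj₂ γ≤0) = positive-root p q (ℤ.- u) (ℤ.- v) 1≤p 1≤q
        (trans e (cong (fromℕ p *_) (trans (solve 1 (λ x → x :* x := (:- x) :* (:- x)) refl γ) (cong₂ _*_ -γ≡ -γ≡))))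
        (subst (0# ≤_) -γ≡ (0≤-neg γ≤0))

    part₂ : (Σ ℚ λ r → Σ K λ γ → (0ℚ ℚ.< r) × γ ≢ (0ℚ , 0ℚ) × α ≡ (ι r *K (γ *K γ))) →
      Conclusion₂ α
    part₂ (r , γ , 0<r , γ≢0 , α≡) = convert (always (root (clearDenominators γ) (numerator-pos r 0<r)))
      where
      root : (∃ λ s → ∃ λ u → ∃ λ v → 1 ℕ.≤ s × fromℕ s * γ ≡ fromℤ u + fromℤ v * √D) → (∃ λ k → ℚ.↥ r ≡ pos (suc k)) → Approximable α 1 2
      -- With r = n / d, the equation α = r γ² becomes d s² α = n (s γ)², where s γ has integer
      -- coordinates.
      root (s , u , v , 1≤s , sγ≡) (k , ↥r≡) = approximable-square (suc k) (ℚ.↧ₙ r ℕ.* (s ℕ.* s)) u v (ℕ.s≤s ℕ.z≤n)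
        (ℕₚ.*-mono-≤ {1} {ℚ.↧ₙ r} (ℕ.s≤s ℕ.z≤n) (ℕₚ.*-mono-≤ 1≤s 1≤s)) (begin
          fromℕ (ℚ.↧ₙ r ℕ.* (s ℕ.* s)) * α ≡⟨ cong₂ _*_ (trans (fromℕ-* (ℚ.↧ₙ r) (s ℕ.* s)) (cong (fromℕ (ℚ.↧ₙ r) *_) (fromℕ-* s s))) α≡ ⟩
          (fromℕ (ℚ.↧ₙ r) * (fromℕ s * fromℕ s)) * (ι r * (γ * γ))
            ≡⟨ solve 4 (λ d s r g → (d :* (s :* s)) :* (r :* (g :* g)) := (d :* r) :* ((s :* g) :* (s :* g))) refl (fromℕ (ℚ.↧ₙ r)) (fromℕ s) (ι r) γ ⟩
          (fromℕ (ℚ.↧ₙ r) * ι r) * ((fromℕ s * γ) * (fromℕ s * γ)) ≡⟨ cong₂ _*_ dr≡ (cong₂ _*_ sγ≡ sγ≡) ⟩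
          fromℕ (suc k) * ((fromℤ u + fromℤ v * √D) * (fromℤ u + fromℤ v * √D)) ∎)
        where
        open ≡-Reasoning
        dr≡ : fromℕ (ℚ.↧ₙ r) * ι r ≡ fromℕ (suc k)
        dr≡ = begin
          fromℕ (ℚ.↧ₙ r) * ι r ≡⟨ cong (_* ι r) (fromℕ≡ι (ℚ.↧ₙ r)) ⟩
          ι (Q.fromℕ (ℚ.↧ₙ r)) * ι r ≡⟨ ι-scale (Q.fromℕ (ℚ.↧ₙ r)) r ⟩
          ι (Q.fromℕ (ℚ.↧ₙ r) ℚ.* r) ≡⟨ cong ι (clearDenominator r) ⟩
          ι (Q.fromℤ (ℚ.↥ r)) ≡⟨ sym (fromℤ≡ι (ℚ.↥ r)) ⟩
          fromℤ (ℚ.↥ r) ≡⟨ cong fromℤ ↥r≡ ⟩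
          fromℕ (suc k) ∎
      convert : (∃ λ C → 1 ℕ.≤ C × (∀ N → 2 ℕ.≤ N → ∃ λ G → ConsecutiveGap N G × fromℕ N * G ≤ fromℕ C)) → Conclusion₂ α
      convert (C , 1≤C , f) = ℕ→ℚ C , ℕ→ℚ-pos 1≤C , λ N 2≤N → each N (f N 2≤N)
        where
        each : ∀ N → (∃ λ G → ConsecutiveGap N G × fromℕ N * G ≤ fromℕ C) → DeltaMinLe α N (λ g → (ιℕ N *K g) ≤K ι (ℕ→ℚ C))
        each N (G , c , bound) = ConsecutiveGap⇒DeltaMinLe c λ g 0≤g g≤G → ≤⇒≤K (begin
          ιℕ N *K g ≡⟨ cong (_* g) (ιℕ≡fromℕ N) ⟩
          fromℕ N * g ≤⟨ *-monoˡ-≤ (fromℕ N) (fromℕ-nonNeg N) g≤G ⟩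
          fromℕ N * G ≤⟨ bound ⟩
          fromℕ C ≡⟨ sym (ιℕ≡fromℕ C) ⟩
          ι (ℕ→ℚ C) ∎)
          where open ≤-Reasoning

open import Data.Nat using (ℕ; _≤_; _<_)
import Data.Rational

theorem1p2 : (D : ℕ) → 2 ≤ D → SquareFree D →
    let open Field D in
    (α : K) → proj₂ α ≢ 0ℚ → Pos α →
    (∀ (p q : ℕ) → 1 ≤ p → 1 ≤ q →
    Σ ℚ λ C → (Data.Rational._<_ 0ℚ C) ×
    (∀ N₀ → ∃ λ N → N₀ ≤ N ×
    DeltaMinLe α N (λ g → ((ιℕ N *K g) ^K q) ≤K ((ι C ^K q) *K (ιℕ N ^K p)))))
    ×
    ((Σ ℚ λ r → Σ K λ γ → (Data.Rational._<_ 0ℚ r) × γ ≢ (0ℚ , 0ℚ) × α ≡ (ι r *K (γ *K γ))) →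
    Σ ℚ λ C → (Data.Rational._<_ 0ℚ C) ×
    (∀ N → 2 ≤ N → DeltaMinLe α N (λ g → (ιℕ N *K g) ≤K ι C)))
theorem1p2 D 2≤D squareFree α α₂≢0 0<α = slope (clearDenominators α)
  where
  open Field D
  open QuadraticField D 2≤D squareFree
  open OrderedDomainProperties orderedDomain using (fromℕ; fromℤ; _+_; _*_)
  open GapBounds D 2≤D squareFree

  slope : (∃ λ q → ∃ λ a → ∃ λ b → 1 ≤ q × fromℕ q * α ≡ fromℤ a + fromℤ b * √D) →
    (∀ p q → 1 ≤ p → 1 ≤ q → Conclusion₁ α p q) ×
    ((Σ ℚ λ r → Σ K λ γ → (0ℚ ℚ.< r) × γ ≢ (0ℚ , 0ℚ) × α ≡ (ι r *K (γ *K γ))) → Conclusion₂ α)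
  slope (q , a , b , 1≤q , qα≡) = part₁ , part₂
    where open WithSlope α α₂≢0 (Pos⇒0< α 0<α) q a b 1≤q qα≡
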